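{- Let $c\in\mathbb F_q$ be such that $x^2-x-c\in\mathbb F_q[x]$ is irreducible, let $\theta\in\mathbb F_{q^2}$ be a root of it, and let $t\ge 2$ be an integer such that every prime factor of $t$ divides $q^2-1$. Let $g(x)\in\mathbb F_q[x]$ be an irreducible polynomial of degree $n$ such that $g(-\theta)\ne0$. If $n$ is even, let $r(x)\in\mathbb F_{q^2}[x]$ be an irreducible factor of $g(x)$ in $\mathbb F_{q^2}[x]$. Define $g_0=g$ and $g_m=g_{m-1}^{Q_{c,t}}$ for $m\ge1$. If $n$ is odd (resp. if $n$ is even), assume that for all primes $\ell\mid t$, the element $\frac{g(-\theta^q)}{g(-\theta)}$ (resp. $\frac{r(-\theta^q)}{r(-\theta)}$) is not an $\ell$-th power in $\mathbb F_{q^2}$. Then, if $n$ is odd or if $4\mid nt$, all polynomials $g_m$, $m\ge0$, are irreducible in $\mathbb F_q[x]$.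
   Context: $\mathbb F_q$ is the finite field with $q$ elements. With $c,\theta,t$ as in the statement, set $$f(x)=\frac{\theta(x+\theta^q)^t-\theta^q(x+\theta)^t}{\theta^q-\theta},\qquad h(x)=\frac{(x+\theta)^t-(x+\theta^q)^t}{\theta^q-\theta};$$ both polynomials belong to $\mathbb F_q[x]$. For a nonzero polynomial $g(x)\in\mathbb F_q[x]$, set $$g^{Q_{c,t}}(x)=h(x)^{\deg g}\, g\left(\frac{f(x)}{h(x)}\right).$$ The element $0$ counts as an $\ell$-th power. -}

module Defs where

open import Algebra.Apartness.Bundles using (HeytingCommutativeRing; HeytingField)
open import Algebra.Bundles using (CommutativeRing)
open import Algebra.Bundles.Raw using (RawRing)
open import Algebra.Morphism.Structures using (module RingMorphisms)
import Algebra.Definitions.RawSemiring as RawSemiringDefinitions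
open import Data.Bool.Base using (if_then_else_)
open import Data.Fin.Base using (Fin; toℕ)
import Data.Fin.Properties as Fin
open import Data.List.Base using (List; []; _∷_; map)
open import Data.List.Relation.Unary.All using (all?)
open import Data.Nat.Base using (ℕ; zero; suc; _∸_)
open import Data.Product.Base using (∃-syntax; _×_; _,_)
open import Function.Bundles using (Inverse)
open import Function.Properties.Inverse using (Inverse⇒Injection)
open import Level using (_⊔_) renaming (suc to lsuc)
open import Relation.Binary.Definitions using (Decidable)
import Relation.Binary.PropositionalEquality.Properties as ≡
open import Relation.Nullary using (yes; no; does)
open import Relation.Nullary.Decidable using (via-injection)

-- On a finite carrier equality and invertibility are decidable, so the
-- apartness of the Heyting field coincides with inequality and this is a
-- field with q elements in the usual sense.

record FiniteField a ℓ₁ ℓ₂ (q : ℕ) : Set (lsuc (a ⊔ ℓ₁ ⊔ ℓ₂)) where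
  field
    heytingField : HeytingField a ℓ₁ ℓ₂

  open HeytingField heytingField public
  open HeytingCommutativeRing heytingCommutativeRing public using (commutativeRing)
  open CommutativeRing commutativeRing public using (rawRing; _≉_)

  field
    enumeration : Inverse setoid (≡.setoid (Fin q))

  open RawSemiringDefinitions (RawRing.rawSemiring rawRing) public using (_^_)

  infix 4 _≟_
  _≟_ : Decidable _≈_
  _≟_ = via-injection (Inverse⇒Injection enumeration) Fin._≟_

  -- Total inverse, found by search; 0# ⁻¹ is 0#.
  infix 9 _⁻¹
  _⁻¹ : Carrier → Carrier
  x ⁻¹ with Fin.any? (λ i → x * Inverse.from enumeration i ≟ 1#)
  ... | yes (i , _) = Inverse.from enumeration i
  ... | no _        = 0#

  infixl 7 _/_
  _/_ : Carrier → Carrier → Carrier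
  x / y = x * y ⁻¹

  _IsPower_ : Carrier → ℕ → Set (a ⊔ ℓ₁)
  x IsPower ℓ = ∃[ y ] y ^ ℓ ≈ x

-- F[x]. A polynomial is its list of coefficients, constant term first.
-- Trailing zeros are allowed and are disregarded by _≈_.

module Polynomial {a ℓ₁ ℓ₂ q} (F : FiniteField a ℓ₁ ℓ₂ q) where

  private module F = FiniteField F

  Poly : Set a
  Poly = List F.Carrier

  coeff : Poly → ℕ → F.Carrier
  coeff []      _       = F.0#
  coeff (x ∷ _) zero    = x
  coeff (_ ∷ p) (suc i) = coeff p i

  infix 4 _≈_
  _≈_ : Poly → Poly → Set ℓ₁
  p ≈ r = ∀ i → coeff p i F.≈ coeff r i

  infixl 6 _+_ _-_
  infixl 7 _*_ _·_
  infix  8 -_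

  _+_ : Poly → Poly → Poly
  []      + r       = r
  p       + []      = p
  (x ∷ p) + (y ∷ r) = (x F.+ y) ∷ (p + r)

  -_ : Poly → Poly
  - p = map (λ x → F.- x) p

  _-_ : Poly → Poly → Poly
  p - r = p + (- r)

  _·_ : F.Carrier → Poly → Poly
  x · p = map (x F.*_) p

  _*_ : Poly → Poly → Poly
  []      * r = []
  (x ∷ p) * r = x · r + (F.0# ∷ p * r)

  rawRing : RawRing a ℓ₁
  rawRing = record
    { Carrier = Poly
    ; _≈_     = _≈_
    ; _+_     = _+_
    ; _*_     = _*_
    ; -_      = -_
    ; 0#      = []
    ; 1#      = F.1# ∷ []
    }

  open RawSemiringDefinitions (RawRing.rawSemiring rawRing) public
    using (_^_; _∣_; Irreducible; sum)

  eval : Poly → F.Carrier → F.Carrier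
  eval []      _ = F.0#
  eval (x ∷ p) y = x F.+ y F.* eval p y

  -- The zero polynomial gets degree 0.
  deg : Poly → ℕ
  deg []      = 0
  deg (_ ∷ p) = if does (all? (F._≟ F.0#) p) then 0 else suc (deg p)

  x+_ : F.Carrier → Poly
  x+ y = y ∷ F.1# ∷ []

  x²-x-_ : F.Carrier → Poly
  x²-x- y = (F.- y) ∷ (F.- F.1#) ∷ F.1# ∷ []

-- With s = q² a ring homomorphism ι : K → L (necessarily injective) plays the
-- role of the inclusion of 𝔽_q in 𝔽_{q²}.

module Extension
  {a ℓ₁ ℓ₂ b ℓ₃ ℓ₄ q s} (K : FiniteField a ℓ₁ ℓ₂ q) (L : FiniteField b ℓ₃ ℓ₄ s)
  (ι : FiniteField.Carrier K → FiniteField.Carrier L)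
  where

  private
    module K[x] = Polynomial K
    module L[x] = Polynomial L

  open RingMorphisms (FiniteField.rawRing K) (FiniteField.rawRing L) public
    using (IsRingHomomorphism)

  ι[x] : K[x].Poly → L[x].Poly
  ι[x] = map ι

  -- The polynomial p over L lies in K[x] and is irreducible there.
  IrreducibleInK[x] : L[x].Poly → Set (a ⊔ ℓ₁ ⊔ ℓ₃)
  IrreducibleInK[x] p = ∃[ p₀ ] (ι[x] p₀ L[x].≈ p) × K[x].Irreducible p₀

-- The transform g ↦ g^Q. The polynomials f and h are written, as their
-- defining formulas are, with coefficients in L; that f, h and the g^Q of a
-- g in K[x] have coefficients in K is not built into the definitions.

module Transform {a ℓ₁ ℓ₂ s} (L : FiniteField a ℓ₁ ℓ₂ s) (q t : ℕ)
                 (θ : FiniteField.Carrier L) where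

  private module L = FiniteField L
  open Polynomial L

  θ^q : L.Carrier
  θ^q = θ L.^ q

  f : Poly
  f = ((θ^q L.- θ) L.⁻¹) · (θ · (x+ θ^q) ^ t - θ^q · (x+ θ) ^ t)

  h : Poly
  h = ((θ^q L.- θ) L.⁻¹) · ((x+ θ) ^ t - (x+ θ^q) ^ t)

  -- h^n g(f/h), with n = deg g, after clearing denominators:
  -- the sum over 0 ≤ i ≤ n of gᵢ fⁱ hⁿ⁻ⁱ.
  _^Q : Poly → Poly
  g ^Q = sum {suc (deg g)} λ i →
    coeff g (toℕ i) · (f ^ toℕ i * h ^ (deg g ∸ toℕ i))

  iterateQ : Poly → ℕ → Poly
  iterateQ g zero    = g
  iterateQ g (suc m) = (iterateQ g m) ^Q

{-# OPTIONS --safe #-}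

-- Since f + τ h = -(x + τ)^t for τ = θ and τ = θ^q, the Möbius map
-- x ↦ (x + θ^q)/(x + θ) conjugates x ↦ f(x)/h(x) to the t-th power map. Write
-- Q = q². Let r be irreducible of degree d over L, α one of its roots, N = Q^d,
-- β a root of r^Q with f(β)/h(β) = α, a = (α + θ^q)/(α + θ) and
-- b = (β + θ^q)/(β + θ), so that b^t = a. By taking norms to L,
-- a^((N - 1)/(Q - 1)) = r(-θ^q)/r(-θ). As this is not an ℓ-th power for any
-- prime ℓ ∣ t, the element ζ = b^(N - 1) has order exactly t. If β has degree
-- de over L, then b^(N^e) = b gives ζ^((N^e - 1)/(N - 1)) = 1, whence t divides
-- (N^e - 1)/(N - 1) and, by lifting the exponent, t ∣ e. So r^Q is irreducible
-- of degree dt, and the hypothesis on r(-θ^q)/r(-θ) passes on to it.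
--
-- For the descent to K let β be a root of the m-th iterate of an irreducible
-- factor r of g over L. If β^(q^k) = β, then n ∣ k, because the image of β under
-- the m-fold map f/h is a root of g; together with the degree of β over L this
-- gives n t^m ∣ k. Hence a factor of g_m over K with root β has degree n t^m.
--
-- A root β of an irreducible polynomial of degree e over a field with Q elements
-- satisfies β^(Q^v) = β exactly if e ∣ v, and the Q-th power map is additive
-- because (X + 1)^Q - X^Q - 1 has degree less than Q and vanishes on the field.

module Submission where

open import Defs
open import Algebra.Definitions.RawMagma using (_,_)
open import Algebra.Apartness.Bundles using (HeytingField)
open import Algebra.Bundles using (CommutativeRing; RawRing)
open import Algebra.Morphism.Construct.Composition using () renaming (isRingHomomorphism to isRingHomomorphism-∘)
open import Algebra.Morphism.Construct.Identity using () renaming (isRingHomomorphism to isRingHomomorphism-id)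
open import Algebra.Morphism.Structures using (module RingMorphisms)
open import Algebra.Solver.Ring.AlmostCommutativeRing
  using (fromCommutativeRing; _-Raw-AlmostCommutative⟶_)
open import Data.Empty using (⊥; ⊥-elim)
open import Data.Fin.Base as Fin using (Fin; toℕ)
import Data.Fin.Permutation as Perm
import Data.Fin.Properties as Finₚ
open import Data.Integer.Base as ℤ using (ℤ; +_; -[1+_])
import Data.Integer.Properties as ℤₚ
open import Data.List.Base as List using (List; []; _∷_; map)
import Data.List.Properties as Listₚ
open import Data.List.Relation.Unary.All using (All; []; _∷_; all?)
open import Data.Maybe.Base using (Maybe; just; nothing)
open import Data.Nat.Base as ℕ using (ℕ; zero; suc; z≤n; s≤s)
import Data.Nat.Properties as ℕₚ
import Data.Nat.Divisibility as ℕ∣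
open import Data.Nat.Divisibility using (divides; divides-refl) renaming (_∣_ to _∣ℕ_)
open import Data.Nat.Coprimality as Coprimality using (Coprime; coprime-divisor)
open import Data.Nat.GCD using (gcd; gcd-GCD; gcd[m,n]∣m; gcd[m,n]∣n; module Bézout)
open import Data.Nat.ListAction using (product)
open import Data.Nat.Primality using (Prime; ¬prime[1]; prime[2]; prime⇒nonZero; prime⇒nonTrivial;
  prime⇒irreducible; irreducible[2]; euclidsLemma)
open import Data.Nat.Primality.Factorisation using (factorise)
open import Data.Nat.Tactic.RingSolver using (solve-∀)
open import Data.Nat.DivMod using (_%_; _/_; m≡m%n+[m/n]*n; m%n<n)
open import Data.Product.Base using (∃; ∃-syntax; _×_; _,_; proj₁; proj₂)
open import Data.Sum.Base using (_⊎_; inj₁; inj₂)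
open import Function.Base using (_∘_; id)
open import Function.Bundles using (Inverse)
open import Level as Level using (_⊔_)
open import Relation.Binary.PropositionalEquality as ≡ using (_≡_; _≢_)
open import Relation.Binary.Definitions using (tri<; tri≈; tri>)
open import Relation.Nullary using (¬_; yes; no)
open import Relation.Nullary.Decidable using (Dec)

-- The delicate point is why the non-power hypothesis survives a transform. Both -θ and -θ^q are
-- fixed points of f/h, so passing from r to r^Q multiplies r(-θ^q)/r(-θ) by a power of
-- h(-θ^q)/h(-θ) = (-1)^(t-1). For even t this sign must be invisible to the test ρ ↦ ρ^((Q - 1)/ℓ).
-- It is, because 2 then divides q² - 1, so q is odd, 4 divides Q - 1 and every (Q - 1)/ℓ is even.
-- The same divisibility by 4 is what lifting the exponent requires at the prime 2. For this reason
-- non-powers are carried through the iteration in the form ρ^((Q - 1)/ℓ) ≠ 1. No algebraic closure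
-- appears: roots live in F[x]/(s) for irreducible s, and a fact about one root of s reaches the
-- roots of s in other fields as a divisibility in F[x]. In the descent with n even, every k with
-- β^(q^k) = β is a multiple of n, hence even, so that k = 2l gives β^(Q^l) = β; together with n ∣ 2
-- deg r this yields n t^m ∣ k.

-- Integer coefficients for the ring solver.

module IntegerCoefficients {c ℓ} (R : CommutativeRing c ℓ) where
  open CommutativeRing R
  open import Algebra.Properties.Ring ring
  open import Algebra.Properties.AbelianGroup +-abelianGroup using (⁻¹-∙-comm)
  open import Algebra.Properties.Semiring.Mult.TCOptimised semiring
    using (1+×; ×-homo-+; ×1-homo-*)
  open import Algebra.Definitions.RawSemiring (RawRing.rawSemiring rawRing) using () renaming (_×′_ to _·1_)
  open import Relation.Binary.Reasoning.Setoid setoid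

  -- In this variant of multiples one copy of `1#` is `1#` itself and not a sum with `0#`, so the
  -- solver literal `con (+ 1)` denotes `1#` by computation.
  ⟦_⟧ : ℤ → Carrier
  ⟦ + n ⟧      = n ·1 1#
  ⟦ -[1+ n ] ⟧ = - (suc n ·1 1#)

  -‿homo : ∀ i → ⟦ ℤ.- i ⟧ ≈ - ⟦ i ⟧
  -‿homo (+ zero)  = sym -0#≈0#
  -‿homo (+ suc n) = refl
  -‿homo -[1+ n ]  = sym (-‿involutive _)

  ⊖-homo : ∀ m n → ⟦ m ℤ.⊖ n ⟧ ≈ m ·1 1# - n ·1 1#
  ⊖-homo m zero = trans (sym (+-identityʳ _)) (+-congˡ (sym -0#≈0#))
  ⊖-homo zero (suc n) = sym (+-identityˡ _)
  ⊖-homo (suc m) (suc n) = begin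
    ⟦ suc m ℤ.⊖ suc n ⟧       ≡⟨ ≡.cong ⟦_⟧ (ℤₚ.[1+m]⊖[1+n]≡m⊖n m n) ⟩
    ⟦ m ℤ.⊖ n ⟧               ≈⟨ ⊖-homo m n ⟩
    m ·1 1# - n ·1 1#         ≈⟨ shift (m ·1 1#) (n ·1 1#) ⟨
    (1# + m ·1 1#) - (1# + n ·1 1#) ≈⟨ +-cong (1+× m 1#) (-‿cong (1+× n 1#)) ⟨
    suc m ·1 1# - suc n ·1 1# ∎
    where
    shift : ∀ x y → (1# + x) - (1# + y) ≈ x - y
    shift x y = begin
      (1# + x) - (1# + y)       ≈⟨ +-cong (+-comm 1# x) (sym (⁻¹-∙-comm 1# y)) ⟩
      (x + 1#) + (- 1# + - y)   ≈⟨ +-assoc x 1# _ ⟩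
      x + (1# + (- 1# + - y))   ≈⟨ +-congˡ (+-assoc 1# (- 1#) (- y)) ⟨
      x + ((1# + - 1#) + - y)   ≈⟨ +-congˡ (+-congʳ (-‿inverseʳ 1#)) ⟩
      x + (0# + - y)            ≈⟨ +-congˡ (+-identityˡ _) ⟩
      x - y                     ∎

  +-homo : ∀ i j → ⟦ i ℤ.+ j ⟧ ≈ ⟦ i ⟧ + ⟦ j ⟧
  +-homo (+ m)    (+ n)    = ×-homo-+ 1# m n
  +-homo (+ m)    -[1+ n ] = ⊖-homo m (suc n)
  +-homo -[1+ m ] (+ n)    = trans (⊖-homo n (suc m)) (+-comm _ _)
  +-homo -[1+ m ] -[1+ n ] = begin
    - (suc (suc (m ℕ.+ n)) ·1 1#)    ≡⟨ ≡.cong (λ k → - (suc k ·1 1#)) (ℕₚ.+-suc m n) ⟨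
    - ((suc m ℕ.+ suc n) ·1 1#)      ≈⟨ -‿cong (×-homo-+ 1# (suc m) (suc n)) ⟩
    - (suc m ·1 1# + suc n ·1 1#)    ≈⟨ ⁻¹-∙-comm _ _ ⟨
    - (suc m ·1 1#) + - (suc n ·1 1#) ∎

  *-homo : ∀ i j → ⟦ i ℤ.* j ⟧ ≈ ⟦ i ⟧ * ⟦ j ⟧
  *-homo-+ : ∀ m j → ⟦ + m ℤ.* j ⟧ ≈ (m ·1 1#) * ⟦ j ⟧
  *-homo-+ m (+ n) = trans (reflexive (≡.cong ⟦_⟧ (≡.sym (ℤₚ.pos-* m n)))) (×1-homo-* m n)
  *-homo-+ m -[1+ n ] = begin
    ⟦ + m ℤ.* -[1+ n ] ⟧        ≡⟨ ≡.cong ⟦_⟧ (ℤₚ.neg-distribʳ-* (+ m) (+ suc n)) ⟨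
    ⟦ ℤ.- (+ m ℤ.* + suc n) ⟧   ≈⟨ -‿homo (+ m ℤ.* + suc n) ⟩
    - ⟦ + m ℤ.* + suc n ⟧       ≈⟨ -‿cong (*-homo-+ m (+ suc n)) ⟩
    - ((m ·1 1#) * (suc n ·1 1#)) ≈⟨ -‿distribʳ-* _ _ ⟩
    (m ·1 1#) * - (suc n ·1 1#)   ∎
  *-homo (+ m) j = *-homo-+ m j
  *-homo -[1+ m ] j = begin
    ⟦ -[1+ m ] ℤ.* j ⟧         ≡⟨ ≡.cong ⟦_⟧ (ℤₚ.neg-distribˡ-* (+ suc m) j) ⟨
    ⟦ ℤ.- (+ suc m ℤ.* j) ⟧    ≈⟨ -‿homo (+ suc m ℤ.* j) ⟩
    - ⟦ + suc m ℤ.* j ⟧        ≈⟨ -‿cong (*-homo-+ (suc m) j) ⟩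
    - ((suc m ·1 1#) * ⟦ j ⟧)  ≈⟨ -‿distribˡ-* _ _ ⟩
    - (suc m ·1 1#) * ⟦ j ⟧    ∎

  morphism : ℤ.+-*-rawRing -Raw-AlmostCommutative⟶ fromCommutativeRing R
  morphism = record
    { ⟦_⟧ = ⟦_⟧ ; +-homo = +-homo ; *-homo = *-homo ; -‿homo = -‿homo
    ; 0-homo = refl ; 1-homo = refl }

  -- Comparing the integers themselves is sound but incomplete: in characteristic p distinct
  -- integers may have the same image, and the answer is then `nothing`.
  _coeff≟_ : ∀ i j → Maybe (⟦ i ⟧ ≈ ⟦ j ⟧)
  i coeff≟ j with i ℤₚ.≟ j
  ... | yes i≡j = just (reflexive (≡.cong ⟦_⟧ i≡j))
  ... | no _    = nothing

  open import Algebra.Solver.Ring _ _ morphism _coeff≟_ public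
    using (Polynomial; con; _:+_; _:*_; _:-_; :-_; _:=_; solve)

-- Arithmetic in a finite field and Fermat's theorem.

module FieldProperties {a ℓ₁ ℓ₂ Q} (F : FiniteField a ℓ₁ ℓ₂ Q) where
  private module F = FiniteField F
  open F public using (enumeration; _≟_; _⁻¹; _/_; _IsPower_; _^_)
  commutativeRing : CommutativeRing a ℓ₁
  commutativeRing = F.commutativeRing
  open CommutativeRing commutativeRing public
  open Inverse enumeration public using (to; from; to-cong; from-cong; strictlyInverseˡ; strictlyInverseʳ)
  open import Algebra.Properties.Ring ring public
    using (-0#≈0#; -‿involutive; -‿distribˡ-*; -‿distribʳ-*)
  open import Algebra.Properties.Group +-group public using ()
    renaming (x∙y⁻¹≈ε⇒x≈y to x-y≈0⇒x≈y; x≈y⇒x∙y⁻¹≈ε to x≈y⇒x-y≈0)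
  open import Algebra.Properties.Semiring.Exp semiring public
    using (^-congˡ; ^-congʳ; ^-homo-*; ^-assocʳ)
  open import Algebra.Properties.CommutativeSemiring.Exp commutativeSemiring public
    using (^-distrib-*)
  open import Algebra.Properties.CommutativeMonoid.Sum *-commutativeMonoid public
    using () renaming (sum to prod; sum-cong-≋ to prod-cong; sum-remove to prod-remove;
                       sum-permute to prod-permute; ∑-distrib-+ to prod-*; sum-replicate to prod-replicate)
  open import Relation.Binary.Reasoning.Setoid setoid

  -- If the two agreed, `0#` would be an inverse of `0# - 0#`, so `0#` would be apart from itself,
  -- against tightness.
  1≉0 : 1# ≉ 0#
  1≉0 1≈0 = proj₂ (F.tight 0# 0#) refl
    (F.invertible⇒# (0# , trans (zeroˡ _) (sym 1≈0) , trans (zeroʳ _) (sym 1≈0)))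

  inverseʳ : ∀ {x} → x ≉ 0# → x * x ⁻¹ ≈ 1#
  inverseʳ {x} x≉0 with Finₚ.any? (λ i → x * from i ≟ 1#)
  ... | yes (i , xy≈1) = xy≈1
  -- A failed search shows that `x` is not apart from `0#`, because apartness supplies an inverse of
  -- `x - 0#`; tightness then gives `x ≈ 0#`.
  ... | no ¬inv = ⊥-elim (x≉0 (proj₁ (F.tight x 0#) λ x#0 →
    let y , _ , xy≈1 = F.#⇒invertible x#0 in
    ¬inv (to y , (begin
      x * from (to y)     ≈⟨ *-cong (trans (sym (+-identityʳ x)) (+-congˡ (sym -0#≈0#))) (strictlyInverseʳ y) ⟩
      (x - 0#) * y        ≈⟨ xy≈1 ⟩
      1#                  ∎))))

  inverseˡ : ∀ {x} → x ≉ 0# → x ⁻¹ * x ≈ 1#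
  inverseˡ x≉0 = trans (*-comm _ _) (inverseʳ x≉0)

  *-cancelˡ : ∀ {x y z} → x ≉ 0# → x * y ≈ x * z → y ≈ z
  *-cancelˡ {x} {y} {z} x≉0 xy≈xz = begin
    y                ≈⟨ *-identityˡ y ⟨
    1# * y           ≈⟨ *-congʳ (inverseˡ x≉0) ⟨
    (x ⁻¹ * x) * y   ≈⟨ *-assoc _ _ _ ⟩
    x ⁻¹ * (x * y)   ≈⟨ *-congˡ xy≈xz ⟩
    x ⁻¹ * (x * z)   ≈⟨ *-assoc _ _ _ ⟨
    (x ⁻¹ * x) * z   ≈⟨ *-congʳ (inverseˡ x≉0) ⟩
    1# * z           ≈⟨ *-identityˡ z ⟩
    z                ∎

  *-cancelʳ : ∀ {x y z} → x ≉ 0# → y * x ≈ z * x → y ≈ z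
  *-cancelʳ x≉0 eq = *-cancelˡ x≉0 (trans (*-comm _ _) (trans eq (*-comm _ _)))

  x*y≉0 : ∀ {x y} → x ≉ 0# → y ≉ 0# → x * y ≉ 0#
  x*y≉0 x≉0 y≉0 xy≈0 = y≉0 (*-cancelˡ x≉0 (trans xy≈0 (sym (zeroʳ _))))

  x*y≈0⇒y≈0 : ∀ {x y} → x ≉ 0# → x * y ≈ 0# → y ≈ 0#
  x*y≈0⇒y≈0 x≉0 xy≈0 = *-cancelˡ x≉0 (trans xy≈0 (sym (zeroʳ _)))

  -x≉0 : ∀ {x} → x ≉ 0# → - x ≉ 0#
  -x≉0 x≉0 -x≈0 = x≉0 (trans (sym (-‿involutive _)) (trans (-‿cong -x≈0) -0#≈0#))

  ⁻¹≉0 : ∀ {x} → x ≉ 0# → x ⁻¹ ≉ 0#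
  ⁻¹≉0 x≉0 eq = 1≉0 (trans (sym (inverseʳ x≉0)) (trans (*-congˡ eq) (zeroʳ _)))

  ^≉0 : ∀ {x} n → x ≉ 0# → x ^ n ≉ 0#
  ^≉0 zero    x≉0 = 1≉0
  ^≉0 (suc n) x≉0 = x*y≉0 x≉0 (^≉0 n x≉0)

  0^suc : ∀ {x} n → x ≈ 0# → x ^ suc n ≈ 0#
  0^suc n x≈0 = trans (*-congʳ x≈0) (zeroˡ _)

  ^≈0⇒≈0 : ∀ {x} n → x ^ n ≈ 0# → x ≈ 0#
  ^≈0⇒≈0 {x} n eq with x ≟ 0#
  ... | yes x≈0 = x≈0
  ... | no x≉0 = ⊥-elim (^≉0 n x≉0 eq)

  1^ : ∀ n → 1# ^ n ≈ 1#
  1^ zero    = refl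
  1^ (suc n) = trans (*-identityˡ _) (1^ n)

  prod≉0 : ∀ {n} (u : Fin n → Carrier) → (∀ i → u i ≉ 0#) → prod u ≉ 0#
  prod≉0 {zero}  u u≉0 = 1≉0
  prod≉0 {suc n} u u≉0 = x*y≉0 (u≉0 Fin.zero) (prod≉0 (u ∘ Fin.suc) (u≉0 ∘ Fin.suc))

  -- The fixed elements of a power map are closed under quotients. It serves for fractions such as
  -- f(β)/h(β), with `n` the exponent of an iterated Frobenius map.
  quotient-fixed : ∀ {x y z n} → y ≉ 0# → z ≈ x * y → y ^ n ≈ y → z ^ n ≈ z → x ^ n ≈ x
  quotient-fixed {x} {y} {z} {n} y≉0 z≈xy yⁿ≈y zⁿ≈z = *-cancelʳ y≉0 (begin
    x ^ n * y      ≈⟨ *-congˡ yⁿ≈y ⟨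
    x ^ n * y ^ n  ≈⟨ ^-distrib-* x y n ⟨
    (x * y) ^ n    ≈⟨ ^-congˡ n z≈xy ⟨
    z ^ n          ≈⟨ zⁿ≈z ⟩
    z              ≈⟨ z≈xy ⟩
    x * y          ∎)

  fixed⇒1 : ∀ {x n m} → x ≉ 0# → n ≡ suc m → x ^ n ≈ x → x ^ m ≈ 1#
  fixed⇒1 {x} x≉0 n≡ xⁿ≈x = *-cancelˡ x≉0
    (trans (sym (^-congʳ x n≡)) (trans xⁿ≈x (sym (*-identityʳ x))))

  ^-neg-even : ∀ x m → (- x) ^ (m ℕ.* 2) ≈ x ^ (m ℕ.* 2)
  ^-neg-even x zero    = refl
  ^-neg-even x (suc m) = trans (*-congˡ (*-congˡ (^-neg-even x m)))
    (solve 2 (λ x y → (:- x) :* ((:- x) :* y) := x :* (x :* y)) refl x (x ^ (m ℕ.* 2)))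
    where open IntegerCoefficients commutativeRing using (solve; _:*_; :-_; _:=_)

  ^-neg-odd : ∀ x m → (- x) ^ suc (m ℕ.* 2) ≈ - (x ^ suc (m ℕ.* 2))
  ^-neg-odd x m = trans (*-congˡ (^-neg-even x m)) (sym (-‿distribˡ-* x _))

  Q≡suc : ∃ λ n → Q ≡ suc n
  Q≡suc = positive (to 0#)
    where
    positive : ∀ {m} → Fin m → ∃ λ n → m ≡ suc n
    positive {suc m} _ = m , ≡.refl

  private
    -- 0 is replaced by 1, so that the product over the whole field does not vanish.
    unit : Carrier → Carrier
    unit y with y ≟ 0#
    ... | yes _ = 1#
    ... | no _  = y

    unit-0 : ∀ {y} → y ≈ 0# → unit y ≈ 1#
    unit-0 {y} y≈0 with y ≟ 0#
    ... | yes _   = refl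
    ... | no y≉0 = ⊥-elim (y≉0 y≈0)

    unit-≉0 : ∀ {y} → y ≉ 0# → unit y ≈ y
    unit-≉0 {y} y≉0 with y ≟ 0#
    ... | yes y≈0 = ⊥-elim (y≉0 y≈0)
    ... | no _    = refl

    unit-cong : ∀ {y z} → y ≈ z → unit y ≈ unit z
    unit-cong {y} {z} y≈z with z ≟ 0#
    ... | yes z≈0 = unit-0 (trans y≈z z≈0)
    ... | no z≉0  = trans (unit-≉0 (λ y≈0 → z≉0 (trans (sym y≈z) y≈0))) y≈z

    unit≉0 : ∀ y → unit y ≉ 0#
    unit≉0 y with y ≟ 0#
    ... | yes _   = 1≉0
    ... | no y≉0 = y≉0

    scaling : ∀ {x} → x ≉ 0# → Perm.Permutation Q Q
    scaling {x} x≉0 = Perm.permutation (λ i → to (x * from i)) (λ i → to (x ⁻¹ * from i))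
      (λ i → ≡.trans (to-cong (undo (inverseʳ x≉0) i)) (strictlyInverseˡ i))
      (λ i → ≡.trans (to-cong (undo (inverseˡ x≉0) i)) (strictlyInverseˡ i))
      where
      undo : ∀ {y z} → y * z ≈ 1# → ∀ i → y * from (to (z * from i)) ≈ from i
      undo {y} {z} yz≈1 i = begin
        y * from (to (z * from i)) ≈⟨ *-congˡ (strictlyInverseʳ _) ⟩
        y * (z * from i)           ≈⟨ *-assoc _ _ _ ⟨
        (y * z) * from i           ≈⟨ *-congʳ yz≈1 ⟩
        1# * from i                ≈⟨ *-identityˡ _ ⟩
        from i                     ∎

    -- The families u and v differ only at the index i₀.
    prod-differ : ∀ {n} (u v : Fin n → Carrier) (i₀ : Fin n) {x} → u i₀ ≈ x * v i₀ →
      (∀ i → ¬ i ≡ i₀ → u i ≈ v i) → prod u ≈ x * prod v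
    prod-differ {suc n} u v i₀ {x} at-i₀ elsewhere = begin
      prod u                                        ≈⟨ prod-remove {i = i₀} u ⟩
      u i₀ * prod (λ j → u (Fin.punchIn i₀ j))      ≈⟨ *-cong at-i₀ (prod-cong (λ j → elsewhere _ (Finₚ.punchInᵢ≢i i₀ j))) ⟩
      (x * v i₀) * prod (λ j → v (Fin.punchIn i₀ j)) ≈⟨ *-assoc _ _ _ ⟩
      x * (v i₀ * prod (λ j → v (Fin.punchIn i₀ j))) ≈⟨ *-congˡ (prod-remove {i = i₀} v) ⟨
      x * prod v                                    ∎

  -- Multiplication by `x ≉ 0#` permutes the field and so preserves the product of its nonzero
  -- elements. The product here keeps an index for `0#`, where `unit` is 1 before and after scaling;
  -- that index contributes the one extra factor `x`, which turns x^(Q-1) = 1 into x^Q = x.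
  fermat : ∀ x → x ^ Q ≈ x
  fermat x with x ≟ 0#
  ... | yes x≈0 = let n , Q≡ = Q≡suc in
    trans (^-congʳ x Q≡) (trans (0^suc n x≈0) (sym x≈0))
  ... | no x≉0 = *-cancelʳ (prod≉0 units (λ i → unit≉0 _)) (begin
    x ^ Q * prod units                          ≈⟨ *-congʳ (prod-replicate Q) ⟨
    prod {Q} (λ _ → x) * prod units             ≈⟨ prod-* (λ _ → x) units ⟨
    prod (λ i → x * units i)                    ≈⟨ prod-differ _ (λ i → unit (x * from i)) (to 0#) at-0 elsewhere ⟩
    x * prod (λ i → unit (x * from i))          ≈⟨ *-congˡ (prod-cong (λ i → unit-cong (strictlyInverseʳ (x * from i)))) ⟨
    x * prod (λ i → units (scaling x≉0 Perm.⟨$⟩ʳ i)) ≈⟨ *-congˡ (prod-permute units (scaling x≉0)) ⟨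
    x * prod units                              ∎)
    where
    units : Fin Q → Carrier
    units i = unit (from i)

    at-0 : x * units (to 0#) ≈ x * unit (x * from (to 0#))
    at-0 = *-congˡ (trans (unit-0 (strictlyInverseʳ 0#))
      (sym (unit-0 (trans (*-congˡ (strictlyInverseʳ 0#)) (zeroʳ x)))))

    elsewhere : ∀ i → ¬ i ≡ to 0# → x * units i ≈ unit (x * from i)
    elsewhere i i≢0 = trans (*-congˡ (unit-≉0 y≉0)) (sym (unit-≉0 (x*y≉0 x≉0 y≉0)))
      where
      y≉0 : from i ≉ 0#
      y≉0 eq = i≢0 (≡.trans (≡.sym (strictlyInverseˡ i)) (to-cong eq))

  fermat-unit : ∀ {x n} → x ≉ 0# → Q ≡ suc n → x ^ n ≈ 1#
  fermat-unit x≉0 Q≡ = fixed⇒1 x≉0 Q≡ (fermat _)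

  fermat-iterate : ∀ x v → x ^ (Q ℕ.^ v) ≈ x
  fermat-iterate x zero    = *-identityʳ x
  fermat-iterate x (suc v) = begin
    x ^ (Q ℕ.* Q ℕ.^ v)   ≈⟨ ^-assocʳ x Q _ ⟨
    (x ^ Q) ^ (Q ℕ.^ v)   ≈⟨ ^-congˡ (Q ℕ.^ v) (fermat x) ⟩
    x ^ (Q ℕ.^ v)         ≈⟨ fermat-iterate x v ⟩
    x                     ∎

-- The ring of coefficient lists.

module PolynomialRing {a ℓ₁ ℓ₂ Q} (F : FiniteField a ℓ₁ ℓ₂ Q) where
  private module F = FieldProperties F
  open Polynomial F public

  ≈-sym : ∀ {p r} → p ≈ r → r ≈ p
  ≈-sym p≈r i = F.sym (p≈r i)

  ≈-trans : ∀ {p r s} → p ≈ r → r ≈ s → p ≈ s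
  ≈-trans p≈r r≈s i = F.trans (p≈r i) (r≈s i)

  coeff-+ : ∀ p r i → coeff (p + r) i F.≈ coeff p i F.+ coeff r i
  coeff-+ []      r       i       = F.sym (F.+-identityˡ _)
  coeff-+ (x ∷ p) []      i       = F.sym (F.+-identityʳ _)
  coeff-+ (x ∷ p) (y ∷ r) zero    = F.refl
  coeff-+ (x ∷ p) (y ∷ r) (suc i) = coeff-+ p r i

  coeff-· : ∀ x p i → coeff (x · p) i F.≈ x F.* coeff p i
  coeff-· x []      i       = F.sym (F.zeroʳ x)
  coeff-· x (y ∷ p) zero    = F.refl
  coeff-· x (y ∷ p) (suc i) = coeff-· x p i

  coeff-neg : ∀ p i → coeff (- p) i F.≈ F.- coeff p i
  coeff-neg []      i       = F.sym F.-0#≈0#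
  coeff-neg (y ∷ p) zero    = F.refl
  coeff-neg (y ∷ p) (suc i) = coeff-neg p i

  coeff-- : ∀ p r i → coeff (p - r) i F.≈ coeff p i F.- coeff r i
  coeff-- p r i = F.trans (coeff-+ p (- r) i) (F.+-congˡ (coeff-neg r i))

  +-cong : ∀ {p p′ r r′} → p ≈ p′ → r ≈ r′ → p + r ≈ p′ + r′
  +-cong {p} {p′} {r} {r′} p≈p′ r≈r′ i =
    F.trans (coeff-+ p r i) (F.trans (F.+-cong (p≈p′ i) (r≈r′ i)) (F.sym (coeff-+ p′ r′ i)))

  neg-cong : ∀ {p p′} → p ≈ p′ → - p ≈ - p′
  neg-cong {p} {p′} p≈p′ i =
    F.trans (coeff-neg p i) (F.trans (F.-‿cong (p≈p′ i)) (F.sym (coeff-neg p′ i)))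

  ·-cong : ∀ {x x′ p p′} → x F.≈ x′ → p ≈ p′ → x · p ≈ x′ · p′
  ·-cong {x} {x′} {p} {p′} x≈x′ p≈p′ i =
    F.trans (coeff-· x p i) (F.trans (F.*-cong x≈x′ (p≈p′ i)) (F.sym (coeff-· x′ p′ i)))

  ∷-cong : ∀ {x x′ p p′} → x F.≈ x′ → p ≈ p′ → x ∷ p ≈ x′ ∷ p′
  ∷-cong x≈x′ p≈p′ zero    = x≈x′
  ∷-cong x≈x′ p≈p′ (suc i) = p≈p′ i

  private
    module _ where
      open IntegerCoefficients F.commutativeRing
      interchange : ∀ w x y z → (w F.+ x) F.+ (y F.+ z) F.≈ (w F.+ y) F.+ (x F.+ z)
      interchange = solve 4 (λ w x y z → (w :+ x) :+ (y :+ z) := (w :+ y) :+ (x :+ z)) F.refl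

      swap : ∀ x y z → x F.+ (y F.+ z) F.≈ y F.+ (x F.+ z)
      swap = solve 3 (λ x y z → x :+ (y :+ z) := y :+ (x :+ z)) F.refl

  +-assoc : ∀ p r s → (p + r) + s ≈ p + (r + s)
  +-assoc p r s i = begin
    coeff ((p + r) + s) i                    ≈⟨ F.trans (coeff-+ (p + r) s i) (F.+-congʳ (coeff-+ p r i)) ⟩
    (coeff p i F.+ coeff r i) F.+ coeff s i  ≈⟨ F.+-assoc _ _ _ ⟩
    coeff p i F.+ (coeff r i F.+ coeff s i)  ≈⟨ F.trans (coeff-+ p (r + s) i) (F.+-congˡ (coeff-+ r s i)) ⟨
    coeff (p + (r + s)) i                    ∎
    where open import Relation.Binary.Reasoning.Setoid F.setoid using (begin_; step-≈-⟩; step-≈-⟨; _∎)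

  +-comm : ∀ p r → p + r ≈ r + p
  +-comm p r i = F.trans (coeff-+ p r i) (F.trans (F.+-comm _ _) (F.sym (coeff-+ r p i)))

  +-identityʳ : ∀ p → p + [] ≈ p
  +-identityʳ p i = F.trans (coeff-+ p [] i) (F.+-identityʳ _)

  +-inverseʳ : ∀ p → p - p ≈ []
  +-inverseʳ p i = F.trans (coeff-- p p i) (F.-‿inverseʳ _)

  +-inverseˡ : ∀ p → (- p) + p ≈ []
  +-inverseˡ p i = F.trans (+-comm (- p) p i) (+-inverseʳ p i)

  coeff-∷* : ∀ x p r i → coeff ((x ∷ p) * r) i F.≈ x F.* coeff r i F.+ coeff (F.0# ∷ p * r) i
  coeff-∷* x p r i = F.trans (coeff-+ (x · r) _ i) (F.+-congʳ (coeff-· x r i))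

  ∷*-cong : ∀ {x x′ p p′ r r′} → x F.≈ x′ → r ≈ r′ → p * r ≈ p′ * r′ →
            (x ∷ p) * r ≈ (x′ ∷ p′) * r′
  ∷*-cong {x} {x′} {p} {p′} {r} {r′} x≈x′ r≈r′ eq i = F.trans (coeff-∷* x p r i)
    (F.trans (F.+-cong (F.*-cong x≈x′ (r≈r′ i)) (∷-cong F.refl eq i)) (F.sym (coeff-∷* x′ p′ r′ i)))

  *-congˡ : ∀ p {r r′} → r ≈ r′ → p * r ≈ p * r′
  *-congˡ []      r≈r′ i = F.refl
  *-congˡ (x ∷ p) {r} {r′} r≈r′ = ∷*-cong {p = p} {p} {r} {r′} F.refl r≈r′ (*-congˡ p r≈r′)

  zero* : ∀ p r → p ≈ [] → p * r ≈ []
  zero* []      r p≈0 i = F.refl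
  zero* (x ∷ p) r p≈0 i = F.trans (coeff-∷* x p r i)
    (F.trans (F.+-cong (F.trans (F.*-congʳ (p≈0 0)) (F.zeroˡ _)) (rest i)) (F.+-identityʳ _))
    where
    rest : F.0# ∷ p * r ≈ []
    rest zero    = F.refl
    rest (suc i) = zero* p r (p≈0 ∘ suc) i

  *-congʳ : ∀ {p p′} r → p ≈ p′ → p * r ≈ p′ * r
  *-congʳ {[]}    {p′}    r p≈p′ = ≈-sym {p′ * r} {[]} (zero* p′ r (≈-sym {[]} {p′} p≈p′))
  *-congʳ {x ∷ p} {[]}    r p≈p′ = zero* (x ∷ p) r p≈p′
  *-congʳ {x ∷ p} {y ∷ s} r p≈p′ =
    ∷*-cong {p = p} {s} {r} {r} (p≈p′ 0) (λ i → F.refl) (*-congʳ {p} {s} r (p≈p′ ∘ suc))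

  *-cong : ∀ {p p′ r r′} → p ≈ p′ → r ≈ r′ → p * r ≈ p′ * r′
  *-cong {p} {p′} {r} {r′} p≈p′ r≈r′ =
    ≈-trans {p * r} {p * r′} {p′ * r′} (*-congˡ p r≈r′) (*-congʳ {p} {p′} r′ p≈p′)

  *-distribˡ : ∀ p r s → p * (r + s) ≈ p * r + p * s
  *-distribˡ []      r s i = F.refl
  *-distribˡ (x ∷ p) r s i = begin
    coeff ((x ∷ p) * (r + s)) i
      ≈⟨ coeff-∷* x p (r + s) i ⟩
    x F.* coeff (r + s) i F.+ coeff (F.0# ∷ p * (r + s)) i
      ≈⟨ F.+-cong (F.trans (F.*-congˡ (coeff-+ r s i)) (F.distribˡ x _ _))
                  (F.trans (∷-cong (F.sym (F.+-identityʳ _)) (*-distribˡ p r s) i) (coeff-+ (F.0# ∷ p * r) (F.0# ∷ p * s) i)) ⟩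
    (x F.* coeff r i F.+ x F.* coeff s i) F.+ (coeff (F.0# ∷ p * r) i F.+ coeff (F.0# ∷ p * s) i)
      ≈⟨ interchange _ _ _ _ ⟩
    (x F.* coeff r i F.+ coeff (F.0# ∷ p * r) i) F.+ (x F.* coeff s i F.+ coeff (F.0# ∷ p * s) i)
      ≈⟨ F.trans (coeff-+ ((x ∷ p) * r) _ i) (F.+-cong (coeff-∷* x p r i) (coeff-∷* x p s i)) ⟨
    coeff ((x ∷ p) * r + (x ∷ p) * s) i ∎
    where open import Relation.Binary.Reasoning.Setoid F.setoid using (begin_; step-≈-⟩; step-≈-⟨; _∎)

  ·-* : ∀ x p r → (x · p) * r ≈ x · (p * r)
  ·-* x []      r i = F.refl
  ·-* x (y ∷ p) r i = begin
    coeff ((x F.* y ∷ x · p) * r) i                        ≈⟨ coeff-∷* (x F.* y) (x · p) r i ⟩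
    (x F.* y) F.* coeff r i F.+ coeff (F.0# ∷ (x · p) * r) i
      ≈⟨ F.+-cong (F.*-assoc _ _ _) (F.trans (∷-cong (F.sym (F.zeroʳ x)) (·-* x p r) i) (coeff-· x (F.0# ∷ p * r) i)) ⟩
    x F.* (y F.* coeff r i) F.+ x F.* coeff (F.0# ∷ p * r) i ≈⟨ F.distribˡ x _ _ ⟨
    x F.* (y F.* coeff r i F.+ coeff (F.0# ∷ p * r) i)     ≈⟨ F.trans (coeff-· x ((y ∷ p) * r) i) (F.*-congˡ (coeff-∷* y p r i)) ⟨
    coeff (x · ((y ∷ p) * r)) i                            ∎
    where open import Relation.Binary.Reasoning.Setoid F.setoid using (begin_; step-≈-⟩; step-≈-⟨; _∎)

  *-[] : ∀ p → p * [] ≈ []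
  *-[] []      i       = F.refl
  *-[] (x ∷ p) zero    = F.refl
  *-[] (x ∷ p) (suc i) = *-[] p i

  -- Multiplication recurses on its left argument; this is the mirror recursion on the right one,
  -- from which commutativity follows by induction.
  coeff-*∷ : ∀ p y r i → coeff (p * (y ∷ r)) i F.≈ y F.* coeff p i F.+ coeff (F.0# ∷ p * r) i
  coeff-*∷ []      y r zero    = F.sym (F.trans (F.+-identityʳ _) (F.zeroʳ y))
  coeff-*∷ []      y r (suc i) = F.sym (F.trans (F.+-identityʳ _) (F.zeroʳ y))
  coeff-*∷ (x ∷ p) y r zero    = F.+-congʳ (F.*-comm x y)
  coeff-*∷ (x ∷ p) y r (suc i) = begin
    coeff ((x ∷ p) * (y ∷ r)) (suc i)            ≈⟨ coeff-∷* x p (y ∷ r) (suc i) ⟩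
    x F.* coeff r i F.+ coeff (p * (y ∷ r)) i    ≈⟨ F.+-congˡ (coeff-*∷ p y r i) ⟩
    x F.* coeff r i F.+ (y F.* coeff p i F.+ coeff (F.0# ∷ p * r) i) ≈⟨ swap _ _ _ ⟩
    y F.* coeff p i F.+ (x F.* coeff r i F.+ coeff (F.0# ∷ p * r) i) ≈⟨ F.+-congˡ (coeff-∷* x p r i) ⟨
    y F.* coeff p i F.+ coeff ((x ∷ p) * r) i    ∎
    where open import Relation.Binary.Reasoning.Setoid F.setoid using (begin_; step-≈-⟩; step-≈-⟨; _∎)

  *-comm : ∀ p r → p * r ≈ r * p
  *-comm p []      = *-[] p
  *-comm p (y ∷ r) i = F.trans (coeff-*∷ p y r i)
    (F.trans (F.+-congˡ (∷-cong F.refl (*-comm p r) i)) (F.sym (coeff-∷* y r p i)))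

  *-distribʳ : ∀ p r s → (r + s) * p ≈ r * p + s * p
  *-distribʳ p r s i = F.trans (*-comm (r + s) p i) (F.trans (*-distribˡ p r s i)
    (+-cong {p * r} {r * p} {p * s} {s * p} (*-comm p r) (*-comm p s) i))

  shift-* : ∀ p r → (F.0# ∷ p) * r ≈ F.0# ∷ p * r
  shift-* p r i = F.trans (coeff-∷* F.0# p r i) (F.trans (F.+-congʳ (F.zeroˡ _)) (F.+-identityˡ _))

  *-assoc : ∀ p r s → (p * r) * s ≈ p * (r * s)
  *-assoc []      r s i = F.refl
  *-assoc (x ∷ p) r s i = F.trans (*-distribʳ s (x · r) (F.0# ∷ p * r) i)
    (+-cong {(x · r) * s} {x · (r * s)} {(F.0# ∷ p * r) * s} {F.0# ∷ p * (r * s)} (·-* x r s)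
      (λ j → F.trans (shift-* (p * r) s j) (∷-cong F.refl (*-assoc p r s) j)) i)

  *-identityˡ : ∀ p → (F.1# ∷ []) * p ≈ p
  *-identityˡ p i = F.trans (coeff-∷* F.1# [] p i)
    (F.trans (F.+-cong (F.*-identityˡ _) (zeros i)) (F.+-identityʳ _))
    where
    zeros : F.0# ∷ [] ≈ []
    zeros zero    = F.refl
    zeros (suc i) = F.refl

  *-identityʳ : ∀ p → p * (F.1# ∷ []) ≈ p
  *-identityʳ p i = F.trans (*-comm p (F.1# ∷ []) i) (*-identityˡ p i)

  -- The arguments of _≈_ cannot be inferred from a proof; those of _≋_ can.
  infix 4 _≋_
  record _≋_ (p r : Poly) : Set ℓ₁ where
    constructor ⟪_⟫
    field at : p ≈ r
  open _≋_ public

  polynomialRing : CommutativeRing a ℓ₁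
  polynomialRing = record
    { Carrier = Poly ; _≈_ = _≋_ ; _+_ = _+_ ; _*_ = _*_ ; -_ = -_ ; 0# = [] ; 1# = F.1# ∷ []
    ; isCommutativeRing = record
      { isRing = record
        { +-isAbelianGroup = record
          { isGroup = record
            { isMonoid = record
              { isSemigroup = record
                { isMagma = record
                  { isEquivalence = record
                    { refl = ⟪ (λ i → F.refl) ⟫
                    ; sym = λ e → ⟪ (λ i → F.sym (at e i)) ⟫
                    ; trans = λ e e′ → ⟪ (λ i → F.trans (at e i) (at e′ i)) ⟫ }
                  ; ∙-cong = λ {p} {p′} {r} {r′} e e′ → ⟪ +-cong {p} {p′} {r} {r′} (at e) (at e′) ⟫ }
                ; assoc = λ p r s → ⟪ +-assoc p r s ⟫ }
              ; identity = (λ p → ⟪ (λ i → F.refl) ⟫) , (λ p → ⟪ +-identityʳ p ⟫) }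
            ; inverse = (λ p → ⟪ +-inverseˡ p ⟫) , (λ p → ⟪ +-inverseʳ p ⟫)
            ; ⁻¹-cong = λ {p} {p′} e → ⟪ neg-cong {p} {p′} (at e) ⟫ }
          ; comm = λ p r → ⟪ +-comm p r ⟫ }
        ; *-cong = λ {p} {p′} {r} {r′} e e′ → ⟪ *-cong {p} {p′} {r} {r′} (at e) (at e′) ⟫
        ; *-assoc = λ p r s → ⟪ *-assoc p r s ⟫
        ; *-identity = (λ p → ⟪ *-identityˡ p ⟫) , (λ p → ⟪ *-identityʳ p ⟫)
        ; distrib = (λ p r s → ⟪ *-distribˡ p r s ⟫) , (λ p r s → ⟪ *-distribʳ p r s ⟫) }
      ; *-comm = λ p r → ⟪ *-comm p r ⟫ } }

  module P = CommutativeRing polynomialRing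

-- Degree, division with remainder, and inverses modulo an irreducible polynomial.

module PolynomialDivision {a ℓ₁ ℓ₂ Q} (F : FiniteField a ℓ₁ ℓ₂ Q) where
  private module F = FieldProperties F
  open PolynomialRing F

  -- Degree less than `n`, the zero polynomial included. With `HasDeg` it expresses degree bounds as
  -- properties of coefficients, free of the convention that `deg` makes for zero.
  Below : Poly → ℕ → Set ℓ₁
  Below p n = ∀ i → n ℕ.≤ i → coeff p i F.≈ F.0#

  record HasDeg (p : Poly) (n : ℕ) : Set ℓ₁ where
    field
      lead  : coeff p n F.≉ F.0#
      below : Below p (suc n)
  open HasDeg public

  tail-below : ∀ {x p n} → Below (x ∷ p) (suc n) → Below p n
  tail-below b i n≤i = b (suc i) (s≤s n≤i)

  -- The bounds are deliberately asymmetric, deg p < m and deg r ≤ n, so that the bound m + n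
  -- involves no predecessor.
  below-* : ∀ p r {m n} → Below p m → Below r (suc n) → Below (p * r) (m ℕ.+ n)
  below-* []      r bp br i _ = F.refl
  below-* (x ∷ p) r {zero} bp br i _ = zero* (x ∷ p) r (λ i → bp i z≤n) i
  below-* (x ∷ p) r {suc m} {n} bp br (suc i) (s≤s m+n≤i) = begin
    coeff ((x ∷ p) * r) (suc i)                      ≈⟨ coeff-∷* x p r (suc i) ⟩
    x F.* coeff r (suc i) F.+ coeff (p * r) i        ≈⟨ F.+-cong (F.*-congˡ (br (suc i) (s≤s (ℕₚ.≤-trans (ℕₚ.m≤n+m n m) m+n≤i)))) (below-* p r (tail-below {x} {p} bp) br i m+n≤i) ⟩
    x F.* F.0# F.+ F.0#                              ≈⟨ F.trans (F.+-identityʳ _) (F.zeroʳ x) ⟩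
    F.0#                                             ∎
    where open import Relation.Binary.Reasoning.Setoid F.setoid using (begin_; step-≈-⟩; step-≈-⟨; _∎)

  coeff-*-top : ∀ p r {m n} → Below p (suc m) → Below r (suc n) →
    coeff (p * r) (m ℕ.+ n) F.≈ coeff p m F.* coeff r n
  coeff-*-top []      r bp br = F.sym (F.zeroˡ _)
  coeff-*-top (x ∷ p) r {zero} {n} bp br = F.trans (coeff-∷* x p r n)
    (F.trans (F.+-congˡ (rest n)) (F.+-identityʳ _))
    where
    rest : ∀ i → coeff (F.0# ∷ p * r) i F.≈ F.0#
    rest zero    = F.refl
    rest (suc i) = zero* p r (λ j → bp (suc j) (s≤s z≤n)) i
  coeff-*-top (x ∷ p) r {suc m} {n} bp br = begin
    coeff ((x ∷ p) * r) (suc m ℕ.+ n)                    ≈⟨ coeff-∷* x p r (suc m ℕ.+ n) ⟩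
    x F.* coeff r (suc m ℕ.+ n) F.+ coeff (p * r) (m ℕ.+ n) ≈⟨ F.+-congʳ (F.*-congˡ (br _ (s≤s (ℕₚ.m≤n+m n m)))) ⟩
    x F.* F.0# F.+ coeff (p * r) (m ℕ.+ n)               ≈⟨ F.trans (F.+-congʳ (F.zeroʳ x)) (F.+-identityˡ _) ⟩
    coeff (p * r) (m ℕ.+ n)                              ≈⟨ coeff-*-top p r (tail-below {x} {p} bp) br ⟩
    coeff p m F.* coeff r n                              ∎
    where open import Relation.Binary.Reasoning.Setoid F.setoid using (begin_; step-≈-⟩; step-≈-⟨; _∎)

  hasDeg-* : ∀ {p r m n} → HasDeg p m → HasDeg r n → HasDeg (p * r) (m ℕ.+ n)
  hasDeg-* {p} {r} {m} {n} hp hr .lead eq =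
    F.x*y≉0 (lead hp) (lead hr) (F.trans (F.sym (coeff-*-top p r (below hp) (below hr))) eq)
  hasDeg-* {p} {r} hp hr .below = below-* p r (below hp) (below hr)

  hasDeg-cong : ∀ {p r n} → p ≋ r → HasDeg p n → HasDeg r n
  hasDeg-cong p≋r hp .lead eq = lead hp (F.trans (at p≋r _) eq)
  hasDeg-cong p≋r hp .below i n<i = F.trans (F.sym (at p≋r i)) (below hp i n<i)

  hasDeg-below : ∀ {p m n} → HasDeg p m → Below p n → m ℕ.< n
  hasDeg-below {m = m} {n} hp b with m ℕₚ.<? n
  ... | yes m<n = m<n
  ... | no m≮n = ⊥-elim (lead hp (b m (ℕₚ.≮⇒≥ m≮n)))

  hasDeg-unique : ∀ {p m n} → HasDeg p m → HasDeg p n → m ≡ n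
  hasDeg-unique hp hp′ = ℕₚ.≤-antisym
    (ℕₚ.≤-pred (hasDeg-below hp (below hp′))) (ℕₚ.≤-pred (hasDeg-below hp′ (below hp)))

  hasDeg≉0 : ∀ {p n} → HasDeg p n → ¬ p ≋ []
  hasDeg≉0 hp p≋0 = lead hp (at p≋0 _)

  all-zero⇒≈0 : ∀ {p} → All (F._≈ F.0#) p → p ≈ []
  all-zero⇒≈0 []       i       = F.refl
  all-zero⇒≈0 (z ∷ zs) zero    = z
  all-zero⇒≈0 (z ∷ zs) (suc i) = all-zero⇒≈0 zs i

  ≈0⇒all-zero : ∀ p → p ≈ [] → All (F._≈ F.0#) p
  ≈0⇒all-zero []      _   = []
  ≈0⇒all-zero (y ∷ p) p≈0 = p≈0 0 ∷ ≈0⇒all-zero p (p≈0 ∘ suc)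

  degree? : ∀ p → p ≋ [] ⊎ HasDeg p (deg p)
  degree? [] = inj₁ ⟪ (λ i → F.refl) ⟫
  degree? (x ∷ p) with all? (F._≟ F.0#) p
  ... | yes zeros with x F.≟ F.0#
  ...   | yes x≈0 = inj₁ ⟪ (λ { zero → x≈0 ; (suc i) → all-zero⇒≈0 zeros i }) ⟫
  ...   | no x≉0  = inj₂ record { lead = x≉0 ; below = λ { (suc i) _ → all-zero⇒≈0 zeros i } }
  degree? (x ∷ p) | no ¬zeros with degree? p
  ... | inj₁ p≋0 = ⊥-elim (¬zeros (≈0⇒all-zero p (at p≋0)))
  ... | inj₂ hp  = inj₂ record { lead = lead hp ; below = λ { (suc i) (s≤s n<i) → below hp i n<i } }

  deg≡ : ∀ {p n} → HasDeg p n → deg p ≡ n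
  deg≡ {p} hp with degree? p
  ... | inj₁ p≋0 = ⊥-elim (hasDeg≉0 hp p≋0)
  ... | inj₂ hp′ = hasDeg-unique hp′ hp

  hasDeg-factors : ∀ {p x y k} → HasDeg p k → p ≋ x * y →
    ∃ λ m → ∃ λ n → HasDeg x m × HasDeg y n × m ℕ.+ n ≡ k
  hasDeg-factors {x = x} {y} hp p≋xy with degree? x | degree? y
  ... | inj₁ x≋0 | _ = ⊥-elim (hasDeg≉0 hp (P.trans p≋xy (P.trans (P.*-congʳ x≋0) (P.zeroˡ y))))
  ... | inj₂ _ | inj₁ y≋0 = ⊥-elim (hasDeg≉0 hp (P.trans p≋xy (P.trans (P.*-congˡ {x} y≋0) (P.zeroʳ x))))
  ... | inj₂ hx | inj₂ hy = _ , _ , hx , hy , hasDeg-unique (hasDeg-* hx hy) (hasDeg-cong p≋xy hp)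

  hasDeg-1 : HasDeg (F.1# ∷ []) 0
  hasDeg-1 = record { lead = F.1≉0 ; below = λ { (suc i) _ → F.refl } }

  hasDeg0⇒unit : ∀ {p} → HasDeg p 0 → p ∣ (F.1# ∷ [])
  hasDeg0⇒unit {p} hp = (coeff p 0 F.⁻¹ ∷ []) , λ i →
    F.trans (coeff-∷* _ [] p i) (inverts i)
    where
    inverts : ∀ i → coeff p 0 F.⁻¹ F.* coeff p i F.+ coeff (F.0# ∷ []) i F.≈ coeff (F.1# ∷ []) i
    inverts zero    = F.trans (F.+-identityʳ _) (F.inverseˡ (lead hp))
    inverts (suc i) = F.trans (F.+-identityʳ _) (F.trans (F.*-congˡ (below hp (suc i) (s≤s z≤n))) (F.zeroʳ _))

  unit⇒hasDeg0 : ∀ {p} → p ∣ (F.1# ∷ []) → HasDeg p 0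
  unit⇒hasDeg0 {p} (u , up≈1) with hasDeg-factors {x = u} {p} hasDeg-1 (P.sym {u * p} ⟪ up≈1 ⟫)
  ... | m , n , _ , hp , m+n≡0 = ≡.subst (HasDeg p) (ℕₚ.m+n≡0⇒n≡0 m m+n≡0) hp

  irreducible-intro : ∀ {p n} → HasDeg p (suc n) →
    (∀ {x y m k} → p ≋ x * y → HasDeg x (suc m) → HasDeg y (suc k) → m ℕ.+ suc k ≡ n → ⊥) →
    Irreducible p
  irreducible-intro {p} {n} hp ¬split = record { p∤1 = p∤1 ; split-∣1 = split }
    where
    p∤1 : ¬ p ∣ (F.1# ∷ [])
    p∤1 p∣1 with hasDeg-unique hp (unit⇒hasDeg0 p∣1)
    ... | ()

    split : ∀ {x y} → p ≈ (x * y) → x ∣ (F.1# ∷ []) ⊎ y ∣ (F.1# ∷ [])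
    split p≈xy with hasDeg-factors hp ⟪ p≈xy ⟫
    ... | zero , _ , hx , _ , _ = inj₁ (hasDeg0⇒unit hx)
    ... | suc m , zero , _ , hy , _ = inj₂ (hasDeg0⇒unit hy)
    ... | suc m , suc k , hx , hy , eq = ⊥-elim (¬split ⟪ p≈xy ⟫ hx hy (ℕₚ.suc-injective eq))

  irreducible-hasDeg : ∀ {p} → Irreducible p → ∃ λ n → HasDeg p (suc n)
  irreducible-hasDeg {p} irr with degree? p
  -- The zero polynomial is excluded by the factorisation `[] * []`: neither factor is a unit.
  ... | inj₁ p≋0 with Irreducible.split-∣1 irr {[]} {[]} (at p≋0)
  ...   | inj₁ (u , eq) = ⊥-elim (F.1≉0 (F.sym (F.trans (F.sym (*-[] u 0)) (eq 0))))
  ...   | inj₂ (u , eq) = ⊥-elim (F.1≉0 (F.sym (F.trans (F.sym (*-[] u 0)) (eq 0))))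
  irreducible-hasDeg {p} irr | inj₂ hp with deg p
  ... | zero  = ⊥-elim (Irreducible.p∤1 irr (hasDeg0⇒unit hp))
  ... | suc n = n , hp

  -- A polynomial with Φ of least degree is irreducible.
  irreducible-factor : ∀ {ℓ} (Φ : Poly → Set ℓ) →
    (∀ {p x y} → Φ p → p ≋ x * y → Φ x ⊎ Φ y) →
    ∀ {p m} → Φ p → HasDeg p (suc m) →
    ¬ ¬ (∃ λ r → ∃ λ k → Irreducible r × HasDeg r (suc k) × Φ r × k ℕ.≤ m)
  irreducible-factor Φ splits {m = m} = go (suc m) (ℕₚ.n<1+n m)
    where
    -- Whether a factorisation exists is not decided. Under a double negation one may assume that
    -- there is no suitable `r`, which makes `p` itself irreducible, a contradiction; both
    -- applications have goal `⊥`. The number `n` bounds the degree for the recursion.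
    go : ∀ n {p m} → m ℕ.< n → Φ p → HasDeg p (suc m) →
      ¬ ¬ (∃ λ r → ∃ λ k → Irreducible r × HasDeg r (suc k) × Φ r × k ℕ.≤ m)
    go (suc n) {p} {m} m<1+n φ hp none = none
      (p , m , irreducible-intro hp ¬split , hp , φ , ℕₚ.≤-refl)
      where
      ¬split : ∀ {x y i j} → p ≋ x * y → HasDeg x (suc i) → HasDeg y (suc j) → i ℕ.+ suc j ≡ m → ⊥
      ¬split {x} {y} {i} {j} p≋xy hx hy ≡.refl with splits φ p≋xy
      ... | inj₁ φx = go n (ℕₚ.<-≤-trans (ℕₚ.m<m+n i (s≤s z≤n)) (ℕₚ.≤-pred m<1+n)) φx hx
        λ (r , k , irr , hr , φr , k≤i) → none (r , k , irr , hr , φr , ℕₚ.≤-trans k≤i (ℕₚ.m≤m+n i _))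
      ... | inj₂ φy = go n (ℕₚ.≤-trans (ℕₚ.m≤n+m (suc j) i) (ℕₚ.≤-pred m<1+n)) φy hy
        λ (r , k , irr , hr , φr , k≤j) → none (r , k , irr , hr , φr , ℕₚ.≤-trans k≤j (ℕₚ.≤-trans (ℕₚ.n≤1+n j) (ℕₚ.m≤n+m (suc j) i)))

  Divides : Poly → Poly → Set (a ⊔ ℓ₁)
  Divides s p = ∃ λ k → p ≋ k * s

  module Remainder {s e} (hs : HasDeg s e) where

    -- Long division along the list, as in Horner's scheme: the remainder of the tail has degree
    -- below `e`, prefixing `x` raises it to at most `e`, and the multiple `c · s` removes the
    -- coefficient at `e`.
    divide : Poly → Poly × Poly
    divide []      = [] , []
    divide (x ∷ p) =
      let k , r = divide p
          c = coeff (x ∷ r) e F.* coeff s e F.⁻¹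
      in (c ∷ k) , ((x ∷ r) - c · s)

    rem : Poly → Poly
    rem p = proj₂ (divide p)

    quot : Poly → Poly
    quot p = proj₁ (divide p)

    division : ∀ p → p ≋ quot p * s + rem p
    division []      = P.refl
    division (x ∷ p) = let k , r = divide p
                           c = coeff (x ∷ r) e F.* coeff s e F.⁻¹ in begin
      x ∷ p                                   ≈⟨ ⟪ ∷-cong F.refl (at (division p)) ⟫ ⟩
      x ∷ (k * s + r)                         ≈⟨ ⟪ ∷-cong (F.sym (F.+-identityˡ x)) (λ i → F.refl) ⟫ ⟩
      (F.0# ∷ k * s) + (x ∷ r)                ≈⟨ regroup (c · s) (F.0# ∷ k * s) (x ∷ r) ⟩
      (c · s + (F.0# ∷ k * s)) + ((x ∷ r) - c · s) ∎
      where
      open import Relation.Binary.Reasoning.Setoid P.setoid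
      open IntegerCoefficients polynomialRing
      regroup : ∀ u v w → v + w ≋ (u + v) + (w - u)
      regroup = solve 3 (λ u v w → v :+ w := (u :+ v) :+ (w :- u)) P.refl

    rem-below : ∀ p → Below (rem p) e
    rem-below []      i _ = F.refl
    rem-below (x ∷ p) i e≤i = let r = rem p
                                  c = coeff (x ∷ r) e F.* coeff s e F.⁻¹ in
      F.trans (coeff-- (x ∷ r) (c · s) i) (F.trans (F.+-congˡ (F.-‿cong (coeff-· c s i))) (cancels e≤i))
      where
      cancels : e ℕ.≤ i → let r = rem p in
        coeff (x ∷ r) i F.- (coeff (x ∷ r) e F.* coeff s e F.⁻¹) F.* coeff s i F.≈ F.0#
      cancels e≤i with ℕₚ.m≤n⇒m<n∨m≡n e≤i
      ... | inj₂ ≡.refl = F.x≈y⇒x-y≈0 (F.sym (F.trans (F.*-assoc _ _ _)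
        (F.trans (F.*-congˡ (F.inverseˡ (lead hs))) (F.*-identityʳ _))))
      ... | inj₁ (s≤s {n = i′} e≤i′) = F.trans (F.+-cong (rem-below p i′ e≤i′)
        (F.-‿cong (F.trans (F.*-congˡ (below hs i (s≤s e≤i′))) (F.zeroʳ _))))
        (F.trans (F.+-identityˡ _) F.-0#≈0#)

    multiple-below : ∀ {p} → Divides s p → Below p e → p ≋ []
    multiple-below {p} (k , p≋ks) b with degree? k
    ... | inj₁ k≋0 = P.trans p≋ks (P.trans (P.*-congʳ k≋0) (P.zeroˡ s))
    ... | inj₂ hk = ⊥-elim (ℕₚ.<⇒≱ (hasDeg-below (hasDeg-cong (P.sym p≋ks) (hasDeg-* hk hs)) b) (ℕₚ.m≤n+m e _))

  -- A descent in the degree of `p`. Write s = k p + r. If r = 0, then p divides s and, being of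
  -- smaller degree, is a unit. Otherwise k p ≡ -r, so an inverse `u` of `r` modulo `s` yields the
  -- inverse -(k u) of `p`.
  inverse-modulo : ∀ {s e} → Irreducible s → HasDeg s e → ∀ {p m} → HasDeg p m → m ℕ.< e →
    ∃ λ u → Divides s (p * u - (F.1# ∷ []))
  inverse-modulo {s} {e} irr hs {m = m} = go (suc m) (ℕₚ.n<1+n m)
    where
    open IntegerCoefficients polynomialRing
    open import Relation.Binary.Reasoning.Setoid P.setoid

    go : ∀ n {p m} → m ℕ.< n → HasDeg p m → m ℕ.< e → ∃ λ u → Divides s (p * u - (F.1# ∷ []))
    go (suc n) {p} {m} m<1+n hp m<e with degree? (Remainder.rem hp s)
    ... | inj₁ r≋0 = exact (Irreducible.split-∣1 irr (at s≋kp))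
      where
      k = Remainder.quot hp s
      s≋kp : s ≋ k * p
      s≋kp = P.trans (Remainder.division hp s) (P.trans (P.+-congˡ {k * p} r≋0) (P.+-identityʳ (k * p)))

      exact : k ∣ (F.1# ∷ []) ⊎ p ∣ (F.1# ∷ []) → ∃ λ u → Divides s (p * u - (F.1# ∷ []))
      exact (inj₁ k∣1) = ⊥-elim (ℕₚ.<-irrefl
        (hasDeg-unique (hasDeg-* (unit⇒hasDeg0 k∣1) hp) (hasDeg-cong s≋kp hs)) m<e)
      exact (inj₂ (u , up≈1)) = u , [] , (begin
        p * u - (F.1# ∷ []) ≈⟨ P.+-congʳ { - (F.1# ∷ []) } {p * u} {F.1# ∷ []} (P.trans {p * u} {u * p} (P.*-comm p u) ⟪ up≈1 ⟫) ⟩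
        (F.1# ∷ []) - (F.1# ∷ []) ≈⟨ P.-‿inverseʳ (F.1# ∷ []) ⟩
        [] ∎)
    ... | inj₂ hr with go n (ℕₚ.<-≤-trans r<m (ℕₚ.≤-pred m<1+n)) hr (ℕₚ.<-trans r<m m<e)
      where r<m = hasDeg-below hr (Remainder.rem-below hp s)
    ...   | u , w , eq = - (k * u) , w - u , (begin
      p * - (k * u) - (F.1# ∷ [])            ≈⟨ solve 4 (λ p k u r → p :* (:- (k :* u)) :- con (+ 1) := (r :* u :- con (+ 1)) :- (k :* p :+ r) :* u) P.refl p k u r ⟩
      (r * u - (F.1# ∷ [])) - (k * p + r) * u ≈⟨ P.+-cong eq (P.-‿cong (P.*-congʳ (P.sym (Remainder.division hp s)))) ⟩
      w * s - s * u                          ≈⟨ solve 3 (λ w s u → w :* s :- s :* u := (w :- u) :* s) P.refl w s u ⟩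
      (w - u) * s                            ∎)
      where
      k = Remainder.quot hp s
      r = Remainder.rem hp s

-- Evaluation and the number of roots.

module Evaluation {a ℓ₁ ℓ₂ Q} (F : FiniteField a ℓ₁ ℓ₂ Q) where
  private module F = FieldProperties F
  open PolynomialRing F
  open PolynomialDivision F
  open import Relation.Binary.Reasoning.Setoid F.setoid using (begin_; step-≈-⟩; step-≈-⟨; _∎)

  eval-zero : ∀ p y → p ≈ [] → eval p y F.≈ F.0#
  eval-zero []      y _   = F.refl
  eval-zero (x ∷ p) y p≈0 = F.trans (F.+-cong (p≈0 0) (F.trans (F.*-congˡ (eval-zero p y (p≈0 ∘ suc))) (F.zeroʳ y))) (F.+-identityˡ _)

  eval-cong′ : ∀ p r y → p ≈ r → eval p y F.≈ eval r y
  eval-cong′ []      r       y p≈r = F.sym (eval-zero r y (λ i → F.sym (p≈r i)))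
  eval-cong′ (x ∷ p) []      y p≈r = eval-zero (x ∷ p) y p≈r
  eval-cong′ (x ∷ p) (z ∷ r) y p≈r = F.+-cong (p≈r 0) (F.*-congˡ (eval-cong′ p r y (p≈r ∘ suc)))

  eval-cong : ∀ {p r y} → p ≋ r → eval p y F.≈ eval r y
  eval-cong {p} {r} {y} p≋r = eval-cong′ p r y (at p≋r)

  eval-congʳ : ∀ p {y z} → y F.≈ z → eval p y F.≈ eval p z
  eval-congʳ []      y≈z = F.refl
  eval-congʳ (x ∷ p) y≈z = F.+-congˡ (F.*-cong y≈z (eval-congʳ p y≈z))

  private
    module _ where
      open IntegerCoefficients F.commutativeRing
      horner-+ : ∀ x z y u v → (x F.+ z) F.+ y F.* (u F.+ v) F.≈ (x F.+ y F.* u) F.+ (z F.+ y F.* v)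
      horner-+ = solve 5 (λ x z y u v → (x :+ z) :+ y :* (u :+ v) := (x :+ y :* u) :+ (z :+ y :* v)) F.refl

      horner-· : ∀ c x y u → c F.* x F.+ y F.* (c F.* u) F.≈ c F.* (x F.+ y F.* u)
      horner-· = solve 4 (λ c x y u → c :* x :+ y :* (c :* u) := c :* (x :+ y :* u)) F.refl

      horner-neg : ∀ x y u → (F.- x) F.+ y F.* (F.- u) F.≈ F.- (x F.+ y F.* u)
      horner-neg = solve 3 (λ x y u → (:- x) :+ y :* (:- u) := :- (x :+ y :* u)) F.refl

      horner-* : ∀ x y u v → x F.* v F.+ (F.0# F.+ y F.* (u F.* v)) F.≈ (x F.+ y F.* u) F.* v
      horner-* = solve 4 (λ x y u v → x :* v :+ (con (+ 0) :+ y :* (u :* v)) := (x :+ y :* u) :* v) F.refl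

      synthetic-step : ∀ x y a u v →
        (x F.+ a F.* u) F.+ (y F.- a) F.* (u F.+ y F.* v) F.≈ x F.+ y F.* (u F.+ (y F.- a) F.* v)
      synthetic-step = solve 5 (λ x y a u v → (x :+ a :* u) :+ (y :- a) :* (u :+ y :* v) := x :+ y :* (u :+ (y :- a) :* v)) F.refl

      rotate : ∀ x y z → x F.* (y F.* z) F.≈ y F.* (x F.* z)
      rotate = solve 3 (λ x y z → x :* (y :* z) := y :* (x :* z)) F.refl

  eval-+ : ∀ p r y → eval (p + r) y F.≈ eval p y F.+ eval r y
  eval-+ []      r       y = F.sym (F.+-identityˡ _)
  eval-+ (x ∷ p) []      y = F.sym (F.+-identityʳ _)
  eval-+ (x ∷ p) (z ∷ r) y = F.trans (F.+-congˡ (F.*-congˡ (eval-+ p r y))) (horner-+ _ _ _ _ _)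

  eval-· : ∀ c p y → eval (c · p) y F.≈ c F.* eval p y
  eval-· c []      y = F.sym (F.zeroʳ c)
  eval-· c (x ∷ p) y = F.trans (F.+-congˡ (F.*-congˡ (eval-· c p y))) (horner-· _ _ _ _)

  eval-neg : ∀ p y → eval (- p) y F.≈ F.- eval p y
  eval-neg []      y = F.sym F.-0#≈0#
  eval-neg (x ∷ p) y = F.trans (F.+-congˡ (F.*-congˡ (eval-neg p y)))
    (horner-neg x y (eval p y))

  eval-- : ∀ p r y → eval (p - r) y F.≈ eval p y F.- eval r y
  eval-- p r y = F.trans (eval-+ p (- r) y) (F.+-congˡ (eval-neg r y))

  eval-* : ∀ p r y → eval (p * r) y F.≈ eval p y F.* eval r y
  eval-* []      r y = F.sym (F.zeroˡ _)
  eval-* (x ∷ p) r y = begin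
    eval (x · r + (F.0# ∷ p * r)) y                            ≈⟨ eval-+ (x · r) (F.0# ∷ p * r) y ⟩
    eval (x · r) y F.+ (F.0# F.+ y F.* eval (p * r) y)         ≈⟨ F.+-cong (eval-· x r y) (F.+-congˡ (F.*-congˡ (eval-* p r y))) ⟩
    x F.* eval r y F.+ (F.0# F.+ y F.* (eval p y F.* eval r y)) ≈⟨ horner-* x y _ _ ⟩
    eval (x ∷ p) y F.* eval r y                                ∎

  eval-const : ∀ x y → eval (x ∷ []) y F.≈ x
  eval-const x y = F.trans (F.+-congˡ (F.zeroʳ y)) (F.+-identityʳ x)

  eval-^ : ∀ p n y → eval (p ^ n) y F.≈ eval p y F.^ n
  eval-^ p zero    y = eval-const F.1# y
  eval-^ p (suc n) y = F.trans (eval-* p (p ^ n) y) (F.*-congˡ (eval-^ p n y))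

  eval-x+ : ∀ z y → eval (x+ z) y F.≈ y F.+ z
  eval-x+ z y = F.trans (F.+-congˡ (F.trans (F.*-congˡ (eval-const F.1# y)) (F.*-identityʳ y))) (F.+-comm z y)

  eval-below-1 : ∀ p y → Below p 1 → eval p y F.≈ coeff p 0
  eval-below-1 []      y b = F.refl
  eval-below-1 (x ∷ p) y b = F.trans (F.+-congˡ (F.trans (F.*-congˡ (eval-zero p y (λ i → b (suc i) (s≤s z≤n)))) (F.zeroʳ y))) (F.+-identityʳ x)

  x+-hasDeg : ∀ z → HasDeg (x+ z) 1
  x+-hasDeg z = record { lead = F.1≉0 ; below = λ { (suc zero) (s≤s ()) ; (suc (suc i)) _ → F.refl } }

  x+^-hasDeg : ∀ z n → HasDeg ((x+ z) ^ n) n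
  x+^-hasDeg z zero    = hasDeg-1
  x+^-hasDeg z (suc n) = hasDeg-* (x+-hasDeg z) (x+^-hasDeg z n)

  x+^-monic : ∀ z n → coeff ((x+ z) ^ n) n F.≈ F.1#
  x+^-monic z zero    = F.refl
  x+^-monic z (suc n) = F.trans
    (coeff-*-top (x+ z) ((x+ z) ^ n) (below (x+-hasDeg z)) (below (x+^-hasDeg z n)))
    (F.trans (F.*-identityˡ _) (x+^-monic z n))

  -- The quotient of p by X - a.
  synthetic : F.Carrier → Poly → Poly
  synthetic a []      = []
  synthetic a (x ∷ p) = eval p a ∷ synthetic a p

  eval-synthetic : ∀ a p y → eval p y F.≈ eval p a F.+ (y F.- a) F.* eval (synthetic a p) y
  eval-synthetic a []      y = F.sym (F.trans (F.+-identityˡ _) (F.zeroʳ _))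
  eval-synthetic a (x ∷ p) y = F.sym (F.trans (synthetic-step x y a _ _) (F.+-congˡ (F.*-congˡ (F.sym (eval-synthetic a p y)))))

  synthetic-below : ∀ a p {n} → Below p (suc n) → Below (synthetic a p) n
  synthetic-below a []      b i       _   = F.refl
  synthetic-below a (x ∷ p) b zero    z≤n = eval-zero p a (λ i → b (suc i) (s≤s z≤n))
  synthetic-below a (x ∷ p) {zero}  b (suc i) _ = synthetic-below a p (λ k _ → b (suc k) (s≤s z≤n)) i z≤n
  synthetic-below a (x ∷ p) {suc n} b (suc i) (s≤s n≤i) = synthetic-below a p (λ k n<k → b (suc k) (s≤s n<k)) i n≤i

  synthetic-top : ∀ a p {n} → Below p (suc (suc n)) → coeff (synthetic a p) n F.≈ coeff p (suc n)
  synthetic-top a []      b = F.refl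
  synthetic-top a (x ∷ p) {zero}  b = eval-below-1 p a (λ k 0<k → b (suc k) (s≤s 0<k))
  synthetic-top a (x ∷ p) {suc n} b = synthetic-top a p (λ k n<k → b (suc k) (s≤s n<k))

  Distinct : ∀ {n} → (Fin n → F.Carrier) → Set ℓ₁
  Distinct x = ∀ {i j} → x i F.≈ x j → i ≡ j

  distinct-tail : ∀ {n} {x : Fin (suc n) → F.Carrier} → Distinct x → Distinct (x ∘ Fin.suc)
  distinct-tail d eq = Finₚ.suc-injective (d eq)

  distinct-head : ∀ {n} {x : Fin (suc n) → F.Carrier} → Distinct x → ∀ i → x (Fin.suc i) F.- x Fin.zero F.≉ F.0#
  distinct-head d i eq with d (F.x-y≈0⇒x≈y _ _ eq)
  ... | ()

  -- Synthetic division by the first root leaves a quotient of smaller degree with the same top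
  -- coefficient; it still vanishes at the other points, since their differences from the first root
  -- are nonzero.
  eval-linear-factors : ∀ n p (x : Fin n → F.Carrier) → Distinct x → (∀ i → eval p (x i) F.≈ F.0#) →
    Below p (suc n) → ∀ y → eval p y F.≈ coeff p n F.* F.prod (λ i → y F.- x i)
  eval-linear-factors zero p x d roots b y = F.trans (eval-below-1 p y b) (F.sym (F.*-identityʳ _))
  eval-linear-factors (suc n) p x d roots b y = begin
    eval p y                                        ≈⟨ eval-synthetic x₀ p y ⟩
    eval p x₀ F.+ (y F.- x₀) F.* eval r y             ≈⟨ F.trans (F.+-congʳ (roots Fin.zero)) (F.+-identityˡ _) ⟩
    (y F.- x₀) F.* eval r y                          ≈⟨ F.*-congˡ (eval-linear-factors n r (x ∘ Fin.suc) (distinct-tail d) roots′ (synthetic-below x₀ p b) y) ⟩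
    (y F.- x₀) F.* (coeff r n F.* F.prod (λ i → y F.- x (Fin.suc i))) ≈⟨ rotate _ _ _ ⟩
    coeff r n F.* F.prod (λ i → y F.- x i)          ≈⟨ F.*-congʳ (synthetic-top x₀ p b) ⟩
    coeff p (suc n) F.* F.prod (λ i → y F.- x i)    ∎
    where
    x₀ = x Fin.zero
    r = synthetic x₀ p

    roots′ : ∀ i → eval r (x (Fin.suc i)) F.≈ F.0#
    roots′ i = F.x*y≈0⇒y≈0 (distinct-head d i) (begin
      (z F.- x₀) F.* eval r z              ≈⟨ F.+-identityˡ _ ⟨
      F.0# F.+ (z F.- x₀) F.* eval r z     ≈⟨ F.+-congʳ (roots Fin.zero) ⟨
      eval p x₀ F.+ (z F.- x₀) F.* eval r z ≈⟨ eval-synthetic x₀ p z ⟨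
      eval p z                            ≈⟨ roots (Fin.suc i) ⟩
      F.0#                                ∎)
      where z = x (Fin.suc i)

  many-roots⇒0 : ∀ n p (x : Fin n → F.Carrier) → Distinct x → (∀ i → eval p (x i) F.≈ F.0#) →
    Below p n → p ≋ []
  many-roots⇒0 zero    p x d roots b = ⟪ (λ i → b i z≤n) ⟫
  many-roots⇒0 (suc n) p x d roots b =
    many-roots⇒0 n p (x ∘ Fin.suc) (distinct-tail d) (roots ∘ Fin.suc) b′
    where
    difference≉0 : ∀ i → x Fin.zero F.- x (Fin.suc i) F.≉ F.0#
    difference≉0 i eq with d (F.x-y≈0⇒x≈y _ _ eq)
    ... | ()

    -- The last `n` points already determine `p` as its coefficient at `n` times a product of linear
    -- factors. At the first point this product is nonzero while `p` vanishes.
    top≈0 : coeff p n F.≈ F.0#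
    top≈0 = F.x*y≈0⇒y≈0 (F.prod≉0 _ difference≉0) (begin
      F.prod (λ i → x Fin.zero F.- x (Fin.suc i)) F.* coeff p n ≈⟨ F.*-comm _ _ ⟩
      coeff p n F.* F.prod (λ i → x Fin.zero F.- x (Fin.suc i)) ≈⟨ eval-linear-factors n p (x ∘ Fin.suc) (distinct-tail d) (roots ∘ Fin.suc) b (x Fin.zero) ⟨
      eval p (x Fin.zero) ≈⟨ roots Fin.zero ⟩
      F.0# ∎)

    b′ : Below p n
    b′ i n≤i with ℕₚ.m≤n⇒m<n∨m≡n n≤i
    ... | inj₁ n<i    = b i n<i
    ... | inj₂ ≡.refl = top≈0

  vanishing⇒0 : ∀ p → Below p Q → (∀ y → eval p y F.≈ F.0#) → p ≋ []
  vanishing⇒0 p b zeros = many-roots⇒0 Q p F.from distinct (λ i → zeros (F.from i)) b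
    where
    distinct : Distinct F.from
    distinct {i} {j} eq = ≡.trans (≡.sym (F.strictlyInverseˡ i)) (≡.trans (F.to-cong eq) (F.strictlyInverseˡ j))

-- Field embeddings and the Frobenius map.

module Embedding {a ℓ₁ ℓ₂ b ℓ₃ ℓ₄ Q s} (F : FiniteField a ℓ₁ ℓ₂ Q) (M : FiniteField b ℓ₃ ℓ₄ s)
  (j : FiniteField.Carrier F → FiniteField.Carrier M)
  (j-homomorphism : RingMorphisms.IsRingHomomorphism (FiniteField.rawRing F) (FiniteField.rawRing M) j) where
  private
    module F = FieldProperties F
    module M = FieldProperties M
    module F[x] where
      open PolynomialRing F public
      open PolynomialDivision F public
      open Evaluation F public
    module M[x] where
      open PolynomialRing M public
      open PolynomialDivision M public
      open Evaluation M public
  open RingMorphisms.IsRingHomomorphism j-homomorphism public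
    using (+-homo; *-homo; 0#-homo; 1#-homo; -‿homo) renaming (⟦⟧-cong to j-cong)
  open import Relation.Binary.Reasoning.Setoid M.setoid using (begin_; step-≈-⟩; step-≈-⟨; _∎)

  j≉0 : ∀ {x} → x F.≉ F.0# → j x M.≉ M.0#
  j≉0 {x} x≉0 jx≈0 = M.1≉0 (begin
    M.1#                  ≈⟨ 1#-homo ⟨
    j F.1#                ≈⟨ j-cong (F.inverseʳ x≉0) ⟨
    j (x F.* x F.⁻¹)      ≈⟨ *-homo _ _ ⟩
    j x M.* j (x F.⁻¹)    ≈⟨ M.*-congʳ jx≈0 ⟩
    M.0# M.* j (x F.⁻¹)   ≈⟨ M.zeroˡ _ ⟩
    M.0#                  ∎)

  j-- : ∀ x y → j (x F.- y) M.≈ j x M.- j y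
  j-- x y = M.trans (+-homo x (F.- y)) (M.+-congˡ (-‿homo y))

  j-^ : ∀ x n → j (x F.^ n) M.≈ j x M.^ n
  j-^ x zero    = 1#-homo
  j-^ x (suc n) = M.trans (*-homo x _) (M.*-congˡ (j-^ x n))

  map-coeff : ∀ p i → M[x].coeff (map j p) i M.≈ j (F[x].coeff p i)
  map-coeff []      i       = M.sym 0#-homo
  map-coeff (x ∷ p) zero    = M.refl
  map-coeff (x ∷ p) (suc i) = map-coeff p i

  map-cong : ∀ {p r} → p F[x].≋ r → map j p M[x].≋ map j r
  map-cong {p} {r} p≋r = M[x].⟪ (λ i → M.trans (map-coeff p i)
    (M.trans (j-cong (F[x].at p≋r i)) (M.sym (map-coeff r i)))) ⟫

  map-+ : ∀ p r → map j (p F[x].+ r) M[x].≋ map j p M[x].+ map j r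
  map-+ p r = M[x].⟪ (λ i → begin
    M[x].coeff (map j (p F[x].+ r)) i                       ≈⟨ map-coeff (p F[x].+ r) i ⟩
    j (F[x].coeff (p F[x].+ r) i)                           ≈⟨ M.trans (j-cong (F[x].coeff-+ p r i)) (+-homo _ _) ⟩
    j (F[x].coeff p i) M.+ j (F[x].coeff r i)               ≈⟨ M.+-cong (map-coeff p i) (map-coeff r i) ⟨
    M[x].coeff (map j p) i M.+ M[x].coeff (map j r) i       ≈⟨ M[x].coeff-+ (map j p) (map j r) i ⟨
    M[x].coeff (map j p M[x].+ map j r) i                   ∎) ⟫

  map-neg : ∀ p → map j (F[x].- p) M[x].≋ M[x].- map j p
  map-neg p = M[x].⟪ (λ i → begin
    M[x].coeff (map j (F[x].- p)) i    ≈⟨ map-coeff (F[x].- p) i ⟩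
    j (F[x].coeff (F[x].- p) i)        ≈⟨ M.trans (j-cong (F[x].coeff-neg p i)) (-‿homo _) ⟩
    M.- j (F[x].coeff p i)             ≈⟨ M.-‿cong (map-coeff p i) ⟨
    M.- M[x].coeff (map j p) i         ≈⟨ M[x].coeff-neg (map j p) i ⟨
    M[x].coeff (M[x].- map j p) i      ∎) ⟫

  map-· : ∀ c p → map j (c F[x].· p) M[x].≋ j c M[x].· map j p
  map-· c p = M[x].⟪ (λ i → begin
    M[x].coeff (map j (c F[x].· p)) i  ≈⟨ map-coeff (c F[x].· p) i ⟩
    j (F[x].coeff (c F[x].· p) i)      ≈⟨ M.trans (j-cong (F[x].coeff-· c p i)) (*-homo _ _) ⟩
    j c M.* j (F[x].coeff p i)         ≈⟨ M.*-congˡ (map-coeff p i) ⟨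
    j c M.* M[x].coeff (map j p) i     ≈⟨ M[x].coeff-· (j c) (map j p) i ⟨
    M[x].coeff (j c M[x].· map j p) i  ∎) ⟫

  map-* : ∀ p r → map j (p F[x].* r) M[x].≋ map j p M[x].* map j r
  map-* []      r = M[x].P.refl
  map-* (x ∷ p) r = M[x].P.trans (map-+ (x F[x].· r) (F.0# ∷ p F[x].* r))
    (M[x].P.+-cong {map j (x F[x].· r)} {j x M[x].· map j r} (map-· x r) M[x].⟪ M[x].∷-cong 0#-homo (M[x].at (map-* p r)) ⟫)

  map-1 : map j (F.1# ∷ []) M[x].≋ M.1# ∷ []
  map-1 = M[x].⟪ M[x].∷-cong 1#-homo (λ i → M.refl) ⟫

  map-^ : ∀ p n → map j (p F[x].^ n) M[x].≋ map j p M[x].^ n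
  map-^ p zero    = map-1
  map-^ p (suc n) = M[x].P.trans (map-* p (p F[x].^ n)) (M[x].P.*-congˡ {map j p} (map-^ p n))

  map-hasDeg : ∀ {p n} → F[x].HasDeg p n → M[x].HasDeg (map j p) n
  map-hasDeg {p} {n} hp = record
    { lead  = λ eq → j≉0 (F[x].lead hp) (M.trans (M.sym (map-coeff p n)) eq)
    ; below = λ i n<i → M.trans (map-coeff p i) (M.trans (j-cong (F[x].below hp i n<i)) 0#-homo) }

  ev : F[x].Poly → M.Carrier → M.Carrier
  ev p = M[x].eval (map j p)

  ev-cong : ∀ {p r y} → p F[x].≋ r → ev p y M.≈ ev r y
  ev-cong p≋r = M[x].eval-cong (map-cong p≋r)

  ev-congʳ : ∀ p {y z} → y M.≈ z → ev p y M.≈ ev p z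
  ev-congʳ p = M[x].eval-congʳ (map j p)

  ev-+ : ∀ p r y → ev (p F[x].+ r) y M.≈ ev p y M.+ ev r y
  ev-+ p r y = M.trans (M[x].eval-cong (map-+ p r)) (M[x].eval-+ (map j p) (map j r) y)

  ev-- : ∀ p r y → ev (p F[x].- r) y M.≈ ev p y M.- ev r y
  ev-- p r y = M.trans (ev-+ p (F[x].- r) y) (M.+-congˡ
    (M.trans (M[x].eval-cong (map-neg r)) (M[x].eval-neg (map j r) y)))

  ev-· : ∀ c p y → ev (c F[x].· p) y M.≈ j c M.* ev p y
  ev-· c p y = M.trans (M[x].eval-cong (map-· c p)) (M[x].eval-· (j c) (map j p) y)

  ev-* : ∀ p r y → ev (p F[x].* r) y M.≈ ev p y M.* ev r y
  ev-* p r y = M.trans (M[x].eval-cong (map-* p r)) (M[x].eval-* (map j p) (map j r) y)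

  ev-^ : ∀ p n y → ev (p F[x].^ n) y M.≈ ev p y M.^ n
  ev-^ p n y = M.trans (M[x].eval-cong (map-^ p n)) (M[x].eval-^ (map j p) n y)

  ev-1 : ∀ y → ev (F.1# ∷ []) y M.≈ M.1#
  ev-1 y = M.trans (M[x].eval-const (j F.1#) y) 1#-homo

  ev-x+ : ∀ z y → ev (F[x].x+ z) y M.≈ y M.+ j z
  ev-x+ z y = M.trans (M[x].eval-cong {map j (F[x].x+ z)} {M[x].x+ j z}
    M[x].⟪ M[x].∷-cong M.refl (M[x].at map-1) ⟫) (M[x].eval-x+ (j z) y)

  ev-j : ∀ p x → ev p (j x) M.≈ j (F[x].eval p x)
  ev-j []      x = M.sym 0#-homo
  ev-j (y ∷ p) x = M.trans (M.+-congˡ (M.trans (M.*-congˡ (ev-j p x)) (M.sym (*-homo _ _)))) (M.sym (+-homo _ _))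

  private
    -- (X + 1)^Q - X^Q - 1 has degree less than Q and vanishes on F.
    frobenius-defect : F[x].Poly
    frobenius-defect = ((F[x].x+ F.1#) F[x].^ Q F[x].- (F[x].x+ F.0#) F[x].^ Q) F[x].- (F.1# ∷ [])

    frobenius-defect≋0 : frobenius-defect F[x].≋ []
    frobenius-defect≋0 = F[x].vanishing⇒0 frobenius-defect small zeros
      where
      u = (F[x].x+ F.1#) F[x].^ Q
      v = (F[x].x+ F.0#) F[x].^ Q

      const-below : ∀ i → Q ℕ.≤ i → F[x].coeff (F.1# ∷ []) i F.≈ F.0#
      const-below zero Q≤0 with ≡.trans (≡.sym (proj₂ F.Q≡suc)) (ℕₚ.n≤0⇒n≡0 Q≤0)
      ... | ()
      const-below (suc i) _ = F.refl

      cancel : ∀ i → Q ℕ.≤ i → F[x].coeff u i F.≈ F[x].coeff v i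
      cancel i Q≤i with ℕₚ.m≤n⇒m<n∨m≡n Q≤i
      ... | inj₁ Q<i = F.trans (F[x].below (F[x].x+^-hasDeg F.1# Q) i Q<i)
        (F.sym (F[x].below (F[x].x+^-hasDeg F.0# Q) i Q<i))
      ... | inj₂ ≡.refl = F.trans (F[x].x+^-monic F.1# Q) (F.sym (F[x].x+^-monic F.0# Q))

      small : F[x].Below frobenius-defect Q
      small i Q≤i = F.trans (F[x].coeff-- (u F[x].- v) _ i) (F.trans (F.+-cong
        (F.trans (F[x].coeff-- u v i) (F.x≈y⇒x-y≈0 (cancel i Q≤i)))
        (F.trans (F.-‿cong (const-below i Q≤i)) F.-0#≈0#)) (F.+-identityˡ _))

      value : ∀ z y → F[x].eval ((F[x].x+ z) F[x].^ Q) y F.≈ y F.+ z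
      value z y = F.trans (F[x].eval-^ (F[x].x+ z) Q y) (F.trans (F.fermat _) (F[x].eval-x+ z y))

      zeros : ∀ y → F[x].eval frobenius-defect y F.≈ F.0#
      zeros y = F.trans (F[x].eval-- (u F[x].- v) (F.1# ∷ []) y) (F.trans (F.+-cong
        (F.trans (F[x].eval-- u v y) (F.+-cong (value F.1# y) (F.-‿cong (value F.0# y))))
        (F.-‿cong (F[x].eval-const F.1# y)))
        (solve 1 (λ y → ((y :+ con (+ 1)) :- (y :+ con (+ 0))) :- con (+ 1) := con (+ 0)) F.refl y))
        where open IntegerCoefficients F.commutativeRing using (solve; _:+_; _:-_; _:=_; con)

    -- The defect is the zero polynomial over `F`, hence vanishes at every point of the larger field
    -- `M`, whose elements need not satisfy x^Q = x.
    frobenius-+1 : ∀ x → (x M.+ M.1#) M.^ Q M.≈ x M.^ Q M.+ M.1#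
    frobenius-+1 x = begin
      (x M.+ M.1#) M.^ Q        ≈⟨ value F.1# M.1# 1#-homo ⟨
      ev u x                    ≈⟨ solve 3 (λ u v w → u := ((u :- v) :- w) :+ (v :+ w)) M.refl (ev u x) (ev v x) (ev o x) ⟩
      ((ev u x M.- ev v x) M.- ev o x) M.+ (ev v x M.+ ev o x) ≈⟨ M.+-congʳ (M.trans (ev-- (u F[x].- v) o x) (M.+-congʳ (ev-- u v x))) ⟨
      ev frobenius-defect x M.+ (ev v x M.+ ev o x) ≈⟨ M.+-cong (ev-cong {frobenius-defect} {[]} frobenius-defect≋0) (M.+-cong (M.trans (value F.0# M.0# 0#-homo) (M.^-congˡ Q (M.+-identityʳ x))) (ev-1 x)) ⟩
      M.0# M.+ (x M.^ Q M.+ M.1#) ≈⟨ M.+-identityˡ _ ⟩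
      x M.^ Q M.+ M.1#          ∎
      where
      open IntegerCoefficients M.commutativeRing using (solve; _:+_; _:-_; _:=_)
      u = (F[x].x+ F.1#) F[x].^ Q
      v = (F[x].x+ F.0#) F[x].^ Q
      o = F.1# ∷ []
      value : ∀ z z′ → j z M.≈ z′ → ev ((F[x].x+ z) F[x].^ Q) x M.≈ (x M.+ z′) M.^ Q
      value z z′ eq = M.trans (ev-^ (F[x].x+ z) Q x) (M.^-congˡ Q (M.trans (ev-x+ z x) (M.+-congˡ eq)))

    -- For y ≠ 0 write x + y = (x/y + 1) y, which reduces additivity to the case of adding 1.
    frobenius-+-once : ∀ x y → (x M.+ y) M.^ Q M.≈ x M.^ Q M.+ y M.^ Q
    frobenius-+-once x y with y M.≟ M.0#
    ... | yes y≈0 = let n , Q≡ = F.Q≡suc in begin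
      (x M.+ y) M.^ Q      ≈⟨ M.^-congˡ Q (M.trans (M.+-congˡ y≈0) (M.+-identityʳ x)) ⟩
      x M.^ Q              ≈⟨ M.+-identityʳ _ ⟨
      x M.^ Q M.+ M.0#     ≈⟨ M.+-congˡ (M.trans (M.^-congʳ y Q≡) (M.0^suc n y≈0)) ⟨
      x M.^ Q M.+ y M.^ Q  ∎
    ... | no y≉0 = begin
      (x M.+ y) M.^ Q                     ≈⟨ M.^-congˡ Q (M.trans (M.distribʳ y w M.1#) (M.+-cong wy≈x (M.*-identityˡ y))) ⟨
      ((w M.+ M.1#) M.* y) M.^ Q          ≈⟨ M.^-distrib-* _ y Q ⟩
      (w M.+ M.1#) M.^ Q M.* y M.^ Q      ≈⟨ M.*-congʳ (frobenius-+1 w) ⟩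
      (w M.^ Q M.+ M.1#) M.* y M.^ Q      ≈⟨ M.trans (M.distribʳ _ _ _) (M.+-congˡ (M.*-identityˡ _)) ⟩
      w M.^ Q M.* y M.^ Q M.+ y M.^ Q     ≈⟨ M.+-congʳ (M.trans (M.sym (M.^-distrib-* w y Q)) (M.^-congˡ Q wy≈x)) ⟩
      x M.^ Q M.+ y M.^ Q                 ∎
      where
      w = x M.* y M.⁻¹
      wy≈x : w M.* y M.≈ x
      wy≈x = M.trans (M.*-assoc _ _ _) (M.trans (M.*-congˡ (M.inverseˡ y≉0)) (M.*-identityʳ x))

  frobenius-step : ∀ x v → x M.^ (Q ℕ.^ suc v) M.≈ (x M.^ Q) M.^ (Q ℕ.^ v)
  frobenius-step x v = M.sym (M.^-assocʳ x Q (Q ℕ.^ v))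

  frobenius-+ : ∀ v x y → (x M.+ y) M.^ (Q ℕ.^ v) M.≈ x M.^ (Q ℕ.^ v) M.+ y M.^ (Q ℕ.^ v)
  frobenius-+ zero    x y = M.trans (M.*-identityʳ _) (M.+-cong (M.sym (M.*-identityʳ x)) (M.sym (M.*-identityʳ y)))
  frobenius-+ (suc v) x y = begin
    (x M.+ y) M.^ (Q ℕ.^ suc v)                ≈⟨ frobenius-step _ v ⟩
    ((x M.+ y) M.^ Q) M.^ (Q ℕ.^ v)            ≈⟨ M.^-congˡ (Q ℕ.^ v) (frobenius-+-once x y) ⟩
    (x M.^ Q M.+ y M.^ Q) M.^ (Q ℕ.^ v)        ≈⟨ frobenius-+ v _ _ ⟩
    (x M.^ Q) M.^ (Q ℕ.^ v) M.+ (y M.^ Q) M.^ (Q ℕ.^ v) ≈⟨ M.+-cong (frobenius-step x v) (frobenius-step y v) ⟨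
    x M.^ (Q ℕ.^ suc v) M.+ y M.^ (Q ℕ.^ suc v) ∎

  frobenius-j : ∀ v x → j x M.^ (Q ℕ.^ v) M.≈ j x
  frobenius-j v x = M.trans (M.sym (j-^ x (Q ℕ.^ v))) (j-cong (F.fermat-iterate x v))

  frobenius-0 : ∀ v → M.0# M.^ (Q ℕ.^ v) M.≈ M.0#
  frobenius-0 v = M.trans (M.^-congˡ (Q ℕ.^ v) (M.sym 0#-homo)) (M.trans (frobenius-j v F.0#) 0#-homo)

  -- The map is additive and multiplicative and fixes the coefficients, which come from `F`.
  ev-frobenius : ∀ v p y → ev p (y M.^ (Q ℕ.^ v)) M.≈ ev p y M.^ (Q ℕ.^ v)
  ev-frobenius v []      y = M.sym (frobenius-0 v)
  ev-frobenius v (x ∷ p) y = M.sym (begin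
    (j x M.+ y M.* ev p y) M.^ (Q ℕ.^ v)                       ≈⟨ frobenius-+ v _ _ ⟩
    j x M.^ (Q ℕ.^ v) M.+ (y M.* ev p y) M.^ (Q ℕ.^ v)         ≈⟨ M.+-cong (frobenius-j v x) (M.^-distrib-* y _ (Q ℕ.^ v)) ⟩
    j x M.+ y M.^ (Q ℕ.^ v) M.* ev p y M.^ (Q ℕ.^ v)           ≈⟨ M.+-congˡ (M.*-congˡ (ev-frobenius v p y)) ⟨
    j x M.+ y M.^ (Q ℕ.^ v) M.* ev p (y M.^ (Q ℕ.^ v))         ∎)

  root-frobenius : ∀ v p {y} → ev p y M.≈ M.0# → ev p (y M.^ (Q ℕ.^ v)) M.≈ M.0#
  root-frobenius v p eq = M.trans (ev-frobenius v p _) (M.trans (M.^-congˡ (Q ℕ.^ v) eq) (frobenius-0 v))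

-- The residue field F[x]/(s).

module ResidueField {a ℓ₁ ℓ₂ Q} (F : FiniteField a ℓ₁ ℓ₂ Q) {s : Polynomial.Poly F} {e : ℕ}
  (irreducible : Polynomial.Irreducible F s) (hasDeg : PolynomialDivision.HasDeg F s e) where
  private
    module F = FieldProperties F
  open PolynomialRing F
  open PolynomialDivision F
  open Remainder hasDeg
  open IntegerCoefficients polynomialRing using (solve; con; _:+_; _:*_; _:-_; :-_; _:=_)

  infix 4 _~_
  -- Congruence modulo `s`, a record for the same reason as `_≋_`: both sides can be inferred from a
  -- proof.
  record _~_ (p r : Poly) : Set (a ⊔ ℓ₁) where
    constructor mod
    field
      quotient  : Poly
      congruent : p - r ≋ quotient * s
  open _~_

  private
    one : Poly
    one = F.1# ∷ []

    ~-divides : ∀ {p r} → p ~ r → Divides s (p - r)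
    ~-divides (mod k eq) = k , eq

    lift : ∀ {p r} → p ≋ r → p ~ r
    lift {p} {r} p≋r = mod [] (P.trans (P.+-congʳ { - r } {p} {r} p≋r) (P.-‿inverseʳ r))

    ~-sym : ∀ {p r} → p ~ r → r ~ p
    ~-sym {p} {r} (mod k eq) = mod (- k) (P.trans
      (solve 2 (λ p r → r :- p := :- (p :- r)) P.refl p r)
      (P.trans (P.-‿cong eq) (solve 2 (λ k s → :- (k :* s) := (:- k) :* s) P.refl k s)))

    ~-trans : ∀ {p r t} → p ~ r → r ~ t → p ~ t
    ~-trans {p} {r} {t} (mod k eq) (mod l eq′) = mod (k + l) (P.trans
      (solve 3 (λ p r t → p :- t := (p :- r) :+ (r :- t)) P.refl p r t)
      (P.trans (P.+-cong eq eq′) (P.sym (P.distribʳ s k l))))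

    ~-+ : ∀ {p p′ r r′} → p ~ p′ → r ~ r′ → p + r ~ p′ + r′
    ~-+ {p} {p′} {r} {r′} (mod k eq) (mod l eq′) = mod (k + l) (P.trans
      (solve 4 (λ p p′ r r′ → (p :+ r) :- (p′ :+ r′) := (p :- p′) :+ (r :- r′)) P.refl p p′ r r′)
      (P.trans (P.+-cong eq eq′) (P.sym (P.distribʳ s k l))))

    ~-neg : ∀ {p p′} → p ~ p′ → - p ~ - p′
    ~-neg {p} {p′} (mod k eq) = mod (- k) (P.trans
      (solve 2 (λ p p′ → (:- p) :- (:- p′) := :- (p :- p′)) P.refl p p′)
      (P.trans (P.-‿cong eq) (solve 2 (λ k s → :- (k :* s) := (:- k) :* s) P.refl k s)))

    ~-* : ∀ {p p′ r r′} → p ~ p′ → r ~ r′ → p * r ~ p′ * r′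
    ~-* {p} {p′} {r} {r′} (mod k eq) (mod l eq′) = mod (k * r + p′ * l) (P.trans
      (solve 4 (λ p p′ r r′ → p :* r :- p′ :* r′ := (p :- p′) :* r :+ p′ :* (r :- r′)) P.refl p p′ r r′)
      (P.trans (P.+-cong (P.*-congʳ {r} eq) (P.*-congˡ {p′} eq′))
        (solve 5 (λ k l r p′ s → (k :* s) :* r :+ p′ :* (l :* s) := (k :* r :+ p′ :* l) :* s) P.refl k l r p′ s)))

    ~rem : ∀ p → p ~ rem p
    ~rem p = mod (quot p) (P.trans (P.+-congʳ { - rem p } (division p))
      (solve 2 (λ u v → (u :+ v) :- v := u) P.refl (quot p * s) (rem p)))

    ~-below : ∀ {p r} → p ~ r → Below p e → Below r e → p ≋ r
    ~-below {p} {r} p~r bp br = ⟪ (λ i → F.x-y≈0⇒x≈y _ _ (F.trans (F.sym (coeff-- p r i)) (at difference≋0 i))) ⟫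
      where
      difference≋0 : p - r ≋ []
      difference≋0 = multiple-below (~-divides p~r) (λ i e≤i →
        F.trans (coeff-- p r i) (F.x≈y⇒x-y≈0 (F.trans (bp i e≤i) (F.sym (br i e≤i)))))

    -- A congruence holds exactly if the remainder of the difference is zero. Decidability is what
    -- makes negated congruence a tight apartness relation, as a Heyting field demands.
    ~? : ∀ p r → Dec (p ~ r)
    ~? p r with degree? (rem (p - r))
    ... | inj₁ rem≋0 = yes (mod (quotient p-r~0) (P.trans (P.sym (P.+-identityʳ (p - r))) (congruent p-r~0)))
      where
      p-r~0 : p - r ~ []
      p-r~0 = ~-trans (~rem (p - r)) (lift rem≋0)
    ... | inj₂ hr = no λ p~r → hasDeg≉0 hr (~-below
      (~-trans (~-sym (~rem (p - r))) (mod (quotient p~r) (P.trans (P.+-identityʳ (p - r)) (congruent p~r))))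
      (rem-below (p - r)) (λ i _ → F.refl))

    1≁0 : ¬ one ~ []
    1≁0 (mod k eq) = Irreducible.p∤1 irreducible (k , at (P.trans (P.sym eq) (P.+-identityʳ one)))

    ~-ring : CommutativeRing a (a ⊔ ℓ₁)
    ~-ring = record
      { Carrier = Poly ; _≈_ = _~_ ; _+_ = _+_ ; _*_ = _*_ ; -_ = -_ ; 0# = [] ; 1# = one
      ; isCommutativeRing = record
        { isRing = record
          { +-isAbelianGroup = record
            { isGroup = record
              { isMonoid = record
                { isSemigroup = record
                  { isMagma = record
                    { isEquivalence = record { refl = lift P.refl ; sym = ~-sym ; trans = ~-trans }
                    ; ∙-cong = ~-+ }
                  ; assoc = λ p r t → lift (P.+-assoc p r t) }
                ; identity = (λ p → lift (P.+-identityˡ p)) , (λ p → lift (P.+-identityʳ p)) }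
              ; inverse = (λ p → lift (P.-‿inverseˡ p)) , (λ p → lift (P.-‿inverseʳ p))
              ; ⁻¹-cong = ~-neg }
            ; comm = λ p r → lift (P.+-comm p r) }
          ; *-cong = ~-*
          ; *-assoc = λ p r t → lift (P.*-assoc p r t)
          ; *-identity = (λ p → lift (P.*-identityˡ p)) , (λ p → lift (P.*-identityʳ p))
          ; distrib = (λ p r t → lift (P.distribˡ p r t)) , (λ p r t → lift (P.distribʳ p r t)) }
        ; *-comm = λ p r → lift (P.*-comm p r) } }

    ~-inverse : ∀ {p} → ¬ p ~ [] → ∃ λ u → p * u ~ one
    ~-inverse {p} p≁0 with degree? (rem p)
    ... | inj₁ rem≋0 = ⊥-elim (p≁0 (~-trans (~rem p) (lift rem≋0)))
    ... | inj₂ hr with inverse-modulo irreducible hasDeg hr (hasDeg-below hr (rem-below p))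
    ...   | u , w , eq = u , ~-trans (~-* (~rem p) (lift (P.refl {u}))) (mod w eq)

    ~-invertible : ∀ {p r} → ¬ p ~ r → ∃ λ u → u * (p - r) ~ one × (p - r) * u ~ one
    ~-invertible {p} {r} p≁r with ~-inverse {p - r} (λ (mod k eq) → p≁r (mod k (P.trans (P.sym (P.+-identityʳ (p - r))) eq)))
    ... | u , eq = u , ~-trans (lift (P.*-comm u (p - r))) eq , eq

    invertible⇒≁ : ∀ {p r} → (∃ λ u → u * (p - r) ~ one × (p - r) * u ~ one) → ¬ p ~ r
    invertible⇒≁ {p} {r} (u , _ , eq) p~r = 1≁0 (~-trans (~-sym eq)
      (~-* {p - r} {[]} {u} {u} (mod (quotient p~r) (P.trans (P.+-identityʳ (p - r)) (congruent p~r))) (lift P.refl)))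

    ≁-cotrans : ∀ {p r} → ¬ p ~ r → ∀ t → ¬ p ~ t ⊎ ¬ t ~ r
    ≁-cotrans {p} p≁r t with ~? p t
    ... | yes p~t = inj₂ (λ t~r → p≁r (~-trans p~t t~r))
    ... | no p≁t  = inj₁ p≁t

    ~-stable : ∀ p r → ¬ ¬ p ~ r → p ~ r
    ~-stable p r ¬¬p~r with ~? p r
    ... | yes p~r = p~r
    ... | no p≁r  = ⊥-elim (¬¬p~r p≁r)

    ~-field : HeytingField a (a ⊔ ℓ₁) (a ⊔ ℓ₁)
    ~-field = record
      { Carrier = Poly ; _≈_ = _~_ ; _#_ = λ p r → ¬ p ~ r
      ; _+_ = _+_ ; _*_ = _*_ ; -_ = -_ ; 0# = [] ; 1# = one
      ; isHeytingField = record
        { isHeytingCommutativeRing = record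
          { isCommutativeRing = CommutativeRing.isCommutativeRing ~-ring
          ; isApartnessRelation = record
            { irrefl  = λ p~r p≁r → p≁r p~r
            ; sym     = λ p≁r r~p → p≁r (~-sym r~p)
            ; cotrans = ≁-cotrans }
          ; #⇒invertible = ~-invertible
          ; invertible⇒# = invertible⇒≁ }
        ; tight = λ p r → ~-stable p r , λ p~r p≁r → p≁r p~r } }

    funToFin-cong : ∀ {m n} {f g : Fin m → Fin n} → (∀ i → f i ≡ g i) → Fin.funToFin f ≡ Fin.funToFin g
    funToFin-cong {zero}  f≗g = ≡.refl
    funToFin-cong {suc m} f≗g = ≡.cong₂ Fin.combine (f≗g Fin.zero) (funToFin-cong (f≗g ∘ Fin.suc))

    -- A class is numbered by the `e` coefficients of its remainder, taken as digits in base `Q`.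
    encode : Poly → Fin (Q ℕ.^ e)
    encode p = Fin.funToFin {e} (λ i → F.to (coeff (rem p) (toℕ i)))

    decode : Fin (Q ℕ.^ e) → Poly
    decode k = List.tabulate {n = e} (λ i → F.from (Fin.finToFun k i))

    coeff-tabulate : ∀ {n} (f : Fin n → F.Carrier) i → coeff (List.tabulate f) (toℕ i) ≡ f i
    coeff-tabulate f Fin.zero    = ≡.refl
    coeff-tabulate f (Fin.suc i) = coeff-tabulate (f ∘ Fin.suc) i

    tabulate-below : ∀ {n} (f : Fin n → F.Carrier) → Below (List.tabulate f) n
    tabulate-below {zero}  f i       _         = F.refl
    tabulate-below {suc n} f (suc i) (s≤s n≤i) = tabulate-below (f ∘ Fin.suc) i n≤i

    below-≈ : ∀ {p r} → Below p e → Below r e →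
      (∀ (i : Fin e) → coeff p (toℕ i) F.≈ coeff r (toℕ i)) → p ≋ r
    below-≈ {p} {r} bp br eq = ⟪ pointwise ⟫
      where
      pointwise : p ≈ r
      pointwise i with i ℕₚ.<? e
      ... | no i≮e  = F.trans (bp i (ℕₚ.≮⇒≥ i≮e)) (F.sym (br i (ℕₚ.≮⇒≥ i≮e)))
      ... | yes i<e = ≡.subst (λ k → coeff p k F.≈ coeff r k) (Finₚ.toℕ-fromℕ< i<e) (eq (Fin.fromℕ< i<e))

    encode-cong : ∀ {p r} → p ~ r → encode p ≡ encode r
    encode-cong {p} {r} p~r = funToFin-cong {e} (λ i → F.to-cong (at (~-below
      (~-trans (~-sym (~rem p)) (~-trans p~r (~rem r))) (rem-below p) (rem-below r)) (toℕ i)))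

    encode-decode : ∀ k → encode (decode k) ≡ k
    encode-decode k = ≡.trans (funToFin-cong {e} pointwise) (Finₚ.funToFin-finToFin {e} k)
      where
      f : Fin e → F.Carrier
      f i = F.from (Fin.finToFun k i)

      rem≋ : rem (decode k) ≋ decode k
      rem≋ = ~-below (~-sym (~rem (decode k))) (rem-below (decode k)) (tabulate-below f)

      pointwise : ∀ i → F.to (coeff (rem (decode k)) (toℕ i)) ≡ Fin.finToFun k i
      pointwise i = ≡.trans (F.to-cong (at rem≋ (toℕ i)))
        (≡.trans (≡.cong F.to (coeff-tabulate f i)) (F.strictlyInverseˡ _))

    decode-encode : ∀ p → decode (encode p) ~ p
    decode-encode p = ~-trans (lift (below-≈ (tabulate-below f) (rem-below p) coefficients)) (~-sym (~rem p))
      where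
      f : Fin e → F.Carrier
      f i = F.from (Fin.finToFun (encode p) i)

      coefficients : ∀ i → coeff (List.tabulate f) (toℕ i) F.≈ coeff (rem p) (toℕ i)
      coefficients i = F.trans (F.reflexive (≡.trans (coeff-tabulate f i)
        (≡.cong F.from (Finₚ.finToFun-funToFin (λ i → F.to (coeff (rem p) (toℕ i))) i))))
        (F.strictlyInverseʳ _)

  residueField : FiniteField a (a ⊔ ℓ₁) (a ⊔ ℓ₁) (Q ℕ.^ e)
  residueField = record
    { heytingField = ~-field
    ; enumeration = record
      { to = encode ; from = decode ; to-cong = encode-cong ; from-cong = λ { ≡.refl → lift P.refl }
      ; inverse = (λ {k} p~ → ≡.trans (encode-cong p~) (encode-decode k))
                , (λ { {p} ≡.refl → decode-encode p }) } }

  const : F.Carrier → Poly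
  const x = x ∷ []

  const-homomorphism : RingMorphisms.IsRingHomomorphism (FiniteField.rawRing F) (FiniteField.rawRing residueField) const
  const-homomorphism = record
    { isSemiringHomomorphism = record
      { isNearSemiringHomomorphism = record
        { +-isMonoidHomomorphism = record
          { isMagmaHomomorphism = record
            { isRelHomomorphism = record { cong = λ x≈y → lift ⟪ ∷-cong x≈y (λ i → F.refl) ⟫ }
            ; homo = λ x y → lift P.refl }
          ; ε-homo = lift ⟪ (λ { zero → F.refl ; (suc i) → F.refl }) ⟫ }
        ; *-homo = λ x y → lift ⟪ ∷-cong (F.sym (F.+-identityʳ _)) (λ i → F.refl) ⟫ }
      ; 1#-homo = lift P.refl }
    ; -‿homo = λ x → lift P.refl }

  generator : Poly
  generator = F.0# ∷ F.1# ∷ []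

  module E = FieldProperties residueField
  open Embedding F residueField const const-homomorphism public

  -- The classes are represented by polynomials, so substituting the class of X returns the
  -- polynomial itself. This gives at once that X is a root of `s` and that it generates the field.
  ev-generator : ∀ p → ev p generator E.≈ p
  ev-generator []      = lift P.refl
  ev-generator (x ∷ p) = E.trans (E.+-congˡ {const x} (E.*-congˡ {generator} (ev-generator p)))
    (lift ⟪ (λ i → F.trans (coeff-+ (x ∷ []) (generator * p) i) (F.trans
      (F.+-congˡ (F.trans (shift-* one p i) (∷-cong F.refl (*-identityˡ p) i))) (sums i))) ⟫)
    where
    sums : ∀ i → coeff (x ∷ []) i F.+ coeff (F.0# ∷ p) i F.≈ coeff (x ∷ p) i
    sums zero    = F.+-identityʳ x
    sums (suc i) = F.+-identityˡ _

  generator-root : ev s generator E.≈ E.0#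
  generator-root = ~-trans {ev s generator} {s} {[]} (ev-generator s) s~0
    where
    s~0 : s ~ []
    s~0 = mod one (P.trans (P.+-identityʳ s) (P.sym (P.*-identityˡ s)))

-- The interface through which F[x]/(s) enters the later arguments: a field with `Q ℕ.^ e` elements
-- all of which are polynomial expressions in one root of `s`.
record RootExtension {a ℓ₁ ℓ₂ Q} (F : FiniteField a ℓ₁ ℓ₂ Q) (s : Polynomial.Poly F) (e : ℕ) : Set (Level.suc (a ⊔ ℓ₁ ⊔ ℓ₂)) where
  field
    field′       : FiniteField a (a ⊔ ℓ₁) (a ⊔ ℓ₁) (Q ℕ.^ e)
    j            : FiniteField.Carrier F → FiniteField.Carrier field′
    homomorphism : RingMorphisms.IsRingHomomorphism (FiniteField.rawRing F) (FiniteField.rawRing field′) j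
    β            : FiniteField.Carrier field′

  open FieldProperties field′ using (_≈_; 0#)
  open Embedding F field′ j homomorphism using (ev)

  field
    root      : ev s β ≈ 0#
    generated : ∀ y → ∃ λ p → ev p β ≈ y

adjoinRoot : ∀ {a ℓ₁ ℓ₂ Q} (F : FiniteField a ℓ₁ ℓ₂ Q) {s e} →
  Polynomial.Irreducible F s → PolynomialDivision.HasDeg F s e → RootExtension F s e
adjoinRoot F irreducible hasDeg = record
  { field′ = residueField ; j = const ; homomorphism = const-homomorphism ; β = generator
  ; root = generator-root ; generated = λ p → p , ev-generator p }
  where open ResidueField F irreducible hasDeg

-- Minimal polynomials and Frobenius periods of roots.

module Roots {a ℓ₁ ℓ₂ b ℓ₃ ℓ₄ Q S} (F : FiniteField a ℓ₁ ℓ₂ Q) (M : FiniteField b ℓ₃ ℓ₄ S)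
  (j : FiniteField.Carrier F → FiniteField.Carrier M)
  (j-homomorphism : RingMorphisms.IsRingHomomorphism (FiniteField.rawRing F) (FiniteField.rawRing M) j) where
  private
    module F = FieldProperties F
    module M = FieldProperties M
  open PolynomialRing F
  open PolynomialDivision F
  open Embedding F M j j-homomorphism

  ev-multiple : ∀ {s p β} → Divides s p → ev s β M.≈ M.0# → ev p β M.≈ M.0#
  ev-multiple {s} {p} {β} (k , p≋ks) root = M.trans (ev-cong {p} {k * s} p≋ks)
    (M.trans (ev-* k s β) (M.trans (M.*-congˡ root) (M.zeroʳ _)))

  -- The remainder of `p` also vanishes at β. Were it nonzero, it would be invertible modulo `s`,
  -- and evaluating that congruence at β would give 1 = 0.
  root⇒divides : ∀ {s e β} → Irreducible s → HasDeg s e → ev s β M.≈ M.0# →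
    ∀ p → ev p β M.≈ M.0# → Divides s p
  root⇒divides {s} {e} {β} irr hs root p p-root with degree? (Remainder.rem hs p)
  ... | inj₁ r≋0 = k , P.trans (Remainder.division hs p) (P.trans (P.+-congˡ {k * s} r≋0) (P.+-identityʳ (k * s)))
    where k = Remainder.quot hs p
  ... | inj₂ hr = ⊥-elim (absurd (inverse-modulo irr hs hr (hasDeg-below hr (Remainder.rem-below hs p))))
    where
    open import Relation.Binary.Reasoning.Setoid M.setoid using (begin_; step-≈-⟩; step-≈-⟨; _∎)
    k = Remainder.quot hs p
    r = Remainder.rem hs p
    one = F.1# ∷ []

    r-root : ev r β M.≈ M.0#
    r-root = begin
      ev r β                     ≈⟨ M.+-identityˡ _ ⟨
      M.0# M.+ ev r β            ≈⟨ M.+-congʳ (ev-multiple {s} {k * s} (k , P.refl) root) ⟨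
      ev (k * s) β M.+ ev r β    ≈⟨ ev-+ (k * s) r β ⟨
      ev (k * s + r) β           ≈⟨ ev-cong {p} {k * s + r} (Remainder.division hs p) ⟨
      ev p β                     ≈⟨ p-root ⟩
      M.0#                       ∎

    absurd : (∃ λ u → Divides s (r * u - one)) → ⊥
    absurd (u , s∣ru-1) = M.1≉0 (begin
      M.1#                       ≈⟨ ev-1 β ⟨
      ev one β                   ≈⟨ M.x-y≈0⇒x≈y _ _ (M.trans (M.sym (ev-- (r * u) one β)) (ev-multiple {s} {r * u - one} s∣ru-1 root)) ⟨
      ev (r * u) β               ≈⟨ ev-* r u β ⟩
      ev r β M.* ev u β          ≈⟨ M.*-congʳ r-root ⟩
      M.0# M.* ev u β            ≈⟨ M.zeroˡ _ ⟩
      M.0#                       ∎)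

module Binomial {a ℓ₁ ℓ₂ Q} (F : FiniteField a ℓ₁ ℓ₂ Q) where
  private module F = FieldProperties F
  open PolynomialRing F
  open PolynomialDivision F
  open Evaluation F

  x^_-x : ℕ → Poly
  x^ n -x = (x+ F.0#) ^ n - (x+ F.0#)

  x^-x-hasDeg : ∀ {n} → 1 ℕ.< n → HasDeg (x^ n -x) n
  x^-x-hasDeg {n} 1<n = record
    { lead  = λ eq → lead (x+^-hasDeg F.0# n) (F.trans (F.sym (difference ℕₚ.≤-refl)) eq)
    ; below = λ i n<i → F.trans (difference (ℕₚ.<⇒≤ n<i)) (below (x+^-hasDeg F.0# n) i n<i) }
    where
    difference : ∀ {i} → n ℕ.≤ i → coeff (x^ n -x) i F.≈ coeff ((x+ F.0#) ^ n) i
    difference {i} n≤i = F.trans (coeff-- ((x+ F.0#) ^ n) (x+ F.0#) i) (F.trans (F.+-congˡ (F.trans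
      (F.-‿cong (below (x+-hasDeg F.0#) i (ℕₚ.<-≤-trans 1<n n≤i))) F.-0#≈0#)) (F.+-identityʳ _))

  eval-x^-x : ∀ n y → eval (x^ n -x) y F.≈ y F.^ n F.- y
  eval-x^-x n y = F.trans (eval-- ((x+ F.0#) ^ n) (x+ F.0#) y) (F.+-cong
    (F.trans (eval-^ (x+ F.0#) n y) (F.^-congˡ n (value y))) (F.-‿cong (value y)))
    where
    value : ∀ y → eval (x+ F.0#) y F.≈ y
    value y = F.trans (eval-x+ F.0# y) (F.+-identityʳ y)

  -- Otherwise x^n - x, a nonzero polynomial of degree `n` since 1 < n, would have `Q` roots with n
  -- < Q.
  ¬all-fixed : ∀ {n} → 1 ℕ.< n → n ℕ.< Q → ¬ (∀ y → y F.^ n F.≈ y)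
  ¬all-fixed {n} 1<n n<Q fixed = hasDeg≉0 (x^-x-hasDeg 1<n) (vanishing⇒0 (x^ n -x)
    (λ i Q≤i → below (x^-x-hasDeg 1<n) i (ℕₚ.<-≤-trans n<Q Q≤i))
    (λ y → F.trans (eval-x^-x n y) (F.x≈y⇒x-y≈0 (fixed y))))

  1<Q : 1 ℕ.< Q
  1<Q = distinct⇒1< (λ eq → F.1≉0 (F.trans (F.sym (F.strictlyInverseʳ F.1#))
    (F.trans (F.from-cong eq) (F.strictlyInverseʳ F.0#)))) 
    where
    distinct⇒1< : ∀ {n} {i k : Fin n} → ¬ i ≡ k → 1 ℕ.< n
    distinct⇒1< {suc zero} {Fin.zero} {Fin.zero} i≢k = ⊥-elim (i≢k ≡.refl)
    distinct⇒1< {suc (suc n)} i≢k = s≤s (s≤s z≤n)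

module Period {a ℓ₁ ℓ₂ b ℓ₃ ℓ₄ Q S} (F : FiniteField a ℓ₁ ℓ₂ Q) (M : FiniteField b ℓ₃ ℓ₄ S)
  (j : FiniteField.Carrier F → FiniteField.Carrier M)
  (j-homomorphism : RingMorphisms.IsRingHomomorphism (FiniteField.rawRing F) (FiniteField.rawRing M) j) where
  private
    module F = FieldProperties F
    module M = FieldProperties M
  open PolynomialRing F
  open PolynomialDivision F
  open Binomial F
  open Embedding F M j j-homomorphism
  open Roots F M j j-homomorphism

  ev-x^-x : ∀ n y → ev (x^ n -x) y M.≈ y M.^ n M.- y
  ev-x^-x n y = M.trans (ev-- ((x+ F.0#) ^ n) (x+ F.0#) y) (M.+-cong
    (M.trans (ev-^ (x+ F.0#) n y) (M.^-congˡ n (value y))) (M.-‿cong (value y)))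
    where
    value : ∀ y → ev (x+ F.0#) y M.≈ y
    value y = M.trans (ev-x+ F.0# y) (M.trans (M.+-congˡ 0#-homo) (M.+-identityʳ y))

  fixed⇒root : ∀ {n y} → y M.^ n M.≈ y → ev (x^ n -x) y M.≈ M.0#
  fixed⇒root {n} {y} fixed = M.trans (ev-x^-x n y) (M.x≈y⇒x-y≈0 fixed)

  root⇒fixed : ∀ {n y} → ev (x^ n -x) y M.≈ M.0# → y M.^ n M.≈ y
  root⇒fixed {n} {y} eq = M.x-y≈0⇒x≈y _ _ (M.trans (M.sym (ev-x^-x n y)) eq)

  fixed-+ : ∀ {y} v w → y M.^ (Q ℕ.^ v) M.≈ y → y M.^ (Q ℕ.^ (w ℕ.+ v)) M.≈ y M.^ (Q ℕ.^ w)
  fixed-+ {y} v w fixed = begin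
    y M.^ (Q ℕ.^ (w ℕ.+ v))          ≈⟨ M.^-congʳ y (≡.trans (ℕₚ.^-distribˡ-+-* Q w v) (ℕₚ.*-comm (Q ℕ.^ w) _)) ⟩
    y M.^ (Q ℕ.^ v ℕ.* Q ℕ.^ w)      ≈⟨ M.^-assocʳ y (Q ℕ.^ v) (Q ℕ.^ w) ⟨
    (y M.^ (Q ℕ.^ v)) M.^ (Q ℕ.^ w)  ≈⟨ M.^-congˡ (Q ℕ.^ w) fixed ⟩
    y M.^ (Q ℕ.^ w)                  ∎
    where open import Relation.Binary.Reasoning.Setoid M.setoid using (begin_; step-≈-⟩; step-≈-⟨; _∎)

  fixed-multiple : ∀ {y} v w → y M.^ (Q ℕ.^ v) M.≈ y → y M.^ (Q ℕ.^ (w ℕ.* v)) M.≈ y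
  fixed-multiple {y} v zero    fixed = M.*-identityʳ y
  fixed-multiple {y} v (suc w) fixed = M.trans (M.^-congʳ y (≡.cong (Q ℕ.^_) (ℕₚ.+-comm v (w ℕ.* v))))
    (M.trans (fixed-+ v (w ℕ.* v) fixed) (fixed-multiple v w fixed))

module GeneratorPeriod {a ℓ₁ ℓ₂ Q} (F : FiniteField a ℓ₁ ℓ₂ Q) {s : Polynomial.Poly F} {e : ℕ}
  (X : RootExtension F s e) where
  open RootExtension X
  open FieldProperties field′
  open Binomial F
  open Embedding F field′ j homomorphism
  open Roots F field′ j homomorphism
  open Period F field′ j homomorphism
  open import Relation.Binary.Reasoning.Setoid setoid using (begin_; step-≈-⟩; step-≈-⟨; _∎)

  divides-binomial : Polynomial.Irreducible F s → PolynomialDivision.HasDeg F s e →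
    PolynomialDivision.Divides F s (x^ (Q ℕ.^ e) -x)
  divides-binomial irr hs = root⇒divides irr hs root _ (fixed⇒root {Q ℕ.^ e} (fermat β))

  -- If `s` divided it, β would be fixed by the Q^v-th power map, and with β all polynomial
  -- expressions in β, that is, the whole field of Q^e elements. This is too many fixed points for 1
  -- < Q^v < Q^e.
  ¬divides-binomial : ∀ v → 0 ℕ.< v → v ℕ.< e → ¬ PolynomialDivision.Divides F s (x^ (Q ℕ.^ v) -x)
  ¬divides-binomial v 0<v v<e s∣x^-x = Binomial.¬all-fixed field′
    (ℕₚ.<-≤-trans 1<Q (≡.subst (ℕ._≤ Q ℕ.^ v) (ℕₚ.^-identityʳ Q) (ℕₚ.^-monoʳ-≤ Q {{ℕ.>-nonZero (ℕₚ.<⇒≤ 1<Q)}} 0<v)))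
    (ℕₚ.^-monoʳ-< Q 1<Q v<e) all-fixed
    where
    all-fixed : ∀ y → y ^ (Q ℕ.^ v) ≈ y
    all-fixed y = let p , eq = generated y in begin
      y ^ (Q ℕ.^ v)             ≈⟨ ^-congˡ (Q ℕ.^ v) eq ⟨
      ev p β ^ (Q ℕ.^ v)        ≈⟨ ev-frobenius v p β ⟨
      ev p (β ^ (Q ℕ.^ v))      ≈⟨ ev-congʳ p (root⇒fixed {Q ℕ.^ v} (ev-multiple {s} {x^ (Q ℕ.^ v) -x} s∣x^-x root)) ⟩
      ev p β                    ≈⟨ eq ⟩
      y                         ∎

module MinimalPeriod {a ℓ₁ ℓ₂ b ℓ₃ ℓ₄ Q S} (F : FiniteField a ℓ₁ ℓ₂ Q) (M : FiniteField b ℓ₃ ℓ₄ S)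
  (j : FiniteField.Carrier F → FiniteField.Carrier M)
  (j-homomorphism : RingMorphisms.IsRingHomomorphism (FiniteField.rawRing F) (FiniteField.rawRing M) j) where
  private module M = FieldProperties M
  open Polynomial F using (Irreducible)
  open PolynomialDivision F using (HasDeg)
  open Binomial F
  open Embedding F M j j-homomorphism
  open Roots F M j j-homomorphism
  open Period F M j j-homomorphism
  open import Relation.Binary.Reasoning.Setoid M.setoid using (begin_; step-≈-⟩; step-≈-⟨; _∎)

  -- Fermat's theorem in F[x]/(s) makes `s` a divisor of X^(Q^e) - X; evaluating this divisibility
  -- at β carries the fact over to the arbitrary field `M`.
  fixed : ∀ {s e β} → Irreducible s → HasDeg s e → ev s β M.≈ M.0# → β M.^ (Q ℕ.^ e) M.≈ β
  fixed {s} {e} irr hs root = root⇒fixed {Q ℕ.^ e} (ev-multiple {s} {x^ (Q ℕ.^ e) -x}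
    (GeneratorPeriod.divides-binomial F (adjoinRoot F irr hs) irr hs) root)

  ¬short-period : ∀ {s e β} → Irreducible s → HasDeg s e → ev s β M.≈ M.0# →
    ∀ v → 0 ℕ.< v → v ℕ.< e → ¬ β M.^ (Q ℕ.^ v) M.≈ β
  ¬short-period irr hs root v 0<v v<e βᵛ≈β = GeneratorPeriod.¬divides-binomial F (adjoinRoot F irr hs) v 0<v v<e
    (root⇒divides irr hs root _ (fixed⇒root {Q ℕ.^ v} βᵛ≈β))

  period : ∀ {s e β} → Irreducible s → HasDeg s e → ev s β M.≈ M.0# → .{{_ : ℕ.NonZero e}} →
    ∀ v → β M.^ (Q ℕ.^ v) M.≈ β → e ℕ∣.∣ v
  period {s} {e} {β} irr hs root v βᵛ≈β with v % e in v%e≡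
  ... | zero  = ℕ∣.m%n≡0⇒n∣m v e v%e≡
  ... | suc r = ⊥-elim (¬short-period irr hs root (v % e) (≡.subst (0 ℕ.<_) (≡.sym v%e≡) (s≤s z≤n)) (m%n<n v e) (begin
    β M.^ (Q ℕ.^ (v % e))                       ≈⟨ fixed-+ (v / e ℕ.* e) (v % e) (fixed-multiple e (v / e) (fixed irr hs root)) ⟨
    β M.^ (Q ℕ.^ (v % e ℕ.+ v / e ℕ.* e))       ≈⟨ M.^-congʳ β (≡.cong (Q ℕ.^_) (≡.sym (m≡m%n+[m/n]*n v e))) ⟩
    β M.^ (Q ℕ.^ v)                             ≈⟨ βᵛ≈β ⟩
    β                                           ∎))

-- A proper factor x of `p` would have an irreducible divisor s of degree less than that of `p`, and
-- the root adjoined for s is a root of `p` in an extension of too small a degree.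
irreducible-by-roots : ∀ {a ℓ₁ ℓ₂ Q} (F : FiniteField a ℓ₁ ℓ₂ Q) {p n} → PolynomialDivision.HasDeg F p (suc n) →
  (∀ {s e} (X : RootExtension F s (suc e)) → let open RootExtension X in
    FieldProperties._≈_ field′ (Embedding.ev F field′ j homomorphism p β) (FieldProperties.0# field′) → n ℕ.≤ e) →
  Polynomial.Irreducible F p
irreducible-by-roots F {p} {n} hp large-roots = irreducible-intro hp ¬split
  where
  open PolynomialRing F
  open PolynomialDivision F

  ¬split : ∀ {x y m k} → p ≋ x * y → HasDeg x (suc m) → HasDeg y (suc k) → m ℕ.+ suc k ≡ n → ⊥
  ¬split {x} {y} {m} {k} p≋xy hx hy degrees = irreducible-factor (λ s → Divides s x) splits
    ((FieldProperties.1# F ∷ []) , P.sym (P.*-identityˡ x)) hx absurd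
    where
    splits : ∀ {s u v} → Divides s x → s ≋ u * v → Divides u x ⊎ Divides v x
    splits {s} {u} {v} (w , x≋ws) s≋uv =
      -- Both factors of a divisor of `x` divide `x`, so the choice of the right one is arbitrary.
      inj₂ (w * u , P.trans x≋ws (P.trans (P.*-congˡ {w} s≋uv) (P.sym (P.*-assoc w u v))))

    absurd : ¬ (∃ λ s → ∃ λ e → Irreducible s × HasDeg s (suc e) × Divides s x × e ℕ.≤ m)
    absurd (s , e , s-irr , hs , s∣x , e≤m) = ℕₚ.<⇒≱
      (ℕₚ.≤-<-trans e≤m (≡.subst (m ℕ.<_) degrees (ℕₚ.m<m+n m (s≤s z≤n)))) (large-roots X-extension root)
      where
      X-extension : RootExtension F s (suc e)
      X-extension = adjoinRoot F s-irr hs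
      module X = RootExtension X-extension
      module E = FieldProperties X.field′
      open Embedding F X.field′ X.j X.homomorphism

      root : ev p X.β E.≈ E.0#
      root = E.trans (ev-cong {p} {x * y} p≋xy) (E.trans (ev-* x y X.β)
        (E.trans (E.*-congʳ (Roots.ev-multiple F X.field′ X.j X.homomorphism {s} {x} s∣x X.root)) (E.zeroˡ (ev y X.β))))

-- Primes, and divisibility of (N^e - 1)/(N - 1).

prime-divisor : ∀ {n} → 1 ℕ.< n → ∃ λ p → Prime p × p ∣ℕ n
prime-divisor {suc n} 1<n with factorise (suc n)
... | record { factors = []    ; isFactorisation = n≡1 } = ⊥-elim (ℕₚ.<-irrefl (≡.sym n≡1) 1<n)
... | record { factors = p ∷ ps ; isFactorisation = n≡ ; factorsPrime = p-prime ∷ _ } =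
  p , p-prime , ≡.subst (p ∣ℕ_) (≡.sym n≡) (ℕ∣.m∣m*n (product ps))

no-common-prime⇒coprime : ∀ {m n} → n ≢ 0 → (∀ p → Prime p → p ∣ℕ m → p ∣ℕ n → ⊥) → Coprime m n
no-common-prime⇒coprime n≢0 none {zero} (_ , 0∣n) = ⊥-elim (n≢0 (ℕ∣.0∣⇒≡0 0∣n))
no-common-prime⇒coprime n≢0 none {suc zero} _ = ≡.refl
no-common-prime⇒coprime n≢0 none {suc (suc d)} (d∣m , d∣n) =
  let p , p-prime , p∣d = prime-divisor {suc (suc d)} (s≤s (s≤s z≤n))
  in ⊥-elim (none p p-prime (ℕ∣.∣-trans p∣d d∣m) (ℕ∣.∣-trans p∣d d∣n))

prime∤1 : ∀ {p} → Prime p → ¬ p ∣ℕ 1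
prime∤1 p-prime p∣1 = ¬prime[1] (≡.subst Prime (ℕ∣.∣1⇒≡1 p∣1) p-prime)

parity : ∀ n → (∃ λ m → n ≡ m ℕ.* 2) ⊎ (∃ λ m → n ≡ suc (m ℕ.* 2))
parity zero = inj₁ (0 , ≡.refl)
parity (suc n) with parity n
... | inj₁ (m , n≡) = inj₂ (m , ≡.cong suc n≡)
... | inj₂ (m , n≡) = inj₁ (suc m , ≡.cong suc n≡)

-- The sum 1 + N + ... + N^(k-1), which is (N^k - 1)/(N - 1) without subtraction or division.
repunit : ℕ → ℕ → ℕ
repunit N zero    = 0
repunit N (suc k) = 1 ℕ.+ N ℕ.* repunit N k

repunit-pow : ∀ n k → suc n ℕ.^ k ≡ suc (n ℕ.* repunit (suc n) k)
repunit-pow n zero    = ≡.cong suc (≡.sym (ℕₚ.*-zeroʳ n))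
repunit-pow n (suc k) = ≡.trans (≡.cong (suc n ℕ.*_) (repunit-pow n k)) (expand n (repunit (suc n) k))
  where
  expand : ∀ n R → suc n ℕ.* suc (n ℕ.* R) ≡ suc (n ℕ.* (1 ℕ.+ suc n ℕ.* R))
  expand = solve-∀

repunit-+ : ∀ N k l → repunit N (k ℕ.+ l) ≡ repunit N k ℕ.+ N ℕ.^ k ℕ.* repunit N l
repunit-+ N zero    l = ≡.sym (ℕₚ.+-identityʳ _)
repunit-+ N (suc k) l = ≡.trans (≡.cong (λ R → 1 ℕ.+ N ℕ.* R) (repunit-+ N k l)) (expand N (repunit N k) (N ℕ.^ k) (repunit N l))
  where
  expand : ∀ N R P S → 1 ℕ.+ N ℕ.* (R ℕ.+ P ℕ.* S) ≡ (1 ℕ.+ N ℕ.* R) ℕ.+ (N ℕ.* P) ℕ.* S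
  expand = solve-∀

repunit-* : ∀ N k l → repunit N (l ℕ.* k) ≡ repunit N k ℕ.* repunit (N ℕ.^ k) l
repunit-* N k zero    = ≡.sym (ℕₚ.*-zeroʳ (repunit N k))
repunit-* N k (suc l) = ≡.trans (repunit-+ N k (l ℕ.* k))
  (≡.trans (≡.cong (λ R → repunit N k ℕ.+ N ℕ.^ k ℕ.* R) (repunit-* N k l))
    (expand (repunit N k) (N ℕ.^ k) (repunit (N ℕ.^ k) l)))
  where
  expand : ∀ R P S → R ℕ.+ P ℕ.* (R ℕ.* S) ≡ R ℕ.* (1 ℕ.+ P ℕ.* S)
  expand = solve-∀

-- The binomial coefficient k over 2, the second one in the expansion of (1 + n)^k.
triangular : ℕ → ℕ
triangular zero    = 0
triangular (suc k) = triangular k ℕ.+ k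

triangular-odd : ∀ m → triangular (suc (m ℕ.* 2)) ≡ suc (m ℕ.* 2) ℕ.* m
triangular-odd zero    = ≡.refl
triangular-odd (suc m) = ≡.trans
  (≡.cong (λ T → T ℕ.+ suc (m ℕ.* 2) ℕ.+ suc (suc (m ℕ.* 2))) (triangular-odd m)) (expand m)
  where
  expand : ∀ m → suc (m ℕ.* 2) ℕ.* m ℕ.+ suc (m ℕ.* 2) ℕ.+ suc (suc (m ℕ.* 2)) ≡ suc (suc (suc (m ℕ.* 2))) ℕ.* suc m
  expand = solve-∀

-- The binomial expansion of ((1 + n)^k - 1)/n with all terms from n² on collected in `X`.
repunit-expansion : ∀ n k → ∃ λ X → repunit (suc n) k ≡ k ℕ.+ n ℕ.* (triangular k ℕ.+ n ℕ.* X)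
repunit-expansion n zero    = 0 , ≡.sym (≡.trans (≡.cong (n ℕ.*_) (ℕₚ.*-zeroʳ n)) (ℕₚ.*-zeroʳ n))
repunit-expansion n (suc k) with repunit-expansion n k
... | X , eq = X ℕ.+ triangular k ℕ.+ n ℕ.* X ,
  ≡.trans (≡.cong (λ R → 1 ℕ.+ suc n ℕ.* R) eq) (expand n k (triangular k) X)
  where
  expand : ∀ n k T X → 1 ℕ.+ suc n ℕ.* (k ℕ.+ n ℕ.* (T ℕ.+ n ℕ.* X)) ≡
    suc k ℕ.+ n ℕ.* ((T ℕ.+ k) ℕ.+ n ℕ.* (X ℕ.+ T ℕ.+ n ℕ.* X))
  expand = solve-∀

-- For odd ℓ the coefficient ℓ over 2 is a multiple of ℓ, and so is n; the expansion becomes ℓ times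
-- a number that is 1 modulo n. At ℓ = 2 the value is 2 + n, whose half is odd once 4 divides n.
repunit-prime : ∀ n {ℓ} → Prime ℓ → ℓ ∣ℕ n → (2 ∣ℕ ℓ → 4 ∣ℕ n) →
  ∃ λ u → repunit (suc n) ℓ ≡ ℓ ℕ.* u × (∀ p → Prime p → p ∣ℕ n → ¬ p ∣ℕ u)
repunit-prime n {ℓ} ℓ-prime ℓ∣n 4∣n with parity ℓ
repunit-prime n {ℓ} ℓ-prime (divides-refl n′) _ | inj₂ (m , ≡.refl) with repunit-expansion n ℓ
... | X , eq = 1 ℕ.+ n ℕ.* (m ℕ.+ n′ ℕ.* X)
  , ≡.trans eq (≡.trans (≡.cong (λ T → ℓ ℕ.+ n ℕ.* (T ℕ.+ n ℕ.* X)) (triangular-odd m)) (expand n′ ℓ m X))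
  , λ p p-prime p∣n p∣u → prime∤1 p-prime (ℕ∣.∣m+n∣m⇒∣n (≡.subst (p ∣ℕ_) (ℕₚ.+-comm 1 _) p∣u) (ℕ∣.∣m⇒∣m*n _ p∣n))
  where
  expand : ∀ n′ ℓ m X → ℓ ℕ.+ (n′ ℕ.* ℓ) ℕ.* (ℓ ℕ.* m ℕ.+ (n′ ℕ.* ℓ) ℕ.* X) ≡
    ℓ ℕ.* (1 ℕ.+ (n′ ℕ.* ℓ) ℕ.* (m ℕ.+ n′ ℕ.* X))
  expand = solve-∀
repunit-prime n {ℓ} ℓ-prime ℓ∣n 4∣n | inj₁ (m , ℓ≡2m) with 4∣n 2∣ℓ | prime⇒irreducible ℓ-prime 2∣ℓ
  where
  2∣ℓ : 2 ∣ℕ ℓ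
  2∣ℓ = divides m ℓ≡2m
-- With n = 4w the value is 2 + 4w = 2 (1 + 2w), and every prime divisor of 4w divides 2w.
... | divides-refl w | inj₂ ≡.refl = 1 ℕ.+ w ℕ.* 2 , expand w , coprime
  where
  expand : ∀ w → 1 ℕ.+ suc (w ℕ.* 4) ℕ.* (1 ℕ.+ suc (w ℕ.* 4) ℕ.* 0) ≡ 2 ℕ.* (1 ℕ.+ w ℕ.* 2)
  expand = solve-∀

  split : ∀ w → w ℕ.* 4 ≡ (w ℕ.* 2) ℕ.* 2
  split = solve-∀

  coprime : ∀ p → Prime p → p ∣ℕ w ℕ.* 4 → ¬ p ∣ℕ 1 ℕ.+ w ℕ.* 2
  coprime p p-prime p∣n p∣u = prime∤1 p-prime (ℕ∣.∣m+n∣m⇒∣n (≡.subst (p ∣ℕ_) (ℕₚ.+-comm 1 _) p∣u) p∣2w)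
    where
    p∣2w : p ∣ℕ w ℕ.* 2
    p∣2w with euclidsLemma (w ℕ.* 2) 2 p-prime (≡.subst (p ∣ℕ_) (split w) p∣n)
    ... | inj₁ p∣2w = p∣2w
    ... | inj₂ p∣2  = ℕ∣.∣n⇒∣m*n w p∣2

-- Lifting the exponent: dividing out one prime factor of t at a time replaces n + 1 by its ℓ-th power.
repunit-divisible : ∀ t n e → t ≢ 0 → (∀ p → Prime p → p ∣ℕ t → p ∣ℕ n) → (2 ∣ℕ t → 4 ∣ℕ n) →
  t ∣ℕ repunit (suc n) e → t ∣ℕ e
repunit-divisible t = go (suc t) t (ℕₚ.n<1+n t)
  where
  go : ∀ fuel t → t ℕ.< fuel → ∀ n e → t ≢ 0 → (∀ p → Prime p → p ∣ℕ t → p ∣ℕ n) → (2 ∣ℕ t → 4 ∣ℕ n) →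
    t ∣ℕ repunit (suc n) e → t ∣ℕ e
  go (suc fuel) zero t< n e t≢0 primes four t∣R = ⊥-elim (t≢0 ≡.refl)
  go (suc fuel) (suc zero) t< n e t≢0 primes four t∣R = ℕ∣.1∣ e
  go (suc fuel) t@(suc (suc _)) t< n e t≢0 primes four t∣R
    with prime-divisor {t} (s≤s (s≤s z≤n)) | repunit-expansion n e
  ... | ℓ , ℓ-prime , ℓ∣t@(divides t′ t≡) | X , expansion =
    ≡.subst₂ _∣ℕ_ (≡.sym t≡) (≡.sym e≡) (ℕ∣.*-monoˡ-∣ ℓ
      (go fuel t′ (ℕₚ.<-≤-trans t′<t (ℕₚ.≤-pred t<)) n⁺ e′ t′≢0
        (λ p p-prime p∣t′ → ℕ∣.∣m⇒∣m*n _ (primes p p-prime (ℕ∣.∣-trans p∣t′ t′∣t)))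
        (λ 2∣t′ → ℕ∣.∣m⇒∣m*n _ (four (ℕ∣.∣-trans 2∣t′ t′∣t)))
        t′∣R′))
    where
    t′∣t : t′ ∣ℕ t
    t′∣t = divides ℓ (≡.trans t≡ (ℕₚ.*-comm t′ ℓ))

    t′≢0 : t′ ≢ 0
    t′≢0 t′≡0 = t≢0 (≡.trans t≡ (≡.cong (ℕ._* ℓ) t′≡0))

    instance
      ℓ≢0 : ℕ.NonZero ℓ
      ℓ≢0 = prime⇒nonZero ℓ-prime

      ℓ>1 : ℕ.NonTrivial ℓ
      ℓ>1 = prime⇒nonTrivial ℓ-prime

    t′<t : t′ ℕ.< t
    t′<t = ≡.subst (t′ ℕ.<_) (≡.sym t≡) (ℕₚ.m<m*n t′ ℓ {{ℕ.≢-nonZero t′≢0}} (ℕ.nonTrivial⇒n>1 ℓ))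

    ℓ∣n : ℓ ∣ℕ n
    ℓ∣n = primes ℓ ℓ-prime ℓ∣t

    -- Modulo n, hence modulo ℓ, the repunit is congruent to e.
    ℓ∣e : ℓ ∣ℕ e
    ℓ∣e = ℕ∣.∣m+n∣m⇒∣n
      (≡.subst (ℓ ∣ℕ_) (≡.trans expansion (ℕₚ.+-comm e _)) (ℕ∣.∣-trans ℓ∣t t∣R)) (ℕ∣.∣m⇒∣m*n _ ℓ∣n)

    e′ : ℕ
    e′ = ℕ∣.quotient ℓ∣e

    e≡ : e ≡ e′ ℕ.* ℓ
    e≡ = ℕ∣._∣_.equality ℓ∣e

    n⁺ : ℕ
    n⁺ = n ℕ.* repunit (suc n) ℓ

    unit = repunit-prime n ℓ-prime ℓ∣n (λ 2∣ℓ → four (ℕ∣.∣-trans 2∣ℓ ℓ∣t))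
    u = proj₁ unit

    -- Splitting e = e′ ℓ factors the repunit into one of length ℓ to the base N, which is ℓ u, and
    -- one of length e′ to the base N^ℓ.
    R≡ : repunit (suc n) e ≡ ℓ ℕ.* (u ℕ.* repunit (suc n⁺) e′)
    R≡ = ≡.trans (≡.cong (repunit (suc n)) e≡) (≡.trans (repunit-* (suc n) ℓ e′)
      (≡.trans (≡.cong₂ ℕ._*_ (proj₁ (proj₂ unit)) (≡.cong (λ N → repunit N e′) (repunit-pow n ℓ)))
        (ℕₚ.*-assoc ℓ u _)))

    t′∣uR′ : t′ ∣ℕ u ℕ.* repunit (suc n⁺) e′
    t′∣uR′ = ℕ∣.*-cancelˡ-∣ ℓ (≡.subst₂ _∣ℕ_ (≡.trans t≡ (ℕₚ.*-comm t′ ℓ)) R≡ t∣R)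

    t′∣R′ : t′ ∣ℕ repunit (suc n⁺) e′
    t′∣R′ = coprime-divisor (Coprimality.sym (no-common-prime⇒coprime t′≢0 (λ p p-prime p∣u p∣t′ →
      proj₂ (proj₂ unit) p p-prime (primes p p-prime (ℕ∣.∣-trans p∣t′ t′∣t)) p∣u))) t′∣uR′

-- Multiplicative orders and power residues.

module Order {a ℓ₁ ℓ₂ Q} (F : FiniteField a ℓ₁ ℓ₂ Q) where
  open FieldProperties F
  open import Relation.Binary.Reasoning.Setoid setoid

  ^-multiple : ∀ {ζ} m k → ζ ^ m ≈ 1# → ζ ^ (k ℕ.* m) ≈ 1#
  ^-multiple {ζ} m k eq = trans (^-congʳ ζ (ℕₚ.*-comm k m))
    (trans (sym (^-assocʳ ζ m k)) (trans (^-congˡ k eq) (1^ k)))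

  ^-gcd : ∀ {ζ m k d} → Bézout.Identity d m k → ζ ^ m ≈ 1# → ζ ^ k ≈ 1# → ζ ^ d ≈ 1#
  ^-gcd {ζ} {m} {k} {d} (Bézout.+- x y eq) ζᵐ≈1 ζᵏ≈1 = begin
    ζ ^ d                      ≈⟨ *-identityʳ _ ⟨
    ζ ^ d * 1#                 ≈⟨ *-congˡ (^-multiple k y ζᵏ≈1) ⟨
    ζ ^ d * ζ ^ (y ℕ.* k)      ≈⟨ ^-homo-* ζ d (y ℕ.* k) ⟨
    ζ ^ (d ℕ.+ y ℕ.* k)        ≈⟨ ^-congʳ ζ eq ⟩
    ζ ^ (x ℕ.* m)              ≈⟨ ^-multiple m x ζᵐ≈1 ⟩
    1#                         ∎
  ^-gcd (Bézout.-+ x y eq) ζᵐ≈1 ζᵏ≈1 = ^-gcd (Bézout.+- y x eq) ζᵏ≈1 ζᵐ≈1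

  -- By Bézout ζ also has g-th power 1 for g = gcd(t, i). If t/g had a prime divisor p, then g would
  -- divide t/p and ζ^(t/p) would be 1.
  order-divides : ∀ {ζ t} → t ≢ 0 → ζ ^ t ≈ 1# →
    (∀ p k → Prime p → t ≡ p ℕ.* k → ¬ ζ ^ k ≈ 1#) → ∀ i → ζ ^ i ≈ 1# → t ∣ℕ i
  order-divides {ζ} {t} t≢0 ζᵗ≈1 minimal i ζⁱ≈1 with gcd[m,n]∣m t i
  ... | divides w t≡ = case w t≡
    where
    g = gcd t i

    ζᵍ≈1 : ζ ^ g ≈ 1#
    ζᵍ≈1 = ^-gcd (Bézout.identity (gcd-GCD t i)) ζᵗ≈1 ζⁱ≈1

    regroup : ∀ k p g → k ℕ.* p ℕ.* g ≡ p ℕ.* (k ℕ.* g)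
    regroup = solve-∀

    case : ∀ w → t ≡ w ℕ.* g → t ∣ℕ i
    case zero          t≡ = ⊥-elim (t≢0 t≡)
    case (suc zero)    t≡ = ≡.subst (_∣ℕ i) (≡.sym (≡.trans t≡ (ℕₚ.+-identityʳ g))) (gcd[m,n]∣n t i)
    case (suc (suc w)) t≡ with prime-divisor {suc (suc w)} (s≤s (s≤s z≤n))
    ... | p , p-prime , divides k w≡ = ⊥-elim (minimal p (k ℕ.* g) p-prime
      (≡.trans t≡ (≡.trans (≡.cong (ℕ._* g) w≡) (regroup k p g))) (^-multiple g k ζᵍ≈1))

module PowerResidue {a ℓ₁ ℓ₂ Q} (F : FiniteField a ℓ₁ ℓ₂ Q) where
  private module F = FieldProperties F
  open PolynomialRing F
  open PolynomialDivision F
  open Evaluation F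
  open Binomial F
  open import Relation.Binary.Reasoning.Setoid F.setoid using (begin_; step-≈-⟩; step-≈-⟨; _∎)

  -- The quotient of X^(ℓk) - ρ^k by X^ℓ - ρ.
  geometric : F.Carrier → ℕ → ℕ → Poly
  geometric ρ ℓ zero    = []
  geometric ρ ℓ (suc k) = (x+ F.0#) ^ (k ℕ.* ℓ) + ρ · geometric ρ ℓ k

  module _ (ρ : F.Carrier) {ℓ : ℕ} (0<ℓ : 0 ℕ.< ℓ) where

    geometric-below : ∀ k → Below (geometric ρ ℓ k) (k ℕ.* ℓ)
    geometric-coeff : ∀ k i → k ℕ.* ℓ ℕ.≤ i →
      coeff (geometric ρ ℓ (suc k)) i F.≈ coeff ((x+ F.0#) ^ (k ℕ.* ℓ)) i

    geometric-below zero    i _ = F.refl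
    geometric-below (suc k) i ℓ+kℓ≤i = F.trans (geometric-coeff k i (ℕₚ.<⇒≤ kℓ<i))
      (below (x+^-hasDeg F.0# (k ℕ.* ℓ)) i kℓ<i)
      where
      kℓ<i : k ℕ.* ℓ ℕ.< i
      kℓ<i = ℕₚ.<-≤-trans (ℕₚ.m<n+m (k ℕ.* ℓ) 0<ℓ) ℓ+kℓ≤i

    geometric-coeff k i kℓ≤i = F.trans (coeff-+ ((x+ F.0#) ^ (k ℕ.* ℓ)) _ i) (F.trans (F.+-congˡ
      (F.trans (coeff-· ρ (geometric ρ ℓ k) i) (F.trans (F.*-congˡ (geometric-below k i kℓ≤i)) (F.zeroʳ ρ))))
      (F.+-identityʳ _))

    geometric-hasDeg : ∀ k → HasDeg (geometric ρ ℓ (suc k)) (k ℕ.* ℓ)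
    geometric-hasDeg k = record
      { lead  = λ eq → lead (x+^-hasDeg F.0# (k ℕ.* ℓ)) (F.trans (F.sym (geometric-coeff k _ ℕₚ.≤-refl)) eq)
      ; below = λ i kℓ<i → F.trans (geometric-coeff k i (ℕₚ.<⇒≤ kℓ<i)) (below (x+^-hasDeg F.0# (k ℕ.* ℓ)) i kℓ<i) }

    eval-geometric : ∀ k y → (y F.^ ℓ F.- ρ) F.* eval (geometric ρ ℓ k) y F.≈ (y F.^ ℓ) F.^ k F.- ρ F.^ k
    eval-geometric zero    y = F.trans (F.zeroʳ _) (F.sym (F.-‿inverseʳ F.1#))
    eval-geometric (suc k) y = begin
      (w F.- ρ) F.* eval (geometric ρ ℓ (suc k)) y
        ≈⟨ F.*-congˡ (F.trans (eval-+ ((x+ F.0#) ^ (k ℕ.* ℓ)) _ y) (F.+-cong power (eval-· ρ (geometric ρ ℓ k) y))) ⟩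
      (w F.- ρ) F.* (w F.^ k F.+ ρ F.* G)
        ≈⟨ solve 4 (λ w ρ u G → (w :- ρ) :* (u :+ ρ :* G) := (w :- ρ) :* u :+ ρ :* ((w :- ρ) :* G)) F.refl w ρ (w F.^ k) G ⟩
      (w F.- ρ) F.* w F.^ k F.+ ρ F.* ((w F.- ρ) F.* G)
        ≈⟨ F.+-congˡ (F.*-congˡ (eval-geometric k y)) ⟩
      (w F.- ρ) F.* w F.^ k F.+ ρ F.* (w F.^ k F.- ρ F.^ k)
        ≈⟨ solve 4 (λ w ρ u v → (w :- ρ) :* u :+ ρ :* (u :- v) := w :* u :- ρ :* v) F.refl w ρ (w F.^ k) (ρ F.^ k) ⟩
      w F.^ suc k F.- ρ F.^ suc k ∎
      where
      open IntegerCoefficients F.commutativeRing using (solve; _:+_; _:*_; _:-_; _:=_)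
      w = y F.^ ℓ
      G = eval (geometric ρ ℓ k) y

      power : eval ((x+ F.0#) ^ (k ℕ.* ℓ)) y F.≈ w F.^ k
      power = begin
        eval ((x+ F.0#) ^ (k ℕ.* ℓ)) y  ≈⟨ eval-^ (x+ F.0#) (k ℕ.* ℓ) y ⟩
        eval (x+ F.0#) y F.^ (k ℕ.* ℓ)  ≈⟨ F.^-congˡ (k ℕ.* ℓ) (F.trans (eval-x+ F.0# y) (F.+-identityʳ y)) ⟩
        y F.^ (k ℕ.* ℓ)                 ≈⟨ F.^-congʳ y (ℕₚ.*-comm k ℓ) ⟩
        y F.^ (ℓ ℕ.* k)                 ≈⟨ F.^-assocʳ y ℓ k ⟨
        w F.^ k                         ∎

  -- If no y^ℓ equals ρ, then X times the quotient above vanishes on F, against its degree.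
  ρ^m≈1⇒power : ∀ {ρ ℓ m} → 0 ℕ.< ℓ → Q ≡ suc (ℓ ℕ.* m) → ρ F.^ m F.≈ F.1# → ¬ ¬ (ρ F.IsPower ℓ)
  -- Here Q would be 1, whereas a field has at least two elements.
  ρ^m≈1⇒power {ρ} {ℓ} {zero} 0<ℓ Q≡ _ _ = ℕₚ.<-irrefl (≡.sym (≡.trans Q≡ (≡.cong suc (ℕₚ.*-zeroʳ ℓ)))) 1<Q
  ρ^m≈1⇒power {ρ} {ℓ} {m@(suc k)} 0<ℓ Q≡ ρᵐ≈1 ¬power =
    hasDeg≉0 (geometric-hasDeg ρ 0<ℓ k) ⟪ (λ i → at shifted≋0 (suc i)) ⟫
    where
    G = geometric ρ ℓ m

    shifted-below : Below (F.0# ∷ G) Q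
    shifted-below zero Q≤0 with ≡.trans (≡.sym Q≡) (ℕₚ.n≤0⇒n≡0 Q≤0)
    ... | ()
    shifted-below (suc i) Q≤i = geometric-below ρ 0<ℓ m i
      (ℕₚ.≤-pred (≡.subst (ℕ._≤ suc i) (≡.trans Q≡ (≡.cong suc (ℕₚ.*-comm ℓ m))) Q≤i))

    -- At 0 the factor X vanishes. At y ≠ 0 one has (y^ℓ)^m = y^(Q-1) = 1 = ρ^m, so the product of
    -- y^ℓ - ρ and the quotient is 0, and the first factor is not.
    vanishes : ∀ y → eval (F.0# ∷ G) y F.≈ F.0#
    vanishes y = F.trans (F.+-identityˡ _) (zero-product (y F.≟ F.0#))
      where
      zero-product : Dec (y F.≈ F.0#) → y F.* eval G y F.≈ F.0#
      zero-product (yes y≈0) = F.trans (F.*-congʳ y≈0) (F.zeroˡ _)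
      zero-product (no y≉0) = F.trans (F.*-congˡ (F.x*y≈0⇒y≈0 (λ eq → ¬power (y , F.x-y≈0⇒x≈y _ _ eq)) (begin
        (y F.^ ℓ F.- ρ) F.* eval G y  ≈⟨ eval-geometric ρ 0<ℓ m y ⟩
        (y F.^ ℓ) F.^ m F.- ρ F.^ m   ≈⟨ F.x≈y⇒x-y≈0 (F.trans (F.trans (F.^-assocʳ y ℓ m) (F.fermat-unit y≉0 Q≡)) (F.sym ρᵐ≈1)) ⟩
        F.0#                          ∎))) (F.zeroʳ y)

    shifted≋0 : F.0# ∷ G ≋ []
    shifted≋0 = vanishing⇒0 (F.0# ∷ G) shifted-below vanishes

-- Conjugates and norms.

module Norm {a ℓ₁ ℓ₂ b ℓ₃ ℓ₄ Q S} (F : FiniteField a ℓ₁ ℓ₂ Q) (M : FiniteField b ℓ₃ ℓ₄ S)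
  (j : FiniteField.Carrier F → FiniteField.Carrier M)
  (j-homomorphism : RingMorphisms.IsRingHomomorphism (FiniteField.rawRing F) (FiniteField.rawRing M) j) where
  private
    module F = FieldProperties F
    module M = FieldProperties M
  open PolynomialRing F using (eval)
  open PolynomialDivision F using (lead)
  open Embedding F M j j-homomorphism
  open Period F M j j-homomorphism
  open MinimalPeriod F M j j-homomorphism
  private
    module M[x] where
      open PolynomialDivision M public
      open Evaluation M public
  open import Relation.Binary.Reasoning.Setoid M.setoid using (begin_; step-≈-⟩; step-≈-⟨; _∎)

  prod-powers : ∀ n z → M.prod {n} (λ i → z M.^ (Q ℕ.^ toℕ i)) M.≈ z M.^ repunit Q n
  prod-powers zero    z = M.refl
  prod-powers (suc n) z = M.*-cong (M.*-identityʳ z) (begin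
    M.prod {n} (λ i → z M.^ (Q ℕ.^ suc (toℕ i)))       ≈⟨ M.prod-cong {n} (λ i → frobenius-step z (toℕ i)) ⟩
    M.prod {n} (λ i → (z M.^ Q) M.^ (Q ℕ.^ toℕ i))     ≈⟨ prod-powers n (z M.^ Q) ⟩
    (z M.^ Q) M.^ repunit Q n                          ≈⟨ M.^-assocʳ z Q (repunit Q n) ⟩
    z M.^ (Q ℕ.* repunit Q n)                          ∎)

  module _ {r d} (irr : Polynomial.Irreducible F r) (hr : PolynomialDivision.HasDeg F r d) {β} (root : ev r β M.≈ M.0#) where

    conjugate : Fin d → M.Carrier
    conjugate i = β M.^ (Q ℕ.^ toℕ i)

    -- Raising an equality of two conjugates to the power Q^(d-i) turns the i-th into β and the k-th
    -- into β^(Q^(k-i)), a period shorter than the degree.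
    conjugates-differ : ∀ {i k} → i ℕ.< k → k ℕ.< d → ¬ β M.^ (Q ℕ.^ i) M.≈ β M.^ (Q ℕ.^ k)
    conjugates-differ {i} {k} i<k k<d eq = ¬short-period irr hr root (k ℕ.∸ i) (ℕₚ.m<n⇒0<n∸m i<k)
      (ℕₚ.≤-<-trans (ℕₚ.m∸n≤m k i) k<d) (begin
      β M.^ (Q ℕ.^ (k ℕ.∸ i))                         ≈⟨ fixed-+ d (k ℕ.∸ i) (fixed irr hr root) ⟨
      β M.^ (Q ℕ.^ (k ℕ.∸ i ℕ.+ d))                   ≈⟨ M.^-congʳ β (≡.cong (Q ℕ.^_) exponent) ⟩
      β M.^ (Q ℕ.^ (k ℕ.+ (d ℕ.∸ i)))                 ≈⟨ power-+ k (d ℕ.∸ i) ⟩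
      (β M.^ (Q ℕ.^ k)) M.^ (Q ℕ.^ (d ℕ.∸ i))         ≈⟨ M.^-congˡ (Q ℕ.^ (d ℕ.∸ i)) eq ⟨
      (β M.^ (Q ℕ.^ i)) M.^ (Q ℕ.^ (d ℕ.∸ i))         ≈⟨ power-+ i (d ℕ.∸ i) ⟨
      β M.^ (Q ℕ.^ (i ℕ.+ (d ℕ.∸ i)))                 ≈⟨ M.^-congʳ β (≡.cong (Q ℕ.^_) (ℕₚ.m+[n∸m]≡n i≤d)) ⟩
      β M.^ (Q ℕ.^ d)                                 ≈⟨ fixed irr hr root ⟩
      β                                               ∎)
      where
      i≤d : i ℕ.≤ d
      i≤d = ℕₚ.<⇒≤ (ℕₚ.<-trans i<k k<d)

      power-+ : ∀ v w → β M.^ (Q ℕ.^ (v ℕ.+ w)) M.≈ (β M.^ (Q ℕ.^ v)) M.^ (Q ℕ.^ w)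
      power-+ v w = M.trans (M.^-congʳ β (ℕₚ.^-distribˡ-+-* Q v w)) (M.sym (M.^-assocʳ β (Q ℕ.^ v) (Q ℕ.^ w)))

      exponent : k ℕ.∸ i ℕ.+ d ≡ k ℕ.+ (d ℕ.∸ i)
      exponent = ≡.trans (≡.sym (ℕₚ.+-∸-comm d (ℕₚ.<⇒≤ i<k))) (ℕₚ.+-∸-assoc k i≤d)

    conjugates-distinct : M[x].Distinct conjugate
    conjugates-distinct {i} {k} eq with ℕₚ.<-cmp (toℕ i) (toℕ k)
    ... | tri< i<k _ _ = ⊥-elim (conjugates-differ i<k (Finₚ.toℕ<n k) eq)
    ... | tri≈ _ i≡k _ = Finₚ.toℕ-injective i≡k
    ... | tri> _ _ k<i = ⊥-elim (conjugates-differ k<i (Finₚ.toℕ<n i) (M.sym eq))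

    -- Over `M` the polynomial r is its leading coefficient times the product of X minus the
    -- conjugates of β. Since `j y` is fixed by Frobenius, the factors at -y are negatives of
    -- conjugates of β + y. The constant κ, leading coefficient times (-1)^d, does not depend on y
    -- and so drops out of r(-θ^q)/r(-θ).
    norm : ∃ λ κ → κ M.≉ M.0# × (∀ y → j (eval r (F.- y)) M.≈ κ M.* (β M.+ j y) M.^ repunit Q d)
    norm = c M.* M.prod {d} (λ _ → M.- M.1#) ,
      M.x*y≉0 (M[x].lead hr′) (M.prod≉0 {d} _ (λ _ → M.-x≉0 M.1≉0)) , value
      where
      hr′ : M[x].HasDeg (map j r) d
      hr′ = map-hasDeg hr
      c = Polynomial.coeff M (map j r) d

      factor : ∀ y (i : Fin d) → j (F.- y) M.- conjugate i M.≈ (M.- M.1#) M.* (β M.+ j y) M.^ (Q ℕ.^ toℕ i)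
      factor y i = M.sym (begin
        (M.- M.1#) M.* (β M.+ j y) M.^ (Q ℕ.^ toℕ i)        ≈⟨ M.*-congˡ (M.trans (frobenius-+ (toℕ i) _ _) (M.+-congˡ (frobenius-j (toℕ i) y))) ⟩
        (M.- M.1#) M.* (conjugate i M.+ j y)                ≈⟨ solve 2 (λ u v → con -[1+ 0 ] :* (u :+ v) := (:- v) :- u) M.refl (conjugate i) (j y) ⟩
        (M.- j y) M.- conjugate i                           ≈⟨ M.+-congʳ (-‿homo y) ⟨
        j (F.- y) M.- conjugate i                           ∎)
        where open IntegerCoefficients M.commutativeRing using (solve; con; _:+_; _:*_; _:-_; :-_; _:=_)

      value : ∀ y → j (eval r (F.- y)) M.≈ (c M.* M.prod {d} (λ _ → M.- M.1#)) M.* (β M.+ j y) M.^ repunit Q d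
      value y = begin
        j (eval r (F.- y))                       ≈⟨ ev-j r (F.- y) ⟨
        ev r (j (F.- y))                         ≈⟨ M[x].eval-linear-factors d (map j r) conjugate conjugates-distinct (λ i → root-frobenius (toℕ i) r root) (M[x].below hr′) _ ⟩
        c M.* M.prod (λ i → j (F.- y) M.- conjugate i) ≈⟨ M.*-congˡ (M.trans (M.prod-cong (factor y)) (M.prod-* {d} (λ _ → M.- M.1#) _)) ⟩
        c M.* (M.prod {d} (λ _ → M.- M.1#) M.* M.prod {d} (λ i → (β M.+ j y) M.^ (Q ℕ.^ toℕ i))) ≈⟨ M.*-assoc _ _ _ ⟨
        (c M.* M.prod {d} (λ _ → M.- M.1#)) M.* M.prod {d} (λ i → (β M.+ j y) M.^ (Q ℕ.^ toℕ i)) ≈⟨ M.*-congˡ (prod-powers d (β M.+ j y)) ⟩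
        (c M.* M.prod {d} (λ _ → M.- M.1#)) M.* (β M.+ j y) M.^ repunit Q d ∎

-- The substitution h^n p(f/h).

module HomogeneousSubstitution {a ℓ₁ ℓ₂ Q} (F : FiniteField a ℓ₁ ℓ₂ Q) where
  private module F = FieldProperties F
  open PolynomialRing F
  open PolynomialDivision F
  open import Algebra.Properties.Semiring.Sum P.semiring using (*-distribˡ-sum; sum-cong-≋)

  -- h^n p(f/h) for deg p ≤ n
  homogenize : Poly → Poly → ℕ → Poly → Poly
  homogenize f h n p = sum {suc n} λ i → coeff p (toℕ i) · (f ^ toℕ i * h ^ (n ℕ.∸ toℕ i))

  -- The degree d t^m is prescribed at each stage, so the iterates are defined before their degrees
  -- are known.
  iterate : Poly → Poly → ℕ → ℕ → Poly → ℕ → Poly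
  iterate f h t d p zero    = p
  iterate f h t d p (suc m) = homogenize f h (d ℕ.* t ℕ.^ m) (iterate f h t d p m)

  iterate-degree : ∀ d t m → d ℕ.* t ℕ.^ m ℕ.* t ≡ d ℕ.* t ℕ.^ suc m
  iterate-degree d t m = ≡.trans (ℕₚ.*-assoc d (t ℕ.^ m) t) (≡.cong (d ℕ.*_) (ℕₚ.*-comm (t ℕ.^ m) t))

  tail : Poly → Poly
  tail = List.drop 1

  coeff-tail : ∀ p i → coeff p (suc i) ≡ coeff (tail p) i
  coeff-tail []      i = ≡.refl
  coeff-tail (x ∷ p) i = ≡.refl

  ·-≋ : ∀ {x y p r} → x F.≈ y → p ≋ r → x · p ≋ y · r
  ·-≋ {p = p} {r} x≈y p≋r = ⟪ ·-cong {p = p} {r} x≈y (at p≋r) ⟫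

  homogenize-zero : ∀ f h p → homogenize f h 0 p ≋ coeff p 0 ∷ []
  homogenize-zero f h p = P.trans (P.+-identityʳ (coeff p 0 · (one * one)))
    (P.trans (·-≋ F.refl (P.*-identityˡ one)) ⟪ ∷-cong (F.*-identityʳ _) (λ i → F.refl) ⟫)
    where
    one = F.1# ∷ []

  -- Horner's rule in homogeneous form; degrees, congruence and evaluation are all obtained by
  -- induction along it.
  homogenize-suc : ∀ f h n p →
    homogenize f h (suc n) p ≋ coeff p 0 · h ^ suc n + f * homogenize f h n (tail p)
  homogenize-suc f h n p = P.+-cong (·-≋ {p = (F.1# ∷ []) * h ^ suc n} F.refl (P.*-identityˡ (h ^ suc n)))
    (P.sym (P.trans (*-distribˡ-sum {suc n} f terms) (sum-cong-≋ {suc n} term)))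
    where
    terms : Fin (suc n) → Poly
    terms i = coeff (tail p) (toℕ i) · (f ^ toℕ i * h ^ (n ℕ.∸ toℕ i))

    term : ∀ (i : Fin (suc n)) → f * (coeff (tail p) (toℕ i) · (f ^ toℕ i * h ^ (n ℕ.∸ toℕ i))) ≋
      coeff p (suc (toℕ i)) · ((f * f ^ toℕ i) * h ^ (n ℕ.∸ toℕ i))
    term i = begin
      f * (x · (u * v))   ≈⟨ P.*-comm f (x · (u * v)) ⟩
      (x · (u * v)) * f   ≈⟨ ⟪ ·-* x (u * v) f ⟫ ⟩
      x · ((u * v) * f)   ≈⟨ ·-≋ {p = (u * v) * f} {(f * u) * v} (F.reflexive (≡.sym (coeff-tail p (toℕ i)))) (solve 3 (λ f u v → (u :* v) :* f := (f :* u) :* v) P.refl f u v) ⟩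
      coeff p (suc (toℕ i)) · ((f * u) * v) ∎
      where
      open import Relation.Binary.Reasoning.Setoid P.setoid
      open IntegerCoefficients polynomialRing using (solve; _:*_; _:=_)
      x = coeff (tail p) (toℕ i)
      u = f ^ toℕ i
      v = h ^ (n ℕ.∸ toℕ i)

  below-tail : ∀ {p n} → Below p (suc n) → Below (tail p) n
  below-tail {p} b i n≤i = F.trans (F.reflexive (≡.sym (coeff-tail p i))) (b (suc i) (s≤s n≤i))

  hasDeg-tail : ∀ {p n} → HasDeg p (suc n) → HasDeg (tail p) n
  hasDeg-tail {p} hp = record
    { lead = λ eq → lead hp (F.trans (F.reflexive (coeff-tail p _)) eq) ; below = below-tail {p} (below hp) }

  hasDeg-+ : ∀ {p r n} → Below p n → HasDeg r n → HasDeg (p + r) n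
  hasDeg-+ {p} {r} bp hr = record
    { lead  = λ eq → lead hr (F.trans (F.sym (same _ ℕₚ.≤-refl)) eq)
    ; below = λ i n<i → F.trans (same i (ℕₚ.<⇒≤ n<i)) (below hr i n<i) }
    where
    same : ∀ i → _ ℕ.≤ i → coeff (p + r) i F.≈ coeff r i
    same i n≤i = F.trans (coeff-+ p r i) (F.trans (F.+-congʳ (bp i n≤i)) (F.+-identityˡ _))

  ^-below : ∀ h {t} → Below h t → ∀ k → Below (h ^ suc k) (suc k ℕ.* t)
  ^-below h {t} bh zero    i t+0≤i = F.trans (*-identityʳ h i) (bh i (≡.subst (ℕ._≤ i) (ℕₚ.+-identityʳ t) t+0≤i))
  ^-below h {t} bh (suc k) = below-* h (h ^ suc k) bh (λ i kt<i → ^-below h bh k i (ℕₚ.<⇒≤ kt<i))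

  -- Since deg h < t = deg f, the summand with h^(n+1) stays below degree (n + 1) t, and the leading
  -- term is that of the part divisible by f.
  homogenize-hasDeg : ∀ {f h t} → HasDeg f t → Below h t → ∀ n p → HasDeg p n →
    HasDeg (homogenize f h n p) (n ℕ.* t)
  homogenize-hasDeg {f} {h} hf bh zero p hp = hasDeg-cong (P.sym (homogenize-zero f h p))
    record { lead = lead hp ; below = λ { (suc i) _ → F.refl } }
  homogenize-hasDeg {f} {h} {t} hf bh (suc n) p hp = hasDeg-cong (P.sym (homogenize-suc f h n p))
    (hasDeg-+ {coeff p 0 · h ^ suc n}
      (λ i le → F.trans (coeff-· _ (h ^ suc n) i) (F.trans (F.*-congˡ (^-below h bh n i le)) (F.zeroʳ _)))
      (hasDeg-* hf (homogenize-hasDeg hf bh n (tail p) (hasDeg-tail hp))))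

  iterate-hasDeg : ∀ {f h t} → HasDeg f t → Below h t → ∀ {p d} → HasDeg p d → ∀ m →
    HasDeg (iterate f h t d p m) (d ℕ.* t ℕ.^ m)
  iterate-hasDeg hf bh {p} {d} hp zero = ≡.subst (HasDeg p) (≡.sym (ℕₚ.*-identityʳ d)) hp
  iterate-hasDeg {f} {h} {t} hf bh {p} {d} hp (suc m) = ≡.subst (HasDeg (iterate f h t d p (suc m))) (iterate-degree d t m)
    (homogenize-hasDeg hf bh (d ℕ.* t ℕ.^ m) (iterate f h t d p m) (iterate-hasDeg hf bh hp m))

  ^-≋ : ∀ {h h′} n → h ≋ h′ → h ^ n ≋ h′ ^ n
  ^-≋ zero    _    = P.refl
  ^-≋ (suc n) h≋h′ = P.*-cong h≋h′ (^-≋ n h≋h′)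

  homogenize-cong : ∀ {f f′ h h′} → f ≋ f′ → h ≋ h′ → ∀ n p p′ → p ≋ p′ →
    homogenize f h n p ≋ homogenize f′ h′ n p′
  homogenize-cong {f} {f′} {h} {h′} f≋ h≋ zero p p′ p≋ = P.trans (homogenize-zero f h p)
    (P.trans ⟪ ∷-cong (at p≋ 0) (λ i → F.refl) ⟫ (P.sym (homogenize-zero f′ h′ p′)))
  homogenize-cong {f} {f′} {h} {h′} f≋ h≋ (suc n) p p′ p≋ = P.trans (homogenize-suc f h n p)
    (P.trans (P.+-cong (·-≋ (at p≋ 0) (^-≋ (suc n) h≋)) (P.*-cong f≋ (homogenize-cong f≋ h≋ n (tail p) (tail p′)
      ⟪ (λ i → F.trans (F.reflexive (≡.sym (coeff-tail p i))) (F.trans (at p≋ (suc i)) (F.reflexive (coeff-tail p′ i)))) ⟫)))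
      (P.sym (homogenize-suc f′ h′ n p′)))

module HomogeneousEvaluation {a ℓ₁ ℓ₂ b ℓ₃ ℓ₄ Q S} (F : FiniteField a ℓ₁ ℓ₂ Q) (M : FiniteField b ℓ₃ ℓ₄ S)
  (j : FiniteField.Carrier F → FiniteField.Carrier M)
  (j-homomorphism : RingMorphisms.IsRingHomomorphism (FiniteField.rawRing F) (FiniteField.rawRing M) j) where
  private
    module F = FieldProperties F
    module M = FieldProperties M
    module M[x] where
      open PolynomialRing M public
      open PolynomialDivision M public
      open Evaluation M public
      open HomogeneousSubstitution M public
  open PolynomialRing F
  open PolynomialDivision F
  open HomogeneousSubstitution F
  open Embedding F M j j-homomorphism
  open import Relation.Binary.Reasoning.Setoid M.setoid using (begin_; step-≈-⟩; step-≈-⟨; _∎)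

  ev-tail : ∀ p y → ev p y M.≈ j (coeff p 0) M.+ y M.* ev (tail p) y
  ev-tail []      y = M.sym (M.trans (M.+-cong 0#-homo (M.zeroʳ y)) (M.+-identityˡ _))
  ev-tail (x ∷ p) y = M.refl

  ev-below-1 : ∀ p y → Below p 1 → ev p y M.≈ j (coeff p 0)
  ev-below-1 p y b = M.trans (M[x].eval-below-1 (map j p) y
    (λ i 1≤i → M.trans (map-coeff p i) (M.trans (j-cong (b i 1≤i)) 0#-homo))) (map-coeff p 0)

  ev-const : ∀ x y → ev (x ∷ []) y M.≈ j x
  ev-const x y = M[x].eval-const (j x) y

  ev-homogenize-suc : ∀ f h n p y → ev (homogenize f h (suc n) p) y M.≈
    j (coeff p 0) M.* ev h y M.^ suc n M.+ ev f y M.* ev (homogenize f h n (tail p)) y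
  ev-homogenize-suc f h n p y = M.trans
    (ev-cong {homogenize f h (suc n) p} {coeff p 0 · h ^ suc n + f * homogenize f h n (tail p)} (homogenize-suc f h n p))
    (M.trans (ev-+ (coeff p 0 · h ^ suc n) (f * homogenize f h n (tail p)) y)
      (M.+-cong (M.trans (ev-· (coeff p 0) (h ^ suc n) y) (M.*-congˡ (ev-^ h (suc n) y)))
        (ev-* f (homogenize f h n (tail p)) y)))

  -- The hypothesis `ratio` says α = f(y)/h(y) without division, so that no inverse of h(y) enters
  -- the induction.
  ev-homogenize : ∀ f h {y α} → ev f y M.≈ α M.* ev h y → ∀ n p → Below p (suc n) →
    ev (homogenize f h n p) y M.≈ ev h y M.^ n M.* ev p α
  ev-homogenize f h {y} {α} ratio zero p b = begin
    ev (homogenize f h 0 p) y   ≈⟨ ev-cong {homogenize f h 0 p} {coeff p 0 ∷ []} (homogenize-zero f h p) ⟩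
    ev (coeff p 0 ∷ []) y       ≈⟨ ev-const _ y ⟩
    j (coeff p 0)               ≈⟨ ev-below-1 p α b ⟨
    ev p α                      ≈⟨ M.*-identityˡ _ ⟨
    M.1# M.* ev p α             ∎
  ev-homogenize f h {y} {α} ratio (suc n) p b = begin
    ev (homogenize f h (suc n) p) y                             ≈⟨ ev-homogenize-suc f h n p y ⟩
    x M.* (B M.* B M.^ n) M.+ ev f y M.* ev (homogenize f h n (tail p)) y
      ≈⟨ M.+-congˡ (M.*-cong ratio (ev-homogenize f h ratio n (tail p) (below-tail {p} b))) ⟩
    x M.* (B M.* B M.^ n) M.+ (α M.* B) M.* (B M.^ n M.* ev (tail p) α)
      ≈⟨ solve 5 (λ x B P α v → x :* (B :* P) :+ (α :* B) :* (P :* v) := (B :* P) :* (x :+ α :* v)) M.refl x B (B M.^ n) α (ev (tail p) α) ⟩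
    (B M.* B M.^ n) M.* (x M.+ α M.* ev (tail p) α)             ≈⟨ M.*-congˡ (ev-tail p α) ⟨
    (B M.* B M.^ n) M.* ev p α                                  ∎
    where
    open IntegerCoefficients M.commutativeRing using (solve; _:+_; _:*_; _:=_)
    x = j (coeff p 0)
    B = ev h y

  -- Where h vanishes, only the summand without a factor h remains.
  ev-homogenize-0 : ∀ f h {y} → ev h y M.≈ M.0# → ∀ n p →
    ev (homogenize f h n p) y M.≈ j (coeff p n) M.* ev f y M.^ n
  ev-homogenize-0 f h {y} B≈0 zero p = M.trans
    (ev-cong {homogenize f h 0 p} {coeff p 0 ∷ []} (homogenize-zero f h p))
    (M.trans (ev-const _ y) (M.sym (M.*-identityʳ _)))
  ev-homogenize-0 f h {y} B≈0 (suc n) p = begin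
    ev (homogenize f h (suc n) p) y                             ≈⟨ ev-homogenize-suc f h n p y ⟩
    x M.* ev h y M.^ suc n M.+ A M.* ev (homogenize f h n (tail p)) y
      ≈⟨ M.+-cong (M.trans (M.*-congˡ (M.0^suc n B≈0)) (M.zeroʳ x)) (M.*-congˡ (ev-homogenize-0 f h B≈0 n (tail p))) ⟩
    M.0# M.+ A M.* (j (coeff (tail p) n) M.* A M.^ n)
      ≈⟨ solve 3 (λ A c P → con (+ 0) :+ A :* (c :* P) := c :* (A :* P)) M.refl A (j (coeff (tail p) n)) (A M.^ n) ⟩
    j (coeff (tail p) n) M.* A M.^ suc n                        ≈⟨ M.*-congʳ (j-cong (F.reflexive (coeff-tail p n))) ⟨
    j (coeff p (suc n)) M.* A M.^ suc n                         ∎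
    where
    open IntegerCoefficients M.commutativeRing using (solve; con; _:+_; _:*_; _:=_)
    x = j (coeff p 0)
    A = ev f y

  map-homogenize : ∀ f h n p → map j (homogenize f h n p) M[x].≋ M[x].homogenize (map j f) (map j h) n (map j p)
  map-homogenize f h zero p = M[x].P.trans (map-cong (homogenize-zero f h p))
    (M[x].P.trans M[x].⟪ M[x].∷-cong (M.sym (map-coeff p 0)) (λ i → M.refl) ⟫
      (M[x].P.sym (M[x].homogenize-zero (map j f) (map j h) (map j p))))
  map-homogenize f h (suc n) p = M[x].P.trans (map-cong (homogenize-suc f h n p))
    (M[x].P.trans (map-+ (coeff p 0 · h ^ suc n) (f * homogenize f h n (tail p)))
    (M[x].P.trans (M[x].P.+-cong
      (M[x].P.trans (map-· (coeff p 0) (h ^ suc n)) (M[x].·-≋ (M.sym (map-coeff p 0)) (map-^ h (suc n))))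
      (M[x].P.trans (map-* f (homogenize f h n (tail p))) (M[x].P.*-congˡ {map j f} (M[x].P.trans (map-homogenize f h n (tail p))
        (M[x].homogenize-cong {map j f} {map j f} {map j h} {map j h} M[x].P.refl M[x].P.refl n _ _ (map-tail p))))))
    (M[x].P.sym (M[x].homogenize-suc (map j f) (map j h) n (map j p)))))
    where
    map-tail : ∀ p → map j (tail p) M[x].≋ M[x].tail (map j p)
    map-tail []      = M[x].P.refl
    map-tail (x ∷ p) = M[x].P.refl

-- n = Q - 1; ρ = r(-θ′)/r(-θ) is not an ℓ-th power once ρ^(n/ℓ) ≠ 1, here cleared of denominators.
record NonPower {a ℓ₁ ℓ₂ Q} (L : FiniteField a ℓ₁ ℓ₂ Q) (θ θ′ : FieldProperties.Carrier L) (n t : ℕ)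
  (r : Polynomial.Poly L) : Set ℓ₁ where
  private module L = FieldProperties L
  open Polynomial L using (eval)
  field
    numerator≉0   : eval r (L.- θ′) L.≉ L.0#
    denominator≉0 : eval r (L.- θ) L.≉ L.0#
    separated     : ∀ ℓ m → Prime ℓ → ℓ ∣ℕ t → n ≡ ℓ ℕ.* m →
      ¬ eval r (L.- θ′) L.^ m L.≈ eval r (L.- θ) L.^ m

Related : ∀ {a ℓ₁ ℓ₂ Q} (L : FiniteField a ℓ₁ ℓ₂ Q) → Polynomial.Poly L → Polynomial.Poly L → ℕ →
  FieldProperties.Carrier L → Set ℓ₁
Related L f h t τ = f + τ · h ≋ - ((x+ τ) ^ t)
  where open PolynomialRing L

-- What the argument over `L` uses of θ, f and h, with `θ′` in the role of θ^q. The field `four` is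
-- the additional condition of lifting the exponent at the prime 2.
record TransformData {a ℓ₁ ℓ₂ Q} (L : FiniteField a ℓ₁ ℓ₂ Q) : Set (a ⊔ ℓ₁) where
  field
    n       : ℕ
    Q≡      : Q ≡ suc n
    θ θ′    : FieldProperties.Carrier L
    θ≉θ′    : FieldProperties._≉_ L θ θ′
    t′      : ℕ
    f h     : Polynomial.Poly L
    f-deg   : PolynomialDivision.HasDeg L f (suc t′)
    h-below : PolynomialDivision.Below L h (suc t′)
    rel     : Related L f h (suc t′) θ
    rel′    : Related L f h (suc t′) θ′
    primes  : ∀ p → Prime p → p ∣ℕ suc t′ → p ∣ℕ n
    four    : 2 ∣ℕ suc t′ → 4 ∣ℕ n

  t : ℕ
  t = suc t′

-- Roots of the transform over `L` and their periods.

module Fibre {a ℓ₁ ℓ₂ b ℓ₃ ℓ₄ Q S} (L : FiniteField a ℓ₁ ℓ₂ Q) (D : TransformData L)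
  (M : FiniteField b ℓ₃ ℓ₄ S) (j : FiniteField.Carrier L → FiniteField.Carrier M)
  (j-homomorphism : RingMorphisms.IsRingHomomorphism (FiniteField.rawRing L) (FiniteField.rawRing M) j) where
  private
    module L = FieldProperties L
    module M = FieldProperties M
    module H = HomogeneousSubstitution L
  open PolynomialRing L using (_·_; _+_; -_; _^_; x+_)
  open PolynomialDivision L using (HasDeg; lead; below)
  open TransformData D
  open Embedding L M j j-homomorphism
  open HomogeneousEvaluation L M j j-homomorphism
  open import Relation.Binary.Reasoning.Setoid M.setoid using (begin_; step-≈-⟩; step-≈-⟨; _∎)

  ev-related : ∀ {τ} → Related L f h t τ → ∀ y → ev f y M.+ j τ M.* ev h y M.≈ M.- ((y M.+ j τ) M.^ t)
  ev-related {τ} rel y = begin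
    ev f y M.+ j τ M.* ev h y      ≈⟨ M.+-congˡ (ev-· τ h y) ⟨
    ev f y M.+ ev (τ · h) y        ≈⟨ ev-+ f (τ · h) y ⟨
    ev (f + τ · h) y               ≈⟨ ev-cong {f + τ · h} { - ((x+ τ) ^ t)} rel ⟩
    ev (- ((x+ τ) ^ t)) y          ≈⟨ M.trans (Evaluation.eval-cong M (map-neg ((x+ τ) ^ t))) (Evaluation.eval-neg M (map j ((x+ τ) ^ t)) y) ⟩
    M.- ev ((x+ τ) ^ t) y          ≈⟨ M.-‿cong (M.trans (ev-^ (x+ τ) t y) (M.^-congˡ t (ev-x+ τ y))) ⟩
    M.- ((y M.+ j τ) M.^ t)        ∎

  related-ratio : ∀ {τ α} → Related L f h t τ → ∀ {y} → ev f y M.≈ α M.* ev h y →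
    (α M.+ j τ) M.* ev h y M.≈ M.- ((y M.+ j τ) M.^ t)
  related-ratio {τ} {α} rel {y} ratio = begin
    (α M.+ j τ) M.* ev h y            ≈⟨ M.distribʳ _ _ _ ⟩
    α M.* ev h y M.+ j τ M.* ev h y   ≈⟨ M.+-congʳ ratio ⟨
    ev f y M.+ j τ M.* ev h y         ≈⟨ ev-related rel y ⟩
    M.- ((y M.+ j τ) M.^ t)           ∎

  module _ {r d} (hr : HasDeg r d) {β} (root : ev (H.homogenize f h d r) β M.≈ M.0#) where

    -- If h(β) = 0, the root equation reduces to a multiple of f(β)^d, so f(β) = 0 as well. Both
    -- relations then make (β + θ)^t and (β + θ′)^t vanish, against θ ≠ θ′.
    h≉0 : ev h β M.≉ M.0#
    h≉0 h≈0 = j≉0 (λ eq → θ≉θ′ (L.x-y≈0⇒x≈y _ _ eq)) (begin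
      j (θ L.- θ′)                          ≈⟨ j-- θ θ′ ⟩
      j θ M.- j θ′                          ≈⟨ solve 3 (λ x y β → x :- y := (β :+ x) :- (β :+ y)) M.refl (j θ) (j θ′) β ⟩
      (β M.+ j θ) M.- (β M.+ j θ′)          ≈⟨ M.+-cong (vanishes rel) (M.-‿cong (vanishes rel′)) ⟩
      M.0# M.- M.0#                         ≈⟨ M.-‿inverseʳ M.0# ⟩
      M.0#                                  ∎)
      where
      open IntegerCoefficients M.commutativeRing using (solve; _:+_; _:-_; _:=_)
      f≈0 : ev f β M.≈ M.0#
      f≈0 = M.^≈0⇒≈0 d (M.x*y≈0⇒y≈0 (j≉0 (lead hr))
        (M.trans (M.sym (ev-homogenize-0 f h h≈0 d r)) root))

      vanishes : ∀ {τ} → Related L f h t τ → β M.+ j τ M.≈ M.0#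
      vanishes {τ} rel = M.^≈0⇒≈0 t (begin
        (β M.+ j τ) M.^ t                 ≈⟨ M.-‿involutive _ ⟨
        M.- (M.- ((β M.+ j τ) M.^ t))     ≈⟨ M.-‿cong (ev-related rel β) ⟨
        M.- (ev f β M.+ j τ M.* ev h β)   ≈⟨ M.-‿cong (M.trans (M.+-cong f≈0 (M.trans (M.*-congˡ h≈0) (M.zeroʳ _))) (M.+-identityʳ _)) ⟩
        M.- M.0#                          ≈⟨ M.-0#≈0# ⟩
        M.0#                              ∎)

    image : M.Carrier
    image = ev f β M.* ev h β M.⁻¹

    image-ratio : ev f β M.≈ image M.* ev h β
    image-ratio = M.sym (M.trans (M.*-assoc _ _ _) (M.trans (M.*-congˡ (M.inverseˡ h≉0)) (M.*-identityʳ _)))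

    image-root : ev r image M.≈ M.0#
    image-root = M.x*y≈0⇒y≈0 (M.^≉0 d h≉0)
      (M.trans (M.sym (ev-homogenize f h image-ratio d r (below hr))) root)

repunit-pow′ : ∀ {N n} → N ≡ suc n → ∀ k → N ℕ.^ k ≡ suc (n ℕ.* repunit N k)
repunit-pow′ {n = n} ≡.refl k = repunit-pow n k

module RadicalPeriod {a ℓ₁ ℓ₂ Q} (M : FiniteField a ℓ₁ ℓ₂ Q) where
  open FieldProperties M
  open Order M using (order-divides)
  open import Relation.Binary.Reasoning.Setoid setoid

  fraction : ∀ {x y} → y ≉ 0# → x ≈ (x * y ⁻¹) * y
  fraction y≉0 = sym (trans (*-assoc _ _ _) (trans (*-congˡ (inverseˡ y≉0)) (*-identityʳ _)))

  -- This is the conjugation to the t-th power map: for u, v = β + θ′, β + θ and U, V = α + θ′, α +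
  -- θ, the common factor H = h(β) and the signs cancel in the quotient.
  fraction-power : ∀ t {u v U V H} → v ≉ 0# → V ≉ 0# → U * H ≈ - (u ^ t) → V * H ≈ - (v ^ t) →
    (u * v ⁻¹) ^ t ≈ U * V ⁻¹
  fraction-power t {u} {v} {U} {V} {H} v≉0 V≉0 UH≈ VH≈ = *-cancelʳ (^≉0 t v≉0) (begin
    B ^ t * v ^ t          ≈⟨ ^-distrib-* B v t ⟨
    (B * v) ^ t            ≈⟨ ^-congˡ t (fraction v≉0) ⟨
    u ^ t                  ≈⟨ -‿involutive _ ⟨
    - (- (u ^ t))          ≈⟨ -‿cong UH≈ ⟨
    - (U * H)              ≈⟨ -‿cong (*-congʳ (fraction V≉0)) ⟩
    - ((A * V) * H)        ≈⟨ solve 3 (λ A V H → :- ((A :* V) :* H) := A :* (:- (V :* H))) refl A V H ⟩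
    A * (- (V * H))        ≈⟨ *-congˡ (trans (-‿cong VH≈) (-‿involutive _)) ⟩
    A * v ^ t              ∎)
    where
    open IntegerCoefficients commutativeRing using (solve; _:*_; :-_; _:=_)
    A = U * V ⁻¹
    B = u * v ⁻¹

  -- ζ = B^(n S) has order exactly t.
  radical-period : ∀ {A B n S N} t e → t ≢ 0 → N ≡ suc (n ℕ.* S) →
    (∀ p → Prime p → p ∣ℕ t → p ∣ℕ n) → (2 ∣ℕ t → 4 ∣ℕ n) →
    B ^ t ≈ A → A ^ (n ℕ.* S) ≈ 1# →
    (∀ p m → Prime p → p ∣ℕ t → n ≡ p ℕ.* m → ¬ (A ^ S) ^ m ≈ 1#) →
    B ^ (n ℕ.* S ℕ.* repunit N e) ≈ 1# → t ∣ℕ e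
  radical-period {A} {B} {n} {S} {N} t e t≢0 N≡ primes four Bᵗ≈A Aⁿˢ≈1 separated Bᴿ≈1 =
    repunit-divisible t (n ℕ.* S) e t≢0
      (λ p p-prime p∣t → ℕ∣.∣m⇒∣m*n S (primes p p-prime p∣t)) (λ 2∣t → ℕ∣.∣m⇒∣m*n S (four 2∣t))
      (≡.subst (λ N → t ∣ℕ repunit N e) N≡ (order-divides t≢0 ζᵗ≈1 ζ-order (repunit N e)
        (trans (^-assocʳ B (n ℕ.* S) (repunit N e)) Bᴿ≈1)))
    where
    ζ-power : ∀ k l → n ℕ.* S ℕ.* k ≡ t ℕ.* l → (B ^ (n ℕ.* S)) ^ k ≈ A ^ l
    ζ-power k l eq = begin
      (B ^ (n ℕ.* S)) ^ k    ≈⟨ ^-assocʳ B (n ℕ.* S) k ⟩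
      B ^ (n ℕ.* S ℕ.* k)    ≈⟨ ^-congʳ B eq ⟩
      B ^ (t ℕ.* l)          ≈⟨ ^-assocʳ B t l ⟨
      (B ^ t) ^ l            ≈⟨ ^-congˡ l Bᵗ≈A ⟩
      A ^ l                  ∎

    ζᵗ≈1 : (B ^ (n ℕ.* S)) ^ t ≈ 1#
    ζᵗ≈1 = trans (ζ-power t (n ℕ.* S) (ℕₚ.*-comm (n ℕ.* S) t)) Aⁿˢ≈1

    regroup : ∀ p m S k → p ℕ.* m ℕ.* S ℕ.* k ≡ p ℕ.* k ℕ.* (S ℕ.* m)
    regroup = solve-∀

    -- With t = p k and n = p m the exponent n S k equals t (S m), so ζ^k is (A^S)^m, which differs
    -- from 1 by `separated`.
    ζ-order : ∀ p k → Prime p → t ≡ p ℕ.* k → ¬ (B ^ (n ℕ.* S)) ^ k ≈ 1#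
    ζ-order p k p-prime t≡pk ζᵏ≈1 with primes p p-prime (divides k (≡.trans t≡pk (ℕₚ.*-comm p k)))
    ... | divides m n≡mp = separated p m p-prime (divides k (≡.trans t≡pk (ℕₚ.*-comm p k))) n≡pm
      (trans (^-assocʳ A S m) (trans (sym (ζ-power k (S ℕ.* m) exponents)) ζᵏ≈1))
      where
      n≡pm : n ≡ p ℕ.* m
      n≡pm = ≡.trans n≡mp (ℕₚ.*-comm m p)

      exponents : n ℕ.* S ℕ.* k ≡ t ℕ.* (S ℕ.* m)
      exponents = ≡.trans (≡.cong (λ n → n ℕ.* S ℕ.* k) n≡pm)
        (≡.trans (regroup p m S k) (≡.cong (ℕ._* (S ℕ.* m)) (≡.sym t≡pk)))

module PeriodOfRoot {a ℓ₁ ℓ₂ b ℓ₃ ℓ₄ Q S} (L : FiniteField a ℓ₁ ℓ₂ Q) (D : TransformData L)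
  (M : FiniteField b ℓ₃ ℓ₄ S) (j : FiniteField.Carrier L → FiniteField.Carrier M)
  (j-homomorphism : RingMorphisms.IsRingHomomorphism (FiniteField.rawRing L) (FiniteField.rawRing M) j) where
  private
    module L = FieldProperties L
    module M = FieldProperties M
    module H = HomogeneousSubstitution L
  open PolynomialRing L using (eval; Irreducible)
  open PolynomialDivision L using (HasDeg)
  open TransformData D
  open Embedding L M j j-homomorphism
  open Fibre L D M j j-homomorphism
  open RadicalPeriod M
  open import Relation.Binary.Reasoning.Setoid M.setoid using (begin_; step-≈-⟩; step-≈-⟨; _∎)

  shift-fixed : ∀ w {x} y → x M.^ (Q ℕ.^ w) M.≈ x → (x M.+ j y) M.^ (Q ℕ.^ w) M.≈ x M.+ j y
  shift-fixed w y fixed = M.trans (frobenius-+ w _ _) (M.+-cong fixed (frobenius-j w y))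

  fraction-fixed : ∀ w {x} y z → x M.+ j z M.≉ M.0# → x M.^ (Q ℕ.^ w) M.≈ x →
    let A = (x M.+ j y) M.* (x M.+ j z) M.⁻¹ in A M.^ (Q ℕ.^ w) M.≈ A
  fraction-fixed w y z ≉0 fixed = M.quotient-fixed {n = Q ℕ.^ w} ≉0 (fraction ≉0)
    (shift-fixed w z fixed) (shift-fixed w y fixed)

  ev-fixed : ∀ e {β} p → β M.^ (Q ℕ.^ e) M.≈ β → ev p β M.^ (Q ℕ.^ e) M.≈ ev p β
  ev-fixed e p fixed = M.trans (M.sym (ev-frobenius e p _)) (ev-congʳ p fixed)

  j-injective : ∀ {x y} → j x M.≈ j y → x L.≈ y
  j-injective {x} {y} jx≈jy with x L.≟ y
  ... | yes x≈y = x≈y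
  ... | no x≉y = ⊥-elim (j≉0 (λ eq → x≉y (L.x-y≈0⇒x≈y _ _ eq))
    (M.trans (j-- x y) (M.x≈y⇒x-y≈0 jx≈jy)))

  -- Here `A` is the image of r(-θ′)/r(-θ), given by its defining product, so an m-th power 1 would
  -- equate the two powers already in `L`.
  separated-image : ∀ {r} → NonPower L θ θ′ n t r → ∀ {A} → j (eval r (L.- θ′)) M.≈ A M.* j (eval r (L.- θ)) →
    ∀ p m → Prime p → p ∣ℕ t → n ≡ p ℕ.* m → ¬ A M.^ m M.≈ M.1#
  separated-image {r} nonPower {A} values p m p-prime p∣t n≡pm Aᵐ≈1 =
    NonPower.separated nonPower p m p-prime p∣t n≡pm (j-injective (begin
      j (x L.^ m)               ≈⟨ j-^ x m ⟩
      j x M.^ m                 ≈⟨ M.^-congˡ m values ⟩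
      (A M.* j y) M.^ m         ≈⟨ M.^-distrib-* A (j y) m ⟩
      A M.^ m M.* j y M.^ m     ≈⟨ M.*-congʳ Aᵐ≈1 ⟩
      M.1# M.* j y M.^ m        ≈⟨ M.*-identityˡ _ ⟩
      j y M.^ m                 ≈⟨ j-^ y m ⟨
      j (y L.^ m)               ∎))
    where
    x = eval r (L.- θ′)
    y = eval r (L.- θ)

  -- Dividing two instances of the norm formula eliminates κ and exhibits r(-y)/r(-z) as an S-th
  -- power of (α + y)/(α + z) in `M`.
  norm-fraction : ∀ {r α κ S} → (∀ y → j (eval r (L.- y)) M.≈ κ M.* (α M.+ j y) M.^ S) → ∀ {y z} → α M.+ j z M.≉ M.0# →
    j (eval r (L.- y)) M.≈ ((α M.+ j y) M.* (α M.+ j z) M.⁻¹) M.^ S M.* j (eval r (L.- z))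
  norm-fraction {r} {α} {κ} {S} norm {y} {z} V≉0 = begin
    j (eval r (L.- y))                 ≈⟨ norm y ⟩
    κ M.* U M.^ S                      ≈⟨ M.*-congˡ (M.trans (M.^-congˡ S (fraction V≉0)) (M.^-distrib-* A V S)) ⟩
    κ M.* (A M.^ S M.* V M.^ S)        ≈⟨ solve 3 (λ κ x y → κ :* (x :* y) := x :* (κ :* y)) M.refl κ (A M.^ S) (V M.^ S) ⟩
    A M.^ S M.* (κ M.* V M.^ S)        ≈⟨ M.*-congˡ (norm z) ⟨
    A M.^ S M.* j (eval r (L.- z))     ∎
    where
    open IntegerCoefficients M.commutativeRing using (solve; _:*_; _:=_)
    U = α M.+ j y
    V = α M.+ j z
    A = U M.* V M.⁻¹

  norm-shift≉0 : ∀ {r α κ S} → (∀ y → j (eval r (L.- y)) M.≈ κ M.* (α M.+ j y) M.^ suc S) → ∀ {y} →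
    eval r (L.- y) L.≉ L.0# → α M.+ j y M.≉ M.0#
  norm-shift≉0 {κ = κ} {S} norm {y} ≉0 eq =
    j≉0 ≉0 (M.trans (norm y) (M.trans (M.*-congˡ (M.0^suc S eq)) (M.zeroʳ κ)))

  below≉0 : ∀ {τ α β} → Related L f h t τ → ev f β M.≈ α M.* ev h β → ev h β M.≉ M.0# →
    α M.+ j τ M.≉ M.0# → β M.+ j τ M.≉ M.0#
  below≉0 rel ratio h≉0 ≉0 eq = M.x*y≉0 ≉0 h≉0 (M.trans (related-ratio rel ratio)
    (M.trans (M.-‿cong (M.0^suc t′ eq)) M.-0#≈0#))

  -- The fractions (α + θ′)/(α + θ) and (β + θ′)/(β + θ) inherit the periods of α and β, because θ
  -- and θ′ come from `L`. Their numerators and denominators are nonzero: for α by the norm formula,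
  -- for β by the relations between f and h.
  period-over-image : ∀ {r d′} → NonPower L θ θ′ n t r → ∀ {α β κ} →
    (∀ y → j (eval r (L.- y)) M.≈ κ M.* (α M.+ j y) M.^ repunit Q (suc d′)) →
    ev f β M.≈ α M.* ev h β → ev h β M.≉ M.0# → α M.^ (Q ℕ.^ suc d′) M.≈ α →
    ∀ e → β M.^ (Q ℕ.^ (e ℕ.* suc d′)) M.≈ β → t ∣ℕ e
  period-over-image {r} {d′} nonPower {α} {β} norm ratio h≉0 α-fixed e β-fixed =
    radical-period {n = n} {repunit Q d} t e (λ ()) N≡ primes four
      (fraction-power t v≉0 V≉0 (related-ratio rel′ ratio) (related-ratio rel ratio))
      (M.fixed⇒1 (M.x*y≉0 U≉0 (M.⁻¹≉0 V≉0)) N≡ (fraction-fixed d θ′ θ V≉0 α-fixed))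
      (separated-image nonPower (norm-fraction {r} {S = repunit Q d} norm V≉0))
      (M.fixed⇒1 (M.x*y≉0 (below≉0 rel′ ratio h≉0 U≉0) (M.⁻¹≉0 v≉0)) exponent
        (fraction-fixed (e ℕ.* d) θ′ θ v≉0 β-fixed))
    where
    d : ℕ
    d = suc d′

    N≡ : Q ℕ.^ d ≡ suc (n ℕ.* repunit Q d)
    N≡ = repunit-pow′ Q≡ d

    -- With N = Q^d this is Q^(ed) - 1 = n · (N - 1)/n · (N^e - 1)/(N - 1).
    exponent : Q ℕ.^ (e ℕ.* d) ≡ suc (n ℕ.* repunit Q d ℕ.* repunit (Q ℕ.^ d) e)
    exponent = ≡.trans (≡.cong (Q ℕ.^_) (ℕₚ.*-comm e d))
      (≡.trans (≡.sym (ℕₚ.^-*-assoc Q d e)) (repunit-pow′ N≡ e))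

    U≉0 : α M.+ j θ′ M.≉ M.0#
    U≉0 = norm-shift≉0 {r} {S = Q ℕ.* repunit Q d′} norm (NonPower.numerator≉0 nonPower)

    V≉0 : α M.+ j θ M.≉ M.0#
    V≉0 = norm-shift≉0 {r} {S = Q ℕ.* repunit Q d′} norm (NonPower.denominator≉0 nonPower)

    v≉0 : β M.+ j θ M.≉ M.0#
    v≉0 = below≉0 rel ratio h≉0 V≉0

  -- A period e of β is one of α = f(β)/h(β), whence deg r divides e; the cofactor is then divisible
  -- by t.
  period-of-root : ∀ {r d} → Irreducible r → HasDeg r (suc d) → NonPower L θ θ′ n t r →
    ∀ {β} → ev (H.homogenize f h (suc d) r) β M.≈ M.0# →
    ∀ e → β M.^ (Q ℕ.^ e) M.≈ β → suc d ℕ.* t ∣ℕ e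
  period-of-root {r} {d} irr hr nonPower {β} root e β-fixed = conclude
    (MinimalPeriod.period L M j j-homomorphism irr hr α-root e
      (M.quotient-fixed {n = Q ℕ.^ e} (h≉0 hr root) (image-ratio hr root) (ev-fixed e h β-fixed) (ev-fixed e f β-fixed)))
    where
    α-root : ev r (image hr root) M.≈ M.0#
    α-root = image-root hr root

    conclude : suc d ∣ℕ e → suc d ℕ.* t ∣ℕ e
    conclude (divides e′ e≡) = ≡.subst₂ _∣ℕ_ (ℕₚ.*-comm t (suc d)) (≡.sym e≡) (ℕ∣.*-monoˡ-∣ (suc d)
      (period-over-image {r} {d} nonPower (proj₂ (proj₂ (Norm.norm L M j j-homomorphism irr hr α-root)))
        (image-ratio hr root) (h≉0 hr root) (MinimalPeriod.fixed L M j j-homomorphism irr hr α-root) e′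
        (M.trans (M.^-congʳ β (≡.cong (Q ℕ.^_) (≡.sym e≡))) β-fixed)))

-- Irreducibility of the transform and inheritance of the hypothesis.

module TransformIrreducible {a ℓ₁ ℓ₂ Q} (L : FiniteField a ℓ₁ ℓ₂ Q) (D : TransformData L) where
  private
    module L = FieldProperties L
    module H = HomogeneousSubstitution L
  open PolynomialRing L using (eval; Irreducible)
  open PolynomialDivision L using (HasDeg; Below)
  open TransformData D

  transform-hasDeg : ∀ {r d} → HasDeg r d → HasDeg (H.homogenize f h d r) (d ℕ.* t)
  transform-hasDeg hr = H.homogenize-hasDeg f-deg h-below _ _ hr

  -- In an extension of degree e + 1 Fermat's theorem makes e + 1 a period of any root, so (d + 1) t
  -- divides e + 1 and no factor can have smaller degree.
  transform-irreducible : ∀ {r d} → Irreducible r → HasDeg r (suc d) → NonPower L θ θ′ n t r →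
    Irreducible (H.homogenize f h (suc d) r)
  transform-irreducible {r} {d} irr hr nonPower = irreducible-by-roots L (transform-hasDeg hr)
    λ {e = e} X root → ℕₚ.≤-pred (ℕ∣.∣⇒≤ (PeriodOfRoot.period-of-root L D (RootExtension.field′ X) (RootExtension.j X)
      (RootExtension.homomorphism X) irr hr nonPower root (suc e) (FieldProperties.fermat (RootExtension.field′ X) (RootExtension.β X))))

  private
    -- The points -θ and -θ′ lie in `L` itself, so the evaluation lemmas are taken for the identity
    -- embedding.
    module Self where
      self-homomorphism : RingMorphisms.IsRingHomomorphism (FiniteField.rawRing L) (FiniteField.rawRing L) id
      self-homomorphism = isRingHomomorphism-id (FiniteField.rawRing L) L.refl
      open Embedding L L id self-homomorphism public
      open HomogeneousEvaluation L L id self-homomorphism public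
      open Fibre L D L id self-homomorphism public

      ev≡eval : ∀ p y → ev p y ≡ eval p y
      ev≡eval p y = ≡.cong (λ p → eval p y) (Listₚ.map-id p)

  open import Relation.Binary.Reasoning.Setoid L.setoid using (begin_; step-≈-⟩; step-≈-⟨; step-≡-⟩; step-≡-⟨; _∎)

  -- The relation f + σ h = -(x + σ)^t vanishes at -σ because t > 0. Thus -σ is a fixed point of
  -- f/h, and the value of r there survives the transform up to a power of h(-σ).
  f-ratio : ∀ {σ} → Related L f h t σ → Self.ev f (L.- σ) L.≈ (L.- σ) L.* Self.ev h (L.- σ)
  f-ratio {σ} relσ = L.x-y≈0⇒x≈y _ _ (begin
    Self.ev f (L.- σ) L.- (L.- σ) L.* Self.ev h (L.- σ)  ≈⟨ solve 3 (λ f σ h → f :- (:- σ) :* h := f :+ σ :* h) L.refl (Self.ev f (L.- σ)) σ (Self.ev h (L.- σ)) ⟩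
    Self.ev f (L.- σ) L.+ σ L.* Self.ev h (L.- σ)        ≈⟨ Self.ev-related relσ (L.- σ) ⟩
    L.- (((L.- σ) L.+ σ) L.^ t)                          ≈⟨ L.-‿cong (L.0^suc t′ (L.-‿inverseˡ σ)) ⟩
    L.- L.0#                                             ≈⟨ L.-0#≈0# ⟩
    L.0#                                                 ∎)
    where open IntegerCoefficients L.commutativeRing using (solve; _:*_; _:+_; _:-_; :-_; _:=_)

  h-value : ∀ {σ τ} → Related L f h t τ → Related L f h t σ →
    (τ L.- σ) L.* eval h (L.- σ) L.≈ L.- ((τ L.- σ) L.^ t)
  h-value {σ} {τ} relτ relσ = begin
    (τ L.- σ) L.* eval h (L.- σ)                ≈⟨ L.*-cong (L.+-comm τ (L.- σ)) (L.reflexive (≡.sym (Self.ev≡eval h _))) ⟩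
    ((L.- σ) L.+ τ) L.* Self.ev h (L.- σ)       ≈⟨ Self.related-ratio relτ (f-ratio relσ) ⟩
    L.- (((L.- σ) L.+ τ) L.^ t)                 ≈⟨ L.-‿cong (L.^-congˡ t (L.+-comm (L.- σ) τ)) ⟩
    L.- ((τ L.- σ) L.^ t)                       ∎

  transform-value : ∀ {σ} r {d} → Related L f h t σ → Below r (suc d) →
    eval (H.homogenize f h d r) (L.- σ) L.≈ eval h (L.- σ) L.^ d L.* eval r (L.- σ)
  transform-value {σ} r {d} relσ b = begin
    eval (H.homogenize f h d r) (L.- σ)                  ≡⟨ Self.ev≡eval (H.homogenize f h d r) (L.- σ) ⟨
    Self.ev (H.homogenize f h d r) (L.- σ)               ≈⟨ Self.ev-homogenize f h (f-ratio relσ) d r b ⟩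
    Self.ev h (L.- σ) L.^ d L.* Self.ev r (L.- σ)        ≡⟨ ≡.cong₂ (λ x y → x L.^ d L.* y) (Self.ev≡eval h (L.- σ)) (Self.ev≡eval r (L.- σ)) ⟩
    eval h (L.- σ) L.^ d L.* eval r (L.- σ)              ∎

  -- By `h-value`, h(-θ) = -(θ′ - θ)^(t-1) and h(-θ′) = -(θ - θ′)^(t-1), which differ by the sign
  -- (-1)^(t-1).
  h-values : (eval h (L.- θ) L.≈ eval h (L.- θ′)) ⊎ (2 ∣ℕ t × eval h (L.- θ) L.≈ L.- eval h (L.- θ′))
  h-values = compare (parity t)
    where
    open IntegerCoefficients L.commutativeRing using (solve; _:*_; _:-_; :-_; _:=_)
    δ = θ L.- θ′
    B = eval h (L.- θ)
    B′ = eval h (L.- θ′)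

    δ≉0 : δ L.≉ L.0#
    δ≉0 eq = θ≉θ′ (L.x-y≈0⇒x≈y _ _ eq)

    δB≈[-δ]ᵗ : δ L.* B L.≈ (L.- δ) L.^ t
    δB≈[-δ]ᵗ = begin
      δ L.* B                           ≈⟨ solve 3 (λ x y b → (x :- y) :* b := :- ((y :- x) :* b)) L.refl θ θ′ B ⟩
      L.- ((θ′ L.- θ) L.* B)            ≈⟨ L.-‿cong (h-value rel′ rel) ⟩
      L.- (L.- ((θ′ L.- θ) L.^ t))      ≈⟨ L.-‿involutive _ ⟩
      (θ′ L.- θ) L.^ t                  ≈⟨ L.^-congˡ t (solve 2 (λ x y → y :- x := :- (x :- y)) L.refl θ θ′) ⟩
      (L.- δ) L.^ t                     ∎

    compare : (∃ λ k → t ≡ k ℕ.* 2) ⊎ (∃ λ k → t ≡ suc (k ℕ.* 2)) → B L.≈ B′ ⊎ (2 ∣ℕ t × B L.≈ L.- B′)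
    compare (inj₂ (k , t≡)) = inj₁ (L.*-cancelˡ δ≉0 (begin
      δ L.* B                        ≈⟨ L.trans δB≈[-δ]ᵗ (L.^-congʳ (L.- δ) t≡) ⟩
      (L.- δ) L.^ suc (k ℕ.* 2)      ≈⟨ L.^-neg-odd δ k ⟩
      L.- (δ L.^ suc (k ℕ.* 2))      ≈⟨ L.-‿cong (L.^-congʳ δ t≡) ⟨
      L.- (δ L.^ t)                  ≈⟨ h-value rel rel′ ⟨
      δ L.* B′                       ∎))
    compare (inj₁ (k , t≡)) = inj₂ (divides k t≡ , L.*-cancelˡ δ≉0 (begin
      δ L.* B                        ≈⟨ L.trans δB≈[-δ]ᵗ (L.^-congʳ (L.- δ) t≡) ⟩
      (L.- δ) L.^ (k ℕ.* 2)          ≈⟨ L.^-neg-even δ k ⟩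
      δ L.^ (k ℕ.* 2)                ≈⟨ L.trans (L.sym (L.^-congʳ δ t≡)) (L.sym (L.-‿involutive _)) ⟩
      L.- (L.- (δ L.^ t))            ≈⟨ L.-‿cong (h-value rel rel′) ⟨
      L.- (δ L.* B′)                 ≈⟨ L.-‿distribʳ-* δ B′ ⟩
      δ L.* (L.- B′)                 ∎))

  -- For even t four divides n = p m. If p = 2, one factor 2 is left for m; if p is odd, both belong
  -- to m. An m-th power then ignores the sign left over by `h-values`.
  even-cofactor : ∀ {p m} → 2 ∣ℕ t → Prime p → n ≡ p ℕ.* m → ∃ λ k → m ≡ k ℕ.* 2
  even-cofactor {p} {m} 2∣t p-prime n≡pm with parity p | four 2∣t
  ... | inj₁ (k , p≡2k) | divides w n≡4w = w , ℕₚ.*-cancelˡ-≡ m (w ℕ.* 2) 2 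
    (≡.trans (≡.cong (ℕ._* m) (≡.sym p≡2)) (≡.trans (≡.sym n≡pm) (≡.trans n≡4w (regroup w))))
    where
    regroup : ∀ w → w ℕ.* 4 ≡ 2 ℕ.* (w ℕ.* 2)
    regroup = solve-∀
    p≡2 : p ≡ 2
    p≡2 with prime⇒irreducible p-prime (divides k p≡2k)
    ... | inj₂ 2≡p = ≡.sym 2≡p
  ... | inj₂ (k , p≡) | divides w n≡4w with euclidsLemma p m prime[2] 2∣pm
    where
    regroup : ∀ w → w ℕ.* 4 ≡ (w ℕ.* 2) ℕ.* 2
    regroup = solve-∀
    2∣pm : 2 ∣ℕ p ℕ.* m
    2∣pm = divides (w ℕ.* 2) (≡.trans (≡.sym n≡pm) (≡.trans n≡4w (regroup w)))
  ...   | inj₂ (divides l m≡) = l , m≡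
  ...   | inj₁ 2∣p = ⊥-elim (prime∤1 prime[2] (ℕ∣.∣m+n∣m⇒∣n (≡.subst (2 ∣ℕ_) (≡.trans p≡ (ℕₚ.+-comm 1 _)) 2∣p) (ℕ∣.n∣m*n k)))

  h-values-power : ∀ {p m} → Prime p → n ≡ p ℕ.* m → eval h (L.- θ) L.^ m L.≈ eval h (L.- θ′) L.^ m
  h-values-power {m = m} p-prime n≡ with h-values
  ... | inj₁ B≈B′ = L.^-congˡ m B≈B′
  ... | inj₂ (2∣t , B≈-B′) with even-cofactor 2∣t p-prime n≡
  ...   | l , ≡.refl = L.trans (L.^-congˡ (l ℕ.* 2) B≈-B′) (L.^-neg-even _ l)

  h-value≉0 : ∀ {σ τ} → Related L f h t τ → Related L f h t σ → τ L.≉ σ → eval h (L.- σ) L.≉ L.0#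
  h-value≉0 {σ} {τ} relτ relσ τ≉σ B≈0 = L.-x≉0 (L.^≉0 t (λ eq → τ≉σ (L.x-y≈0⇒x≈y _ _ eq)))
    (L.trans (L.sym (h-value relτ relσ)) (L.trans (L.*-congˡ B≈0) (L.zeroʳ _)))

  -- The two values of the transform are those of r times h(-θ′)^d and h(-θ)^d. These factors have
  -- equal m-th powers and cancel in the equation to be refuted.
  transform-nonPower : ∀ {r d} → Below r (suc d) → NonPower L θ θ′ n t r → NonPower L θ θ′ n t (H.homogenize f h d r)
  transform-nonPower {r} {d} b nonPower = record
    { numerator≉0   = λ eq → L.x*y≉0 (L.^≉0 d B′≉0) numerator≉0 (L.trans (L.sym (transform-value r rel′ b)) eq)
    ; denominator≉0 = λ eq → L.x*y≉0 (L.^≉0 d (h-value≉0 rel′ rel (λ eq → θ≉θ′ (L.sym eq)))) denominator≉0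
        (L.trans (L.sym (transform-value r rel b)) eq)
    ; separated     = λ p m p-prime p∣t n≡ eq → separated p m p-prime p∣t n≡
        (L.*-cancelˡ (L.^≉0 m (L.^≉0 d B′≉0)) (begin
          (B′ L.^ d) L.^ m L.* x L.^ m                       ≈⟨ L.^-distrib-* (B′ L.^ d) x m ⟨
          (B′ L.^ d L.* x) L.^ m                             ≈⟨ L.^-congˡ m (transform-value r rel′ b) ⟨
          eval (H.homogenize f h d r) (L.- θ′) L.^ m         ≈⟨ eq ⟩
          eval (H.homogenize f h d r) (L.- θ) L.^ m          ≈⟨ L.^-congˡ m (transform-value r rel b) ⟩
          (B L.^ d L.* y) L.^ m                              ≈⟨ L.^-distrib-* (B L.^ d) y m ⟩
          (B L.^ d) L.^ m L.* y L.^ m                        ≈⟨ L.*-congʳ (powers m (h-values-power p-prime n≡)) ⟩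
          (B′ L.^ d) L.^ m L.* y L.^ m                       ∎)) }
    where
    open NonPower nonPower
    x = eval r (L.- θ′)
    y = eval r (L.- θ)
    B = eval h (L.- θ)
    B′ = eval h (L.- θ′)

    B′≉0 : B′ L.≉ L.0#
    B′≉0 = h-value≉0 rel rel′ θ≉θ′

    powers : ∀ m → B L.^ m L.≈ B′ L.^ m → (B L.^ d) L.^ m L.≈ (B′ L.^ d) L.^ m
    powers m eq = begin
      (B L.^ d) L.^ m     ≈⟨ L.trans (L.^-assocʳ B d m) (L.^-congʳ B (ℕₚ.*-comm d m)) ⟩
      B L.^ (m ℕ.* d)     ≈⟨ L.^-assocʳ B m d ⟨
      (B L.^ m) L.^ d     ≈⟨ L.^-congˡ d eq ⟩
      (B′ L.^ m) L.^ d    ≈⟨ L.^-assocʳ B′ m d ⟩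
      B′ L.^ (m ℕ.* d)    ≈⟨ L.trans (L.^-assocʳ B′ d m) (L.^-congʳ B′ (ℕₚ.*-comm d m)) ⟨
      (B′ L.^ d) L.^ m    ∎

-- The transform reads its exponent off `deg`, while `homogenize` is given it; a proof of `HasDeg`
-- identifies the two.
^Q-homogenize : ∀ {a ℓ₁ ℓ₂ s} (L : FiniteField a ℓ₁ ℓ₂ s) q t θ {p d} → PolynomialDivision.HasDeg L p d →
  let open Transform L q t θ in p ^Q ≡ HomogeneousSubstitution.homogenize L f h d p
^Q-homogenize L q t θ {p} hp = ≡.cong (λ d → homogenize f h d p) (PolynomialDivision.deg≡ L hp)
  where
  open Transform L q t θ
  open HomogeneousSubstitution L

-- The coefficients of f and h lie in `K`.

module ConjugatePair {a ℓ₁ ℓ₂ b ℓ₃ ℓ₄ q S} (K : FiniteField a ℓ₁ ℓ₂ q) (L : FiniteField b ℓ₃ ℓ₄ S)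
  (ι : FiniteField.Carrier K → FiniteField.Carrier L)
  (ι-homomorphism : RingMorphisms.IsRingHomomorphism (FiniteField.rawRing K) (FiniteField.rawRing L) ι)
  (c : FiniteField.Carrier K) where
  private
    module K = FieldProperties K
    module L = FieldProperties L
    module K[x] where
      open PolynomialRing K public
      open PolynomialDivision K public
      open Evaluation K public
      open HomogeneousSubstitution K public
    module L[x] where
      open PolynomialRing L public
      open PolynomialDivision L public
      open Evaluation L public
  open Embedding K L ι ι-homomorphism
  open L[x] using (_≋_; ⟪_⟫; module P)

  -- (x + τ)^k = first k + τ second k for both roots τ of x² - x - c
  first second : ℕ → K[x].Poly
  first zero     = K.1# ∷ []
  first (suc k)  = c K[x].· second k K[x].+ (K.0# ∷ first k)
  second zero    = []
  second (suc k) = first k K[x].+ ((K.0# ∷ second k) K[x].+ second k)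

  shift-below : ∀ {p n} → K[x].Below p n → K[x].Below (K.0# ∷ p) (suc n)
  shift-below b (suc i) (s≤s n≤i) = b i n≤i

  +-below : ∀ {p r n} → K[x].Below p n → K[x].Below r n → K[x].Below (p K[x].+ r) n
  +-below {p} {r} bp br i n≤i = K.trans (K[x].coeff-+ p r i) (K.trans (K.+-cong (bp i n≤i) (br i n≤i)) (K.+-identityˡ _))

  -- Each sequence enters the recursion of the other, so the two bounds are proved together. They
  -- become deg f = t and deg h < t.
  first-hasDeg : ∀ k → K[x].HasDeg (first k) k
  second-below : ∀ k → K[x].Below (second k) k
  first-hasDeg zero    = K[x].hasDeg-1
  first-hasDeg (suc k) = K[x].hasDeg-+ {c K[x].· second k}
    (λ i k<i → K.trans (K[x].coeff-· c (second k) i) (K.trans (K.*-congˡ (second-below k i (ℕₚ.<⇒≤ k<i))) (K.zeroʳ c)))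
    record { lead = K[x].lead (first-hasDeg k) ; below = shift-below {first k} (K[x].below (first-hasDeg k)) }
  second-below zero    i _ = K.refl
  second-below (suc k) = +-below {first k} (K[x].below (first-hasDeg k))
    (+-below {K.0# ∷ second k} {second k} (shift-below {second k} (second-below k)) (λ i k<i → second-below k i (ℕₚ.<⇒≤ k<i)))

  private
    const : L.Carrier → L[x].Poly
    const x = x ∷ []

    X : L[x].Poly
    X = L.0# ∷ L.1# ∷ []

    const-* : ∀ x p → const x L[x].* p ≋ x L[x].· p
    const-* x p = P.trans (P.+-congˡ {x L[x].· p} ⟪ (λ { zero → L.refl ; (suc i) → L.refl }) ⟫) (P.+-identityʳ (x L[x].· p))

    X-* : ∀ p → X L[x].* p ≋ L.0# ∷ p
    X-* p = ⟪ (λ i → L.trans (L[x].shift-* (L.1# ∷ []) p i) (L[x].∷-cong L.refl (L[x].*-identityˡ p) i)) ⟫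

    X+const : ∀ τ → L[x].x+ τ ≋ X L[x].+ const τ
    X+const τ = ⟪ (λ { zero → L.sym (L.+-identityˡ τ) ; (suc i) → L.refl }) ⟫

    const-cong : ∀ {x y} → x L.≈ y → const x ≋ const y
    const-cong x≈y = ⟪ L[x].∷-cong x≈y (λ i → L.refl) ⟫

    const-product : ∀ x y → const x L[x].* const y ≋ const (x L.* y)
    const-product x y = const-* x (const y)

    A B : ℕ → L[x].Poly
    A k = map ι (first k)
    B k = map ι (second k)

    map-shift : ∀ p → map ι (K.0# ∷ p) ≋ X L[x].* map ι p
    map-shift p = P.trans ⟪ L[x].∷-cong 0#-homo (λ i → L.refl) ⟫ (P.sym (X-* (map ι p)))

  module _ {τ : L.Carrier} (τ-root : τ L.* τ L.≈ τ L.+ ι c) where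

    -- Using τ² = τ + c, the product (X + τ)(A + τB) equals (cB + XA) + τ(A + XB + B), which is the
    -- recursion of `first` and `second`.
    x+^-split : ∀ k → (L[x].x+ τ) L[x].^ k ≋ A k L[x].+ const τ L[x].* B k
    x+^-split zero = P.sym (P.trans (P.+-cong map-1 (P.trans (P.*-comm (const τ) []) (P.zeroˡ (const τ)))) (P.+-identityʳ (L.1# ∷ [])))
    x+^-split (suc k) = begin
      (L[x].x+ τ) L[x].* (L[x].x+ τ) L[x].^ k
        ≈⟨ P.*-cong (X+const τ) (x+^-split k) ⟩
      (X L[x].+ T) L[x].* (A k L[x].+ T L[x].* B k)
        ≈⟨ solve 4 (λ X T A B → (X :+ T) :* (A :+ T :* B) := (T :* T) :* B :+ (X :* A :+ T :* (A :+ X :* B))) P.refl X T (A k) (B k) ⟩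
      (T L[x].* T) L[x].* B k L[x].+ (X L[x].* A k L[x].+ T L[x].* (A k L[x].+ X L[x].* B k))
        ≈⟨ P.+-congʳ {X L[x].* A k L[x].+ T L[x].* (A k L[x].+ X L[x].* B k)} (P.*-congʳ {B k} TT) ⟩
      (T L[x].+ const (ι c)) L[x].* B k L[x].+ (X L[x].* A k L[x].+ T L[x].* (A k L[x].+ X L[x].* B k))
        ≈⟨ solve 5 (λ X T A B C → (T :+ C) :* B :+ (X :* A :+ T :* (A :+ X :* B)) := (C :* B :+ X :* A) :+ T :* (A :+ (X :* B :+ B))) P.refl X T (A k) (B k) (const (ι c)) ⟩
      (const (ι c) L[x].* B k L[x].+ X L[x].* A k) L[x].+ T L[x].* (A k L[x].+ (X L[x].* B k L[x].+ B k))
        ≈⟨ P.+-cong A-suc (P.*-congˡ {T} B-suc) ⟨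
      A (suc k) L[x].+ T L[x].* B (suc k) ∎
      where
      open import Relation.Binary.Reasoning.Setoid P.setoid
      open IntegerCoefficients L[x].polynomialRing using (solve; _:+_; _:*_; _:=_)
      T = const τ

      TT : T L[x].* T ≋ T L[x].+ const (ι c)
      TT = P.trans (const-product τ τ) (const-cong τ-root)

      A-suc : A (suc k) ≋ const (ι c) L[x].* B k L[x].+ X L[x].* A k
      A-suc = P.trans (map-+ (c K[x].· second k) (K.0# ∷ first k))
        (P.+-cong (P.trans (map-· c (second k)) (P.sym (const-* (ι c) (B k)))) (map-shift (first k)))

      B-suc : B (suc k) ≋ A k L[x].+ (X L[x].* B k L[x].+ B k)
      B-suc = P.trans (map-+ (first k) _) (P.+-congˡ {A k}
        (P.trans (map-+ (K.0# ∷ second k) (second k)) (P.+-congʳ {B k} (map-shift (second k)))))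

  module Coefficients (θ : L.Carrier) (θ≉θ^q : θ L.≉ θ L.^ q)
    (θ-root : θ L.* θ L.≈ θ L.+ ι c) (θ^q-root : (θ L.^ q) L.* (θ L.^ q) L.≈ θ L.^ q L.+ ι c) (k : ℕ) where

    open Transform L q k θ using (f; h) renaming (θ^q to θ′)

    private
      open import Relation.Binary.Reasoning.Setoid P.setoid
      open IntegerCoefficients L[x].polynomialRing using (solve; _:+_; _:*_; _:-_; :-_; _:=_)
      D T T′ : L[x].Poly
      D = const ((θ′ L.- θ) L.⁻¹)
      T = const θ
      T′ = const θ′

      D-inverse : D L[x].* (T′ L[x].- T) ≋ L.1# ∷ []
      D-inverse = P.trans (const-product _ (θ′ L.- θ))
        (const-cong (L.inverseˡ (λ eq → θ≉θ^q (L.sym (L.x-y≈0⇒x≈y _ _ eq)))))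

    -- In θ(A + θ′B) - θ′(A + θB) the terms with B cancel, leaving -(θ′ - θ)A; the factor θ′ - θ
    -- cancels against the denominator. For h it is A that cancels.
    f≋ : f ≋ L[x].- A k
    f≋ = begin
      f ≈⟨ const-* _ _ ⟨
      D L[x].* (θ L[x].· (L[x].x+ θ′) L[x].^ k L[x].- θ′ L[x].· (L[x].x+ θ) L[x].^ k)
        ≈⟨ P.*-congˡ {D} (P.+-cong
          (P.trans (P.sym (const-* θ ((L[x].x+ θ′) L[x].^ k))) (P.*-congˡ {T} (x+^-split θ^q-root k)))
          (P.-‿cong (P.trans (P.sym (const-* θ′ ((L[x].x+ θ) L[x].^ k))) (P.*-congˡ {T′} (x+^-split θ-root k))))) ⟩
      D L[x].* (T L[x].* (A k L[x].+ T′ L[x].* B k) L[x].- T′ L[x].* (A k L[x].+ T L[x].* B k))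
        ≈⟨ solve 5 (λ D T T′ A B → D :* (T :* (A :+ T′ :* B) :- T′ :* (A :+ T :* B)) := :- ((D :* (T′ :- T)) :* A)) P.refl D T T′ (A k) (B k) ⟩
      L[x].- ((D L[x].* (T′ L[x].- T)) L[x].* A k)
        ≈⟨ P.-‿cong (P.trans (P.*-congʳ {A k} D-inverse) (P.*-identityˡ (A k))) ⟩
      L[x].- A k ∎

    h≋ : h ≋ L[x].- B k
    h≋ = begin
      h ≈⟨ const-* _ _ ⟨
      D L[x].* ((L[x].x+ θ) L[x].^ k L[x].- (L[x].x+ θ′) L[x].^ k)
        ≈⟨ P.*-congˡ {D} (P.+-cong (x+^-split θ-root k) (P.-‿cong (x+^-split θ^q-root k))) ⟩
      D L[x].* ((A k L[x].+ T L[x].* B k) L[x].- (A k L[x].+ T′ L[x].* B k))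
        ≈⟨ solve 5 (λ D T T′ A B → D :* ((A :+ T :* B) :- (A :+ T′ :* B)) := :- ((D :* (T′ :- T)) :* B)) P.refl D T T′ (A k) (B k) ⟩
      L[x].- ((D L[x].* (T′ L[x].- T)) L[x].* B k)
        ≈⟨ P.-‿cong (P.trans (P.*-congʳ {B k} D-inverse) (P.*-identityˡ (B k))) ⟩
      L[x].- B k ∎

    f₀ h₀ : K[x].Poly
    f₀ = K[x].- first k
    h₀ = K[x].- second k

    map-f₀ : map ι f₀ ≋ f
    map-f₀ = P.trans (map-neg (first k)) (P.sym f≋)

    map-h₀ : map ι h₀ ≋ h
    map-h₀ = P.trans (map-neg (second k)) (P.sym h≋)

    f₀-hasDeg : K[x].HasDeg f₀ k
    f₀-hasDeg = record
      { lead  = λ eq → K.-x≉0 (K[x].lead (first-hasDeg k)) (K.trans (K.sym (K[x].coeff-neg (first k) k)) eq)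
      ; below = λ i k<i → K.trans (K[x].coeff-neg (first k) i) (K.trans (K.-‿cong (K[x].below (first-hasDeg k) i k<i)) K.-0#≈0#) }

    h₀-below : K[x].Below h₀ k
    h₀-below i k≤i = K.trans (K[x].coeff-neg (second k) i) (K.trans (K.-‿cong (second-below k i k≤i)) K.-0#≈0#)

    f-hasDeg : L[x].HasDeg f k
    f-hasDeg = L[x].hasDeg-cong map-f₀ (map-hasDeg f₀-hasDeg)

    h-below : L[x].Below h k
    h-below i k≤i = L.trans (L.sym (L[x].at map-h₀ i)) (L.trans (map-coeff h₀ i) (L.trans (j-cong (h₀-below i k≤i)) 0#-homo))

    related : ∀ {τ} → τ L.* τ L.≈ τ L.+ ι c → f L[x].+ τ L[x].· h ≋ L[x].- ((L[x].x+ τ) L[x].^ k)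
    related {τ} τ-root = begin
      f L[x].+ τ L[x].· h                                 ≈⟨ P.+-cong f≋ (P.trans (P.sym (const-* τ h)) (P.*-congˡ {const τ} h≋)) ⟩
      (L[x].- A k) L[x].+ const τ L[x].* (L[x].- B k)     ≈⟨ solve 3 (λ A T B → (:- A) :+ T :* (:- B) := :- (A :+ T :* B)) P.refl (A k) (const τ) (B k) ⟩
      L[x].- (A k L[x].+ const τ L[x].* B k)              ≈⟨ P.-‿cong (x+^-split τ-root k) ⟨
      L[x].- ((L[x].x+ τ) L[x].^ k)                       ∎

    -- One transform over `L` is the image of the same substitution carried out over `K` with f₀ and
    -- h₀.
    map-step : ∀ {p₀ p N} → K[x].HasDeg p₀ N → map ι p₀ ≋ p →
      map ι (K[x].homogenize f₀ h₀ N p₀) ≋ Transform._^Q L q k θ p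
    map-step {p₀} {p} {N} hp₀ eq = P.trans
      (HomogeneousEvaluation.map-homogenize K L ι ι-homomorphism f₀ h₀ N p₀)
      (P.trans (HomogeneousSubstitution.homogenize-cong L {map ι f₀} {f} {map ι h₀} {h} map-f₀ map-h₀ N (map ι p₀) p eq)
        (P.reflexive (≡.sym (^Q-homogenize L q k θ (L[x].hasDeg-cong eq (map-hasDeg hp₀))))))

-- If q² - 1 is even, q is odd, and an odd square is 1 modulo 4.
square-minus-one : ∀ {q n} → q ℕ.^ 2 ≡ suc n → 2 ∣ℕ n → 4 ∣ℕ n
square-minus-one {q} {n} q²≡ 2∣n with parity q
... | inj₁ (w , ≡.refl) = ⊥-elim (prime∤1 prime[2] (ℕ∣.∣m+n∣m⇒∣n
  (≡.subst (2 ∣ℕ_) (≡.trans q²≡ (ℕₚ.+-comm 1 n)) (divides (w ℕ.* (w ℕ.* 2)) (even w))) 2∣n))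
  where
  even : ∀ w → (w ℕ.* 2) ℕ.* (w ℕ.* 2 ℕ.* 1) ≡ w ℕ.* (w ℕ.* 2) ℕ.* 2
  even = solve-∀
... | inj₂ (w , ≡.refl) = divides (w ℕ.+ w ℕ.* w) (ℕₚ.suc-injective (≡.trans (≡.sym q²≡) (odd w)))
  where
  odd : ∀ w → suc (w ℕ.* 2) ℕ.* (suc (w ℕ.* 2) ℕ.* 1) ≡ suc ((w ℕ.+ w ℕ.* w) ℕ.* 4)
  odd = solve-∀

-- The quadratic extension `L` of `K`.

module _ {a ℓ₁ ℓ₂ b ℓ₃ ℓ₄ q} (K : FiniteField a ℓ₁ ℓ₂ q) (L : FiniteField b ℓ₃ ℓ₄ (q ℕ.^ 2))
  (ι : FiniteField.Carrier K → FiniteField.Carrier L)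
  (ι-homomorphism : RingMorphisms.IsRingHomomorphism (FiniteField.rawRing K) (FiniteField.rawRing L) ι)
  where
  private
    module K = FieldProperties K
    module L = FieldProperties L
    module ι = Embedding K L ι ι-homomorphism
    module K[x] where
      open PolynomialRing K public
      open PolynomialDivision K public
      open HomogeneousSubstitution K public
    module L[x] where
      open PolynomialRing L public
      open PolynomialDivision L public
      open Evaluation L public
      open HomogeneousSubstitution L public

  module Generator {c : K.Carrier} (c-irr : K[x].Irreducible (K[x].x²-x- c)) {θ : L.Carrier}
    (root : ι.ev (K[x].x²-x- c) θ L.≈ L.0#) where
    private
      s : K[x].Poly
      s = K[x].x²-x- c

      s-hasDeg : K[x].HasDeg s 2
      s-hasDeg = record { lead = K.1≉0 ; below = λ { (suc (suc (suc i))) _ → K.refl ; (suc zero) (s≤s ()) ; (suc (suc zero)) (s≤s (s≤s ())) } }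

    conjugate : L.Carrier
    conjugate = θ L.^ q

    private
      open import Relation.Binary.Reasoning.Setoid L.setoid using (begin_; step-≈-⟩; step-≈-⟨; _∎)

      ^q¹ : ∀ x → x L.^ (q ℕ.^ 1) L.≈ x L.^ q
      ^q¹ x = L.^-congʳ x (ℕₚ.*-identityʳ q)

    conjugate-root : ι.ev s conjugate L.≈ L.0#
    conjugate-root = L.trans (ι.ev-congʳ s (L.sym (^q¹ θ))) (ι.root-frobenius 1 s root)

    -- A root of the irreducible quadratic has Frobenius period 2 over `K`, so θ^q = θ is
    -- impossible.
    θ≉conjugate : θ L.≉ conjugate
    θ≉conjugate θ≈ = MinimalPeriod.¬short-period K L ι ι-homomorphism c-irr s-hasDeg root 1 (s≤s z≤n) (s≤s (s≤s z≤n))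
      (L.trans (^q¹ θ) (L.sym θ≈))

    square : ∀ {τ} → ι.ev s τ L.≈ L.0# → τ L.* τ L.≈ τ L.+ ι c
    square {τ} τ-root = L.x-y≈0⇒x≈y _ _ (begin
      τ L.* τ L.- (τ L.+ ι c)
        ≈⟨ solve 2 (λ τ c → τ :* τ :- (τ :+ c) := (:- c) :+ τ :* ((:- con (+ 1)) :+ τ :* (con (+ 1) :+ τ :* con (+ 0)))) L.refl τ (ι c) ⟩
      (L.- ι c) L.+ τ L.* ((L.- L.1#) L.+ τ L.* (L.1# L.+ τ L.* L.0#))
        ≈⟨ L.+-cong (ι.-‿homo c) (L.*-congˡ (L.+-cong (L.trans (ι.-‿homo K.1#) (L.-‿cong ι.1#-homo)) (L.*-congˡ (L.+-congʳ ι.1#-homo)))) ⟨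
      ι.ev s τ                          ≈⟨ τ-root ⟩
      L.0#                              ∎)
      where open IntegerCoefficients L.commutativeRing using (solve; con; _:+_; _:*_; _:-_; :-_; _:=_)

  module Tower {e ℓ₅ ℓ₆ S} (M : FiniteField e ℓ₅ ℓ₆ S) (j : L.Carrier → FiniteField.Carrier M)
    (j-homomorphism : RingMorphisms.IsRingHomomorphism (FiniteField.rawRing L) (FiniteField.rawRing M) j) where
    private module M = FieldProperties M

    j∘ι-homomorphism : RingMorphisms.IsRingHomomorphism (FiniteField.rawRing K) (FiniteField.rawRing M) (j ∘ ι)
    j∘ι-homomorphism = isRingHomomorphism-∘ M.trans ι-homomorphism j-homomorphism

    private
      module M/L = Embedding L M j j-homomorphism
      module M/K = Embedding K M (j ∘ ι) j∘ι-homomorphism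

    ev-tower : ∀ p y → M/K.ev p y M.≈ M/L.ev (map ι p) y
    ev-tower p y = M.reflexive (≡.cong (λ p → Polynomial.eval M p y) (Listₚ.map-∘ {g = j} {f = ι} p))

    period-of-conjugate : ∀ {g n} → K[x].Irreducible g → K[x].HasDeg g (suc n) → ∀ {β} → M/L.ev (map ι g) β M.≈ M.0# →
      ∀ k → β M.^ (q ℕ.^ k) M.≈ β → suc n ∣ℕ k
    period-of-conjugate {g} irr hg {β} root = MinimalPeriod.period K M (j ∘ ι) j∘ι-homomorphism irr hg
      (M.trans (ev-tower g β) root)

    period-over-L : ∀ {g n} → K[x].Irreducible g → K[x].HasDeg g (suc n) → ∀ {β} → M/L.ev (map ι g) β M.≈ M.0# →
      ∀ e → β M.^ ((q ℕ.^ 2) ℕ.^ e) M.≈ β → suc n ∣ℕ 2 ℕ.* e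
    period-over-L irr hg {β} root e fixed = period-of-conjugate irr hg root (2 ℕ.* e)
      (M.trans (M.^-congʳ β (≡.sym (ℕₚ.^-*-assoc q 2 e))) fixed)

  -- A root in an extension of `L` of degree e is fixed by the power q^(2e), so deg g divides 2e
  -- and, being odd, divides e.
  odd-degree-irreducible : ∀ {g n} → K[x].Irreducible g → K[x].HasDeg g (suc n) → ¬ 2 ∣ℕ suc n →
    L[x].Irreducible (map ι g)
  odd-degree-irreducible {g} {n} irr hg odd = irreducible-by-roots L (ι.map-hasDeg hg)
    λ {e = e} X root → ℕₚ.≤-pred (ℕ∣.∣⇒≤ (coprime-divisor (Coprimality.sym 2-coprime)
      (Tower.period-over-L (RootExtension.field′ X) (RootExtension.j X) (RootExtension.homomorphism X) irr hg root (suc e)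
        (FieldProperties.fermat (RootExtension.field′ X) (RootExtension.β X)))))
    where
    only-2 : ∀ {p} → Prime p → p ∣ℕ suc n → p ≡ 1 ⊎ p ≡ 2 → ⊥
    only-2 p-prime p∣n (inj₁ ≡.refl) = ¬prime[1] p-prime
    only-2 p-prime p∣n (inj₂ ≡.refl) = odd p∣n

    2-coprime : Coprime 2 (suc n)
    2-coprime = no-common-prime⇒coprime (λ ()) λ p p-prime p∣2 p∣n → only-2 p-prime p∣n (irreducible[2] p∣2)

  -- The root adjoined for r is fixed by the power q^(2 deg r) and is also a root of g. For even
  -- degree of g this bounds deg r below by one half of it, in the divisibility form that the
  -- descent uses.
  factor-degree : ∀ {g n r d} → K[x].Irreducible g → K[x].HasDeg g (suc n) → L[x].Irreducible r →
    L[x].HasDeg r (suc d) → L[x].Divides r (map ι g) → suc n ∣ℕ 2 ℕ.* suc d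
  factor-degree {g} {r = r} {d} g-irr hg r-irr hr r∣ιg =
    Tower.period-over-L X.field′ X.j X.homomorphism g-irr hg
      (Roots.ev-multiple L X.field′ X.j X.homomorphism {r} {map ι g} r∣ιg X.root) (suc d) (E.fermat X.β)
    where
    X-extension : RootExtension L r (suc d)
    X-extension = adjoinRoot L r-irr hr
    module X = RootExtension X-extension
    module E = FieldProperties X.field′

-- Descent from `L` to `K`.

module Period⇒Irreducible {a ℓ₁ ℓ₂ b ℓ₃ ℓ₄ q S} (K : FiniteField a ℓ₁ ℓ₂ q) (M : FiniteField b ℓ₃ ℓ₄ S)
  (j : FiniteField.Carrier K → FiniteField.Carrier M)
  (j-homomorphism : RingMorphisms.IsRingHomomorphism (FiniteField.rawRing K) (FiniteField.rawRing M) j) where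
  private module M = FieldProperties M
  open PolynomialRing K
  open PolynomialDivision K
  open Embedding K M j j-homomorphism

  root-splits : ∀ {β p x y} → ev p β M.≈ M.0# → p ≋ x * y → ev x β M.≈ M.0# ⊎ ev y β M.≈ M.0#
  root-splits {β} {p} {x} {y} p-root p≋xy with ev x β M.≟ M.0#
  ... | yes x-root = inj₁ x-root
  ... | no x≉0 = inj₂ (M.x*y≈0⇒y≈0 x≉0 (M.trans (M.sym (ev-* x y β))
    (M.trans (M.sym (ev-cong {p} {x * y} p≋xy)) p-root)))

  -- In a proper factorisation one factor has the root β, hence an irreducible divisor with root β.
  -- Its degree would be a period of β smaller than N + 1.
  period⇒irreducible : ∀ {β p N} → HasDeg p (suc N) → ev p β M.≈ M.0# →
    (∀ k → β M.^ (q ℕ.^ k) M.≈ β → suc N ∣ℕ k) → Irreducible p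
  period⇒irreducible {β} {p} {N} hp p-root period = irreducible-intro hp ¬split
    where
    large : ∀ {x i} → HasDeg x (suc i) → ev x β M.≈ M.0# → i ℕ.< N → ⊥
    large hx x-root i<N = irreducible-factor (λ p → ev p β M.≈ M.0#) (λ {p} {x} {y} → root-splits {β} {p} {x} {y}) x-root hx
      λ (s , e , s-irr , hs , s-root , e≤i) → ℕₚ.<⇒≱ (s≤s (ℕₚ.≤-<-trans e≤i i<N))
        (ℕ∣.∣⇒≤ (period (suc e) (MinimalPeriod.fixed K M j j-homomorphism s-irr hs s-root)))

    ¬split : ∀ {x y i k} → p ≋ x * y → HasDeg x (suc i) → HasDeg y (suc k) → i ℕ.+ suc k ≡ N → ⊥
    ¬split {x} {y} {i} {k} p≋xy hx hy eq with root-splits {β} {p} {x} {y} p-root p≋xy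
    ... | inj₁ x-root = large hx x-root (≡.subst (i ℕ.<_) eq (ℕₚ.m<m+n i (s≤s z≤n)))
    ... | inj₂ y-root = large hy y-root (≡.subst (k ℕ.<_) eq (ℕₚ.m≤n+m (suc k) i))

-- The invariant of the iteration over `L`; `N≡` records that the degree is positive.
record IrreducibleNonPower {a ℓ₁ ℓ₂ Q} (L : FiniteField a ℓ₁ ℓ₂ Q) (D : TransformData L)
  (p : Polynomial.Poly L) (N : ℕ) : Set (a ⊔ ℓ₁) where
  open TransformData D
  field
    d           : ℕ
    N≡          : N ≡ suc d
    irreducible : Polynomial.Irreducible L p
    hasDeg      : PolynomialDivision.HasDeg L p (suc d)
    nonPower    : NonPower L θ θ′ n t p

iterate-irreducibleNonPower : ∀ {a ℓ₁ ℓ₂ Q} (L : FiniteField a ℓ₁ ℓ₂ Q) (D : TransformData L) {p d} →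
  IrreducibleNonPower L D p d → ∀ m → let open TransformData D in
  IrreducibleNonPower L D (HomogeneousSubstitution.iterate L f h t d p m) (d ℕ.* t ℕ.^ m)
iterate-irreducibleNonPower L D {p} {d} P zero = ≡.subst (IrreducibleNonPower L D p) (≡.sym (ℕₚ.*-identityʳ d)) P
iterate-irreducibleNonPower L D {p} {d} P (suc m) =
  ≡.subst (IrreducibleNonPower L D (iterate f h t d p (suc m))) (iterate-degree d t m)
    (step (iterate-irreducibleNonPower L D P m))
  where
  open TransformData D
  open TransformIrreducible L D
  open HomogeneousSubstitution L using (iterate; iterate-degree; homogenize)

  step : ∀ {p N} → IrreducibleNonPower L D p N → IrreducibleNonPower L D (homogenize f h N p) (N ℕ.* t)
  step record { N≡ = ≡.refl ; irreducible = irr ; hasDeg = hp ; nonPower = nonPower } = record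
    { N≡          = ≡.refl
    ; irreducible = transform-irreducible irr hp nonPower
    ; hasDeg      = transform-hasDeg hp
    ; nonPower    = transform-nonPower (PolynomialDivision.below hp) nonPower }

-- The coefficients of f and h lie in K.
record Rational {a ℓ₁ ℓ₂ b ℓ₃ ℓ₄ q Q} (K : FiniteField a ℓ₁ ℓ₂ q) (L : FiniteField b ℓ₃ ℓ₄ Q)
  (ι : FiniteField.Carrier K → FiniteField.Carrier L) (D : TransformData L) : Set (a ⊔ ℓ₁ ⊔ ℓ₃) where
  open TransformData D
  open PolynomialRing L using (_≋_)
  field
    f₀ h₀    : Polynomial.Poly K
    map-f₀   : map ι f₀ ≋ f
    map-h₀   : map ι h₀ ≋ h
    f₀-deg   : PolynomialDivision.HasDeg K f₀ t
    h₀-below : PolynomialDivision.Below K h₀ t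

module Descent {a ℓ₁ ℓ₂ b ℓ₃ ℓ₄ e ℓ₅ ℓ₆ q S} (K : FiniteField a ℓ₁ ℓ₂ q) (L : FiniteField b ℓ₃ ℓ₄ (q ℕ.^ 2))
  (ι : FiniteField.Carrier K → FiniteField.Carrier L)
  (ι-homomorphism : RingMorphisms.IsRingHomomorphism (FiniteField.rawRing K) (FiniteField.rawRing L) ι)
  (D : TransformData L) (R : Rational K L ι D)
  (M : FiniteField e ℓ₅ ℓ₆ S) (j : FiniteField.Carrier L → FiniteField.Carrier M)
  (j-homomorphism : RingMorphisms.IsRingHomomorphism (FiniteField.rawRing L) (FiniteField.rawRing M) j) where
  private
    module M = FieldProperties M
    module K[x] where
      open PolynomialDivision K public using (HasDeg; Below; below)
      open HomogeneousSubstitution K public using (homogenize; iterate; iterate-hasDeg)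
    module L[x] where
      open PolynomialRing L public using (_≋_; Irreducible)
      open PolynomialDivision L public using (HasDeg; Divides)
      open HomogeneousSubstitution L public using (homogenize; iterate)
  open TransformData D using (f; h; t)
  open Rational R
  open Tower K L ι ι-homomorphism M j j-homomorphism
  private
    module M/L = Embedding L M j j-homomorphism
    module M/K = Embedding K M (j ∘ ι) j∘ι-homomorphism
  open Fibre L D M j j-homomorphism
  open import Relation.Binary.Reasoning.Setoid M.setoid using (begin_; step-≈-⟩; step-≈-⟨; _∎)

  -- The number n remains the degree of g at every stage; the growth by t^m is contributed
  -- separately by the degree of β over `L`.
  Descends : Polynomial.Poly K → ℕ → M.Carrier → Set ℓ₅
  Descends p₀ n β = M/K.ev p₀ β M.≈ M.0# × (∀ k → β M.^ (q ℕ.^ k) M.≈ β → n ∣ℕ k)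

  ev-lower : ∀ {p₀ p} → map ι p₀ L[x].≋ p → ∀ y → M/K.ev p₀ y M.≈ M/L.ev p y
  ev-lower {p₀} {p} eq y = M.trans (ev-tower p₀ y) (M/L.ev-cong {map ι p₀} {p} eq)

  rational-fixed : ∀ {p₀ p} → map ι p₀ L[x].≋ p → ∀ k {β} → β M.^ (q ℕ.^ k) M.≈ β →
    M/L.ev p β M.^ (q ℕ.^ k) M.≈ M/L.ev p β
  rational-fixed {p₀} {p} eq k {β} fixed = begin
    M/L.ev p β M.^ (q ℕ.^ k)     ≈⟨ M.^-congˡ (q ℕ.^ k) (ev-lower {p₀} {p} eq β) ⟨
    M/K.ev p₀ β M.^ (q ℕ.^ k)    ≈⟨ M/K.ev-frobenius k p₀ β ⟨
    M/K.ev p₀ (β M.^ (q ℕ.^ k))  ≈⟨ M/K.ev-congʳ p₀ fixed ⟩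
    M/K.ev p₀ β                  ≈⟨ ev-lower {p₀} {p} eq β ⟩
    M/L.ev p β                   ∎

  -- As f and h have coefficients in `K`, any q^k-th power map that fixes β fixes f(β), h(β) and
  -- their quotient α, to which the induction hypothesis applies.
  descend-step : ∀ {p₀ N p d n} → K[x].HasDeg p₀ N → L[x].HasDeg p d →
    (∀ {α} → M/L.ev p α M.≈ M.0# → Descends p₀ n α) →
    ∀ {β} → M/L.ev (L[x].homogenize f h d p) β M.≈ M.0# → Descends (K[x].homogenize f₀ h₀ N p₀) n β
  descend-step {p₀} {N} hp₀ hp ih {β} root =
    M.trans (HomogeneousEvaluation.ev-homogenize K M (j ∘ ι) j∘ι-homomorphism f₀ h₀ ratio N p₀ (K[x].below hp₀))
      (M.trans (M.*-congˡ (proj₁ α-descends)) (M.zeroʳ _))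
    , λ k fixed → proj₂ α-descends k (M.quotient-fixed {n = q ℕ.^ k} (h≉0 hp root) (image-ratio hp root)
        (rational-fixed {h₀} {h} map-h₀ k fixed) (rational-fixed {f₀} {f} map-f₀ k fixed))
    where
    α-descends : Descends p₀ _ (image hp root)
    α-descends = ih (image-root hp root)

    ratio : M/K.ev f₀ β M.≈ image hp root M.* M/K.ev h₀ β
    ratio = begin
      M/K.ev f₀ β                       ≈⟨ ev-lower {f₀} {f} map-f₀ β ⟩
      M/L.ev f β                        ≈⟨ image-ratio hp root ⟩
      image hp root M.* M/L.ev h β      ≈⟨ M.*-congˡ (ev-lower {h₀} {h} map-h₀ β) ⟨
      image hp root M.* M/K.ev h₀ β     ∎

  descends : ∀ {g n r d} → Polynomial.Irreducible K g → K[x].HasDeg g (suc n) → L[x].Divides r (map ι g) →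
    IrreducibleNonPower L D r d → ∀ m {β} → M/L.ev (L[x].iterate f h t d r m) β M.≈ M.0# →
    Descends (K[x].iterate f₀ h₀ t (suc n) g m) (suc n) β
  descends {g} {n} {r} g-irr hg r∣ιg P zero {β} root = M.trans (ev-tower g β) ιg-root , period-of-conjugate g-irr hg ιg-root
    where
    ιg-root : M/L.ev (map ι g) β M.≈ M.0#
    ιg-root = Roots.ev-multiple L M j j-homomorphism {r} {map ι g} r∣ιg root
  descends {g} {n} {r} {d} g-irr hg r∣ιg P (suc m) root =
    descend-step (K[x].iterate-hasDeg f₀-deg h₀-below hg m)
      (≡.subst (L[x].HasDeg (L[x].iterate f h t d r m)) (≡.sym N≡) hasDeg) (descends g-irr hg r∣ιg P m) root
    where open IrreducibleNonPower (iterate-irreducibleNonPower L D P m) using (N≡; hasDeg)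

  -- Here d₀ T is the degree of β over `L`. If d₀ = n, then β is also fixed by the power Q^k =
  -- q^(2k), so n T divides k. If n is even, so is k = 2l; then Q^l = q^k gives d₀ T ∣ l, and n ∣ 2
  -- d₀ yields n T ∣ 2 d₀ T ∣ k.
  large-period : ∀ {p d n d₀ T β} → L[x].Irreducible p → L[x].HasDeg p (suc d) → M/L.ev p β M.≈ M.0# →
    d₀ ℕ.* T ≡ suc d → d₀ ≡ n ⊎ (2 ∣ℕ n × n ∣ℕ 2 ℕ.* d₀) →
    (∀ k → β M.^ (q ℕ.^ k) M.≈ β → n ∣ℕ k) → ∀ k → β M.^ (q ℕ.^ k) M.≈ β → n ℕ.* T ∣ℕ k
  large-period {d = d} {n} {d₀} {T} {β} irr hp root d₀T≡ degrees period k fixed = cases degrees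
    where
    over-L : ∀ l → β M.^ ((q ℕ.^ 2) ℕ.^ l) M.≈ β → d₀ ℕ.* T ∣ℕ l
    over-L l fixed = ≡.subst (_∣ℕ l) (≡.sym d₀T≡) (MinimalPeriod.period L M j j-homomorphism irr hp root l fixed)

    half : ∀ l → k ≡ 2 ℕ.* l → n ∣ℕ 2 ℕ.* d₀ → n ℕ.* T ∣ℕ k
    half l k≡ n∣2d₀ = ≡.subst (n ℕ.* T ∣ℕ_) (≡.sym k≡) (ℕ∣.∣-trans (ℕ∣.*-monoˡ-∣ T n∣2d₀)
      (≡.subst (_∣ℕ 2 ℕ.* l) (≡.sym (ℕₚ.*-assoc 2 d₀ T)) (ℕ∣.*-monoʳ-∣ 2 (over-L l
        (M.trans (M.^-congʳ β (≡.trans (ℕₚ.^-*-assoc q 2 l) (≡.cong (q ℕ.^_) (≡.sym k≡)))) fixed)))))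

    cases : d₀ ≡ n ⊎ (2 ∣ℕ n × n ∣ℕ 2 ℕ.* d₀) → n ℕ.* T ∣ℕ k
    cases (inj₁ ≡.refl) = over-L k (M.trans (M.^-congʳ β (ℕₚ.^-*-assoc q 2 k))
      (Period.fixed-multiple K M (j ∘ ι) j∘ι-homomorphism k 2 fixed))
    cases (inj₂ (2∣n , n∣2d₀)) with ℕ∣.∣-trans 2∣n (period k fixed)
    ... | divides l k≡ = half l (≡.trans k≡ (ℕₚ.*-comm l 2)) n∣2d₀

iterate-irreducible : ∀ {a ℓ₁ ℓ₂ b ℓ₃ ℓ₄ q} (K : FiniteField a ℓ₁ ℓ₂ q) (L : FiniteField b ℓ₃ ℓ₄ (q ℕ.^ 2))
  (ι : FiniteField.Carrier K → FiniteField.Carrier L)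
  (ι-homomorphism : RingMorphisms.IsRingHomomorphism (FiniteField.rawRing K) (FiniteField.rawRing L) ι)
  (D : TransformData L) (R : Rational K L ι D) {g n r d₀} →
  Polynomial.Irreducible K g → PolynomialDivision.HasDeg K g (suc n) →
  PolynomialDivision.Divides L r (map ι g) → IrreducibleNonPower L D r d₀ →
  d₀ ≡ suc n ⊎ (2 ∣ℕ suc n × suc n ∣ℕ 2 ℕ.* d₀) →
  ∀ m → let open TransformData D using (t); open Rational R in
  Polynomial.Irreducible K (HomogeneousSubstitution.iterate K f₀ h₀ t (suc n) g m)
iterate-irreducible K L ι ι-homomorphism D R {g} {n} {r} {d₀} g-irr hg r∣ιg P degrees m =
  Period⇒Irreducible.period⇒irreducible K X.field′ (X.j ∘ ι) j∘ι-homomorphism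
    (≡.subst (PolynomialDivision.HasDeg K (iterate f₀ h₀ t (suc n) g m)) N≡suc (iterate-hasDeg f₀-deg h₀-below hg m))
    (proj₁ descended)
    (λ k fixed → ≡.subst (_∣ℕ k) N≡suc
      (large-period I.irreducible I.hasDeg X.root I.N≡ degrees (proj₂ descended) k fixed))
  where
  open TransformData D using (f; h; t)
  open Rational R
  open HomogeneousSubstitution K using (iterate; iterate-hasDeg)
  module I = IrreducibleNonPower (iterate-irreducibleNonPower L D P m)
  X : RootExtension L _ (suc I.d)
  X = adjoinRoot L I.irreducible I.hasDeg
  module X = RootExtension X
  open Tower K L ι ι-homomorphism X.field′ X.j X.homomorphism using (j∘ι-homomorphism)
  open Descent K L ι ι-homomorphism D R X.field′ X.j X.homomorphism

  descended : Descends (iterate f₀ h₀ t (suc n) g m) (suc n) X.β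
  descended = descends g-irr hg r∣ιg P m X.root

  N≡suc : suc n ℕ.* t ℕ.^ m ≡ suc (ℕ.pred (suc n ℕ.* t ℕ.^ m))
  N≡suc = ≡.sym (ℕₚ.suc-pred (suc n ℕ.* t ℕ.^ m) {{ℕₚ.m*n≢0 (suc n) (t ℕ.^ m) {{_}} {{ℕₚ.m^n≢0 t m}}}})

-- From the hypotheses of the theorem to the invariant.

-- The numerator is nonzero because 0 is an ℓ-th power and t ≥ 2 has a prime divisor ℓ. If the m-th
-- powers of numerator and denominator agreed, the m-th power of the quotient would be 1, making it
-- an ℓ-th power.
nonPower-intro : ∀ {a ℓ₁ ℓ₂ Q} (L : FiniteField a ℓ₁ ℓ₂ Q) {θ θ′ n t} → Q ≡ suc n → 2 ℕ.≤ t → ∀ {r} →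
  let module L = FieldProperties L
      open Polynomial L using (eval)
  in
  eval r (L.- θ) L.≉ L.0# → (∀ ℓ → Prime ℓ → ℓ ∣ℕ t → ¬ ((eval r (L.- θ′) L./ eval r (L.- θ)) L.IsPower ℓ)) → NonPower L θ θ′ n t r
nonPower-intro L {θ} {θ′} Q≡ 2≤t {r} y≉0 ¬power = record
  { numerator≉0   = λ x≈0 → let ℓ , ℓ-prime , ℓ∣t = prime-divisor 2≤t in
      ¬power ℓ ℓ-prime ℓ∣t (L.0# , L.trans (0^prime ℓ-prime) (L.sym (L.trans (L.*-congʳ x≈0) (L.zeroˡ _))))
  ; denominator≉0 = y≉0
  ; separated     = λ ℓ m ℓ-prime ℓ∣t n₀≡ xᵐ≈yᵐ → PowerResidue.ρ^m≈1⇒power L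
      (ℕ.>-nonZero⁻¹ ℓ {{prime⇒nonZero ℓ-prime}}) (≡.trans Q≡ (≡.cong suc n₀≡))
      (begin
        (x L.* y L.⁻¹) L.^ m          ≈⟨ L.^-distrib-* x _ m ⟩
        x L.^ m L.* (y L.⁻¹) L.^ m    ≈⟨ L.*-congʳ xᵐ≈yᵐ ⟩
        y L.^ m L.* (y L.⁻¹) L.^ m    ≈⟨ L.^-distrib-* y _ m ⟨
        (y L.* y L.⁻¹) L.^ m          ≈⟨ L.^-congˡ m (L.inverseʳ y≉0) ⟩
        L.1# L.^ m                    ≈⟨ L.1^ m ⟩
        L.1#                          ∎)
      (¬power ℓ ℓ-prime ℓ∣t) }
  where
  module L = FieldProperties L
  open Polynomial L using (eval)
  open import Relation.Binary.Reasoning.Setoid L.setoid using (begin_; step-≈-⟩; step-≈-⟨; _∎)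
  x = eval r (L.- θ′)
  y = eval r (L.- θ)

  0^prime : ∀ {ℓ} → Prime ℓ → L.0# L.^ ℓ L.≈ L.0#
  0^prime {zero}  p = ⊥-elim (ℕ.≢-nonZero⁻¹ 0 {{prime⇒nonZero p}} ≡.refl)
  0^prime {suc ℓ} _ = L.0^suc ℓ L.refl

open import Data.Nat using (ℕ; _^_; _*_; _∸_; _≤_)
open import Data.Nat.Divisibility using (_∣_; _∤_)
open import Data.Nat.Primality using (Prime)
open import Data.Product using (_×_; ∃-syntax)
open import Data.Sum using (_⊎_)
open import Relation.Binary.PropositionalEquality using (_≡_)
open import Relation.Nullary using (¬_)

theorem5p3 :
  ∀ {a ℓ₁ ℓ₂ b ℓ₃ ℓ₄} (q : ℕ)
  (K : FiniteField a ℓ₁ ℓ₂ q) (L : FiniteField b ℓ₃ ℓ₄ (q ^ 2))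
  (ι : FiniteField.Carrier K → FiniteField.Carrier L) →
  let module K = FiniteField K
      module L = FiniteField L
      module K[x] = Polynomial K
      module L[x] = Polynomial L
      open Extension K L ι
  in
  IsRingHomomorphism ι →
  (c : K.Carrier) → K[x].Irreducible (K[x].x²-x- c) →
  (θ : L.Carrier) → L[x].eval (ι[x] (K[x].x²-x- c)) θ L.≈ L.0# →
  (t : ℕ) → 2 ≤ t → (∀ ℓ → Prime ℓ → ℓ ∣ t → ℓ ∣ q ^ 2 ∸ 1) →
  let open Transform L q t θ in
  (n : ℕ) (g : K[x].Poly) → K[x].Irreducible g → K[x].deg g ≡ n →
  L[x].eval (ι[x] g) (L.- θ) L.≉ L.0# →
  (2 ∤ n → ∀ ℓ → Prime ℓ → ℓ ∣ t →
    ¬ ((L[x].eval (ι[x] g) (L.- θ^q) L./ L[x].eval (ι[x] g) (L.- θ)) L.IsPower ℓ)) →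
  (2 ∣ n → ∃[ r ] L[x].Irreducible r × r L[x].∣ ι[x] g ×
    (∀ ℓ → Prime ℓ → ℓ ∣ t →
      ¬ ((L[x].eval r (L.- θ^q) L./ L[x].eval r (L.- θ)) L.IsPower ℓ))) →
  2 ∤ n ⊎ 4 ∣ n * t →
  ∀ m → IrreducibleInK[x] (iterateQ (ι[x] g) m)
theorem5p3 q K L ι ι-homomorphism c c-irr θ θ-root t@(suc t′) 2≤t primes n g g-irr deg≡n ιg≉0 odd-case even-case _ m =
  -- The polynomial over `K` required by `IrreducibleInK[x]` is the iterate of g under f₀ and h₀.
  IK.iterate K[x].f₀ K[x].h₀ t n g m , IL.at (map-iterate m) , irreducible (2 ℕ∣.∣? n)
  where
  module L = FieldProperties L
  module θ = Generator K L ι ι-homomorphism c-irr θ-root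
  module K[x] = ConjugatePair.Coefficients K L ι ι-homomorphism c θ θ.θ≉conjugate (θ.square θ-root) (θ.square θ.conjugate-root) t
  module IK = HomogeneousSubstitution K
  module IL where
    open PolynomialRing L public
    open PolynomialDivision L public
    open HomogeneousSubstitution L public
  open Transform L q t θ using (f; h; θ^q; iterateQ)
  open Embedding K L ι ι-homomorphism using (map-hasDeg)

  q²≡ : q ^ 2 ≡ suc (q ^ 2 ∸ 1)
  q²≡ = let k , eq = FieldProperties.Q≡suc L in ≡.trans eq (≡.cong (λ Q → suc (Q ∸ 1)) (≡.sym eq))

  D : TransformData L
  D = record
    { n = q ^ 2 ∸ 1 ; Q≡ = q²≡ ; θ = θ ; θ′ = θ^q ; θ≉θ′ = θ.θ≉conjugate ; t′ = t′ ; f = f ; h = h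
    ; f-deg = K[x].f-hasDeg ; h-below = K[x].h-below
    ; rel = K[x].related (θ.square θ-root) ; rel′ = K[x].related (θ.square θ.conjugate-root)
    -- For even t the prime 2 divides q² - 1, which is therefore divisible by 4.
    ; primes = primes ; four = λ 2∣t → square-minus-one {q} q²≡ (primes 2 prime[2] 2∣t) }

  R : Rational K L ι D
  R = record
    { f₀ = K[x].f₀ ; h₀ = K[x].h₀ ; map-f₀ = K[x].map-f₀ ; map-h₀ = K[x].map-h₀
    ; f₀-deg = K[x].f₀-hasDeg ; h₀-below = K[x].h₀-below }

  n₁ : ℕ
  n₁ = proj₁ (PolynomialDivision.irreducible-hasDeg K g-irr)

  hg₁ : PolynomialDivision.HasDeg K g (suc n₁)
  hg₁ = proj₂ (PolynomialDivision.irreducible-hasDeg K g-irr)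

  n≡ : n ≡ suc n₁
  n≡ = ≡.trans (≡.sym deg≡n) (PolynomialDivision.deg≡ K hg₁)

  hg : PolynomialDivision.HasDeg K g n
  hg = ≡.subst (PolynomialDivision.HasDeg K g) (≡.sym n≡) hg₁

  map-iterate : ∀ m → map ι (IK.iterate K[x].f₀ K[x].h₀ t n g m) IL.≋ iterateQ (map ι g) m
  map-iterate zero    = IL.P.refl
  map-iterate (suc m) = K[x].map-step (IK.iterate-hasDeg K[x].f₀-hasDeg K[x].h₀-below hg m) (map-iterate m)

  conclude : ∀ {r d} → IL.Irreducible r → IL.HasDeg r (suc d) → NonPower L θ θ^q (q ^ 2 ∸ 1) t r → IL.Divides r (map ι g) →
    suc d ≡ suc n₁ ⊎ (2 ∣ suc n₁ × suc n₁ ∣ 2 * suc d) → Polynomial.Irreducible K (IK.iterate K[x].f₀ K[x].h₀ t n g m)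
  conclude r-irr hr nonPower r∣ιg degrees = ≡.subst (λ n → Polynomial.Irreducible K (IK.iterate K[x].f₀ K[x].h₀ t n g m)) (≡.sym n≡)
    (iterate-irreducible K L ι ι-homomorphism D R g-irr hg₁ r∣ιg
      record { N≡ = ≡.refl ; irreducible = r-irr ; hasDeg = hr ; nonPower = nonPower } degrees m)

  irreducible : Dec (2 ∣ n) → Polynomial.Irreducible K (IK.iterate K[x].f₀ K[x].h₀ t n g m)
  -- For odd n the polynomial g stays irreducible over `L` and serves as its own factor r.
  irreducible (no 2∤n) = conclude
    (odd-degree-irreducible K L ι ι-homomorphism g-irr hg₁ (λ 2∣n → 2∤n (≡.subst (2 ∣_) (≡.sym n≡) 2∣n)))
    (map-hasDeg hg₁) (nonPower-intro L q²≡ 2≤t {map ι g} ιg≉0 (odd-case 2∤n))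
    ((L.1# ∷ []) , IL.P.sym (IL.P.*-identityˡ (map ι g))) (inj₁ ≡.refl)
  irreducible (yes 2∣n) with even-case 2∣n
  ... | r , r-irr , (k , kr≈ιg) , ¬power with IL.irreducible-hasDeg r-irr
  ...   | d , hr = conclude r-irr hr (nonPower-intro L q²≡ 2≤t {r} r≉0 ¬power) r∣ιg
    (inj₂ (≡.subst (2 ∣_) n≡ 2∣n , factor-degree K L ι ι-homomorphism g-irr hg₁ r-irr hr r∣ιg))
    where
    open Evaluation L
    r∣ιg : IL.Divides r (map ι g)
    r∣ιg = k , IL.P.sym IL.⟪ kr≈ιg ⟫
    -- The value g(-θ) ≠ 0 is a multiple of r(-θ), because r divides g.
    r≉0 : IL.eval r (L.- θ) L.≉ L.0#
    r≉0 r≈0 = ιg≉0 (L.trans (eval-cong (proj₂ r∣ιg))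
      (L.trans (eval-* k r (L.- θ)) (L.trans (L.*-congˡ r≈0) (L.zeroʳ _))))
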